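{- Swap Bribery for $k$-approval (with $k$ part of the input), restricted to instances with only one vote, is W[1]-hard when parameterized by $k$.
   Context: Elections. An election consists of a set $C=\{c_1,\dots,c_m\}$ of candidates and votes $V=\{v_1,\dots,v_n\}$; each vote is a strict linear order over $C$, and $\mathrm{rank}(c,v)$ is the position of $c$ in $v$ (position $1$ is best). In $k$-approval, a candidate $c$ receives one point from $v$ if $\mathrm{rank}(c,v)\le k$ and zero points otherwise; the winners are all candidates with the highest total number of points (ties are allowed, so there may be several winners). Swaps. A swap in a vote $v$ is a triple $(v,a,b)$ with $a,b\in C$, $a\ne b$. It is admissible in $v$ if $\mathrm{rank}(a,v)=\mathrm{rank}(b,v)-1$; applying it exchanges the positions of $a$ and $b$ in $v$. A set $\Gamma$ of swaps is admissible in $v$ if its elements can be applied to $v$ one after the other in some order, each being admissible in the vote obtained so far; the resulting vote is $v^{\Gamma}$. This extends vote by vote to several votes, the resulting votes being denoted $V^{\Gamma}$. Swap Bribery for an election system $\mathcal{E}$: given an $\mathcal{E}$-election $(C,V)$, a preferred candidate $p\in C$, a cost function assigning to each possible swap in each vote a non-negative integer, and a budget $\beta\in\mathbb{N}$, decide whether there is an admissible set $\Gamma$ of swaps of total cost at most $\beta$ such that $p$ is a winner in the $\mathcal{E}$-election $(C,V^{\Gamma})$. W[1]-hardness is with respect to parameterized reductions: $(I,\kappa)$ is mapped in time $f(\kappa)\cdot|I|^{O(1)}$, $f$ computable, to an equivalent instance $(I',\kappa')$ with $\kappa'$ depending only on $\kappa$. -}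

module Defs where

open import Data.Bool using (Bool; true; false; not; if_then_else_)
open import Data.Fin using (Fin; zero; suc; toℕ)
open import Data.Fin.Permutation using (Permutation′; _⟨$⟩ʳ_; _⟨$⟩ˡ_; transpose; _∘ₚ_)
open import Data.Fin.Subset using (Subset; ∣_∣)
open import Data.List using (List; []; _∷_; map; foldr; length; tabulate; all; any)
open import Data.List.Relation.Binary.Permutation.Propositional using (_↭_)
open import Data.List.Relation.Unary.Unique.Propositional using (Unique)
open import Data.Nat using (ℕ; zero; suc; _+_; _*_; _^_; _⊔_; _≤_; _≤ᵇ_; _<ᵇ_)
open import Data.Nat.Binary using (ℕᵇ; zero; 2[1+_]; 1+[2_]; fromℕ)
open import Data.Nat.ListAction using (sum)
open import Data.Product using (Σ; ∃; ∃-syntax; _×_; _,_; proj₁)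
open import Data.Vec using (lookup)
open import Data.Vec.Functional using (Vector; updateAt)
open import Function using (_∘_; _⇔_)
open import Relation.Binary.PropositionalEquality using (_≡_)

------------------------------------------------------------------------
-- Machine model: a WHILE language over binary trees, in combinator form
-- (after Jones, "Computability and Complexity from a Programming
-- Perspective").

data Tree : Set where
  leaf : Tree
  node : Tree → Tree → Tree

size : Tree → ℕ
size leaf       = 1
size (node l r) = suc (size l + size r)

data Prog : Set where
  id nil hd tl : Prog
  cons         : Prog → Prog → Prog
  _⨾_          : Prog → Prog → Prog
  cond         : Prog → Prog → Prog → Prog
  while        : Prog → Prog → Prog

infixr 6 _⨾_
infix 4 _∙_⇓_⟨_⟩

-- P ∙ x ⇓ y ⟨ t ⟩ : on input x, program P halts with output y in time t.
-- In tests, leaf is false and every node is true.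
--
-- Primitives, and leaving a loop, cost the size of the argument, not one
-- unit: a tree built by sharing subtrees can be exponentially larger than
-- the number of steps.  Charging for size gives  size y ≤ t  always, and
-- makes time polynomially related to Turing machine time.
data _∙_⇓_⟨_⟩ : Prog → Tree → Tree → ℕ → Set where
  ⇓id         : ∀ {x} → id ∙ x ⇓ x ⟨ size x ⟩
  ⇓nil        : ∀ {x} → nil ∙ x ⇓ leaf ⟨ size x ⟩
  ⇓hd-leaf    : hd ∙ leaf ⇓ leaf ⟨ 1 ⟩
  ⇓hd-node    : ∀ {l r} → hd ∙ node l r ⇓ l ⟨ size (node l r) ⟩
  ⇓tl-leaf    : tl ∙ leaf ⇓ leaf ⟨ 1 ⟩
  ⇓tl-node    : ∀ {l r} → tl ∙ node l r ⇓ r ⟨ size (node l r) ⟩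
  ⇓cons       : ∀ {P Q x y z s t} →
                P ∙ x ⇓ y ⟨ s ⟩ → Q ∙ x ⇓ z ⟨ t ⟩ →
                cons P Q ∙ x ⇓ node y z ⟨ suc (s + t) ⟩
  ⇓⨾          : ∀ {P Q x y z s t} →
                P ∙ x ⇓ y ⟨ s ⟩ → Q ∙ y ⇓ z ⟨ t ⟩ →
                P ⨾ Q ∙ x ⇓ z ⟨ suc (s + t) ⟩
  ⇓cond-true  : ∀ {B P Q x l r y s t} →
                B ∙ x ⇓ node l r ⟨ s ⟩ → P ∙ x ⇓ y ⟨ t ⟩ →
                cond B P Q ∙ x ⇓ y ⟨ suc (s + t) ⟩
  ⇓cond-false : ∀ {B P Q x y s t} →
                B ∙ x ⇓ leaf ⟨ s ⟩ → Q ∙ x ⇓ y ⟨ t ⟩ →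
                cond B P Q ∙ x ⇓ y ⟨ suc (s + t) ⟩
  ⇓while-stop : ∀ {B P x s} →
                B ∙ x ⇓ leaf ⟨ s ⟩ →
                while B P ∙ x ⇓ x ⟨ s + size x ⟩
  ⇓while-step : ∀ {B P x l r y z s t u} →
                B ∙ x ⇓ node l r ⟨ s ⟩ → P ∙ x ⇓ y ⟨ t ⟩ → while B P ∙ y ⇓ z ⟨ u ⟩ →
                while B P ∙ x ⇓ z ⟨ suc (s + t + u) ⟩

unary : ℕ → Tree
unary zero    = leaf
unary (suc n) = node leaf (unary n)

-- The digits of the zeroless (bijective) binary numeral, low digit first;
-- the size is logarithmic in the number.
binary : ℕ → Tree
binary = digits ∘ fromℕ
  where
  digits : ℕᵇ → Tree
  digits zero     = leaf
  digits 2[1+ b ] = node leaf (digits b)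
  digits 1+[2 b ] = node (node leaf leaf) (digits b)

listTree : List Tree → Tree
listTree = foldr node leaf

Computable : (ℕ → ℕ) → Set
Computable f = ∃[ P ] ∀ n → ∃[ t ] P ∙ unary n ⇓ unary (f n) ⟨ t ⟩

------------------------------------------------------------------------
-- Parameterized problems and reductions

record Problem : Set₁ where
  field
    Instance : Set
    code     : Instance → Tree
    param    : Instance → ℕ
    Yes      : Instance → Set

  -- What a machine reads and writes.  The parameter need not be
  -- recoverable from the code alone.
  input : Instance → Tree
  input I = node (code I) (unary (param I))

open Problem

restrict : (A : Problem) → (Instance A → Set) → Problem
restrict A R = record
  { Instance = Σ (Instance A) R
  ; code     = code A ∘ proj₁
  ; param    = param A ∘ proj₁
  ; Yes      = Yes A ∘ proj₁
  }

infix 4 _≤fpt_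

record _≤fpt_ (A B : Problem) : Set where
  field
    program      : Prog
    f g          : ℕ → ℕ
    c            : ℕ
    f-computable : Computable f
    g-computable : Computable g
    reduces      : ∀ I → ∃[ J ] ∃[ t ]
      program ∙ input A I ⇓ input B J ⟨ t ⟩
      × t ≤ f (param A I) * size (code A I) ^ c
      × (Yes A I ⇔ Yes B J)
      × param B J ≡ g (param A I)

------------------------------------------------------------------------
-- Boolean circuits and the W-hierarchy

-- A gate that reads its inputs among j earlier nodes.
data Gate (j : ℕ) : Set where
  NOT    : Fin j → Gate j
  AND OR : List (Fin j) → Gate j

-- Circuit n j : n input variables and j nodes in all, in topological order.
-- Nodes are numbered like de Bruijn indices: in C ▹ g, node zero is g and
-- node suc i is node i of C.
data Circuit (n : ℕ) : ℕ → Set where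
  inputs : Circuit n n
  _▹_    : ∀ {j} → Circuit n j → Gate j → Circuit n (suc j)

infixl 5 _▹_

fanIn : ∀ {j} → Gate j → List (Fin j)
fanIn (NOT i)  = i ∷ []
fanIn (AND is) = is
fanIn (OR is)  = is

gateValue : ∀ {j} → Gate j → (Fin j → Bool) → Bool
gateValue (NOT i)  v = not (v i)
gateValue (AND is) v = all v is
gateValue (OR is)  v = any v is

-- The value of a node when exactly the variables in S are true.
value : ∀ {n j} → Circuit n j → Subset n → Fin j → Bool
value inputs  S i       = lookup S i
value (C ▹ g) S zero    = gateValue g (value C S)
value (C ▹ g) S (suc i) = value C S i

-- The greatest total weight of the gates on a path ending in a node.
longest : (∀ {j} → Gate j → ℕ) → ∀ {n j} → Circuit n j → Fin j → ℕ
longest w inputs  i       = 0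
longest w (C ▹ g) zero    = w g + foldr _⊔_ 0 (map (longest w C) (fanIn g))
longest w (C ▹ g) (suc i) = longest w C i

depth : ∀ {n j} → Circuit n j → Fin j → ℕ
depth = longest (λ _ → 1)

-- Only gates of fan-in greater than two count.
weft : ∀ {n j} → Circuit n j → Fin j → ℕ
weft = longest (λ g → if 2 <ᵇ length (fanIn g) then 1 else 0)

gateCode : ∀ {j} → Gate j → Tree
gateCode (NOT i)  = node (unary 0) (unary (toℕ i))
gateCode (AND is) = node (unary 1) (listTree (map (unary ∘ toℕ) is))
gateCode (OR is)  = node (unary 2) (listTree (map (unary ∘ toℕ) is))

gateCodes : ∀ {n j} → Circuit n j → List Tree
gateCodes inputs  = []
gateCodes (C ▹ g) = gateCode g ∷ gateCodes C

record WCSInstance (t d : ℕ) : Set where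
  field
    {variables nodes} : ℕ
    circuit           : Circuit variables nodes
    output            : Fin nodes
    weight            : ℕ
    weft≤             : weft circuit output ≤ t
    depth≤            : depth circuit output ≤ d

WeightedCircuitSat : ℕ → ℕ → Problem
WeightedCircuitSat t d = record
  { Instance = WCSInstance t d
  ; code     = λ I → let open WCSInstance I in
      node (unary variables) (node (listTree (gateCodes circuit)) (unary (toℕ output)))
  ; param    = WCSInstance.weight
  ; Yes      = λ I → let open WCSInstance I in
      ∃[ S ] ∣ S ∣ ≡ weight × value circuit S output ≡ true
  }

W[_] : ℕ → Problem → Set
W[ t ] A = ∃[ d ] A ≤fpt WeightedCircuitSat t d

W[_]-Hard : ℕ → Problem → Set₁
W[ t ]-Hard A = ∀ L → W[ t ] L → L ≤fpt A

------------------------------------------------------------------------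
-- Elections

-- A linear order on m candidates, as the bijection from candidates to
-- (zero-based) positions.
Vote : ℕ → Set
Vote m = Permutation′ m

rank : ∀ {m} → Fin m → Vote m → ℕ
rank c v = suc (toℕ (v ⟨$⟩ʳ c))

Votes : ℕ → ℕ → Set
Votes n m = Vector (Vote m) n

score : ∀ {n m} → ℕ → Votes n m → Fin m → ℕ
score k V c = sum (tabulate λ i → if rank c (V i) ≤ᵇ k then 1 else 0)

ApprovalWinner : ℕ → ∀ {n m} → Votes n m → Fin m → Set
ApprovalWinner k V p = ∀ c → score k V c ≤ score k V p

------------------------------------------------------------------------
-- Swaps

-- (i , a , b) swaps a and b in vote i.  Triples with a = b are never
-- admissible.
Swap : ℕ → ℕ → Set
Swap n m = Fin n × Fin m × Fin m

Admissible : ∀ {n m} → Swap n m → Votes n m → Set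
Admissible (i , a , b) V = suc (rank a (V i)) ≡ rank b (V i)

apply : ∀ {n m} → Swap n m → Votes n m → Votes n m
apply (i , a , b) V = updateAt V i (transpose a b ∘ₚ_)

infix 4 _⟦_⟧↦_ _^_↦_

data _⟦_⟧↦_ {n m} : Votes n m → List (Swap n m) → Votes n m → Set where
  []  : ∀ {V} → V ⟦ [] ⟧↦ V
  _∷_ : ∀ {V V′ s Δ} → Admissible s V → apply s V ⟦ Δ ⟧↦ V′ → V ⟦ s ∷ Δ ⟧↦ V′

-- Γ, read as a set, is admissible for V and turns it into V′.
_^_↦_ : ∀ {n m} → Votes n m → List (Swap n m) → Votes n m → Set
V ^ Γ ↦ V′ = Unique Γ × ∃[ Δ ] Δ ↭ Γ × V ⟦ Δ ⟧↦ V′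

------------------------------------------------------------------------
-- Swap Bribery

record BriberyInstance : Set where
  field
    {voters candidates} : ℕ
    votes               : Votes voters candidates
    preferred           : Fin candidates
    cost                : Swap voters candidates → ℕ
    budget              : ℕ
    approvals           : ℕ

-- Swap Bribery for k-approval, with k (the field approvals) both part of
-- the input and the parameter.  A vote is coded as its list of candidates,
-- best first; costs and budget are coded in binary.
SwapBribery : Problem
SwapBribery = record
  { Instance = BriberyInstance
  ; code     = λ I → let open BriberyInstance I in
      node (unary candidates)
     (node (listTree (tabulate λ i → listTree (tabulate λ r → unary (toℕ (votes i ⟨$⟩ˡ r)))))
     (node (unary (toℕ preferred))
     (node (listTree (tabulate λ i → listTree (tabulate λ a → listTree (tabulate λ b →
              binary (cost (i , a , b))))))
           (binary budget))))
  ; param    = BriberyInstance.approvals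
  ; Yes      = λ I → let open BriberyInstance I in
      ∃[ Γ ] ∃[ V′ ] votes ^ Γ ↦ V′
                   × sum (map cost Γ) ≤ budget
                   × ApprovalWinner approvals V′ preferred
  }

OneVote : BriberyInstance → Set
OneVote I = BriberyInstance.voters I ≡ 1

{-# OPTIONS --safe #-}

-- Bribing a single vote in which the favourite is last amounts to choosing the
-- set T of candidates that stay ahead of it.  At least the pairs whose order
-- has to be inverted must be swapped, and these suffice, so the cost is a sum
-- over r ∉ T of the cost of (r , favourite) and the costs of (r , t) for t ∈ T
-- behind r.  Prohibitive costs close T under prescribed arcs.
--
-- A node of a circuit with small gates only is a 0/1-valued polynomial.  A
-- large gate asks whether a sum of such polynomials is positive, and Boolean
-- combinations of such questions are decision lists, which are combined by
-- multiplying their entries pairwise.  Scaling every entry of a list beyond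
-- all that follows turns the list into one integer polynomial P of bounded
-- degree that is positive exactly on the accepted sets of variables.
--
-- The candidates are the variables and the tuples of variables of bounded
-- length; keeping a tuple forces its variables to be kept.  Let N be the
-- number of tuples over k variables.  The budget forces N tuples to be kept,
-- at most k + N candidates can be kept, and fewer than k variables do not
-- admit N tuples: so T consists of k variables and all of their tuples.  The
-- cost of a tuple contains the coefficient of its monomial in P, and the
-- budget is met exactly if P is positive on the chosen variables.
module Submission where

open import Data.Bool using (Bool; true; false; not; if_then_else_; T; _∧_; _∨_; _xor_)
open import Data.Bool.Properties using (if-eta; xor-identityʳ; ∧-identityʳ)
open import Data.Fin using (Fin; zero; suc; toℕ; inject₁; fromℕ; _≟_)
open import Data.Fin.Permutation using (_⟨$⟩ʳ_; _⟨$⟩ˡ_; inverseʳ; inverseˡ; transpose) renaming (id to idPerm)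
open import Data.Fin.Properties using (toℕ-injective; toℕ-inject₁; toℕ-fromℕ; toℕ<n)
open import Data.Fin.Subset using (Subset; ∣_∣)
open import Data.Integer as ℤ using (ℤ; 0ℤ; 1ℤ; -1ℤ; +≤+; -≤+; +<+)
import Data.Integer.Properties as ℤₚ
open import Data.List using (List; []; _∷_; _++_; map; foldr; foldl; length; replicate; reverse; concatMap; drop; all; any; tabulate; applyUpTo; upTo; downFrom)
open import Data.List.Membership.Propositional using (_∈_; _∉_)
open import Data.List.Membership.Propositional.Properties using (∈-∃++; ∈-++⁻; ∈-++⁺ʳ; ∈-map⁻; ∈-map⁺; ∈-upTo⁺; ∈-tabulate⁻)
open import Data.List.Properties using (++-assoc; ++-identityʳ; drop-[]; tabulate-cong; ∷-injectiveˡ; ∷-injectiveʳ; length-++; length-downFrom; length-map; length-replicate; length-reverse; length-upTo; map-++; map-cong; map-id; map-tabulate; map-upTo; map-∘; reverse-downFrom; reverse-foldl; unfold-reverse)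
open import Data.List.Relation.Binary.Permutation.Propositional using (↭-refl)
open import Data.List.Relation.Binary.Permutation.Propositional.Properties using (∈-resp-↭)
open import Data.List.Relation.Unary.All as All using (All; []; _∷_)
import Data.List.Relation.Unary.All.Properties as Allₚ
open import Data.List.Relation.Unary.AllPairs using ([]; _∷_)
open import Data.List.Relation.Unary.Any using (here; there)
open import Data.List.Relation.Unary.Unique.Propositional using (Unique)
import Data.List.Relation.Unary.Unique.Propositional.Properties as Uniqueₚ
open import Data.Nat using (ℕ; zero; suc; _+_; _*_; _^_; _∸_; _⊔_; _≤_; _<_; _≡ᵇ_; _≤ᵇ_; _<ᵇ_; z≤n; s≤s; s≤s⁻¹)
open import Data.Nat.Binary using (ℕᵇ; 2[1+_]; 1+[2_]) renaming (zero to 0ᵇ; suc to sucᵇ; toℕ to toℕᵇ; fromℕ to fromℕᵇ)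
open import Data.Nat.Binary.Properties using (fromℕ-toℕ; toℕ-suc) renaming (toℕ-fromℕ to toℕᵇ-fromℕᵇ)
open import Data.Nat.ListAction using (sum)
open import Data.Nat.ListAction.Properties using (sum-++)
open import Data.Nat.Properties hiding (_≟_)
open import Data.Nat.Solver using (module +-*-Solver)
open import Data.Product using (∃; ∃-syntax; _×_; _,_; proj₁; proj₂)
open import Data.Sum using (_⊎_; inj₁; inj₂; [_,_])
open import Data.Unit using (⊤; tt)
open import Data.Vec as Vec using (lookup)
open import Data.Vec.Properties using (lookup∘tabulate)
open import Function using (_∘_; const; mk⇔; _⇔_; Equivalence)
open import Relation.Binary.PropositionalEquality using (_≡_; _≢_; refl; sym; trans; cong; cong₂; subst; subst₂; module ≡-Reasoning)
open import Relation.Nullary using (yes; no; contradiction)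
open import Relation.Nullary.Decidable using (dec-true; dec-false)
open import Defs

-- Polynomial-time functions between encoded types

-- W[1] is given by circuits of weft 1 and constant depth, so every such circuit has to be treated;
-- no normal form and no hardness of cliques is presupposed. Weft 1 means that a path meets at most
-- one large gate: below it every node is a 0/1-valued polynomial of degree at most `2 ^ d`, above
-- it every gate has at most two inputs. The sum at a large gate is no longer 0/1-valued, which is
-- why only its positivity is passed on.
--
-- Costs cannot be negative, so the two signs of coefficients need different places. A positive
-- coefficient is paid for dropping the tuple, a negative one for keeping it: the candidate `toll`
-- starts ahead of the tuples, has to leave, and pays for each kept tuple that it passes. Dummies in
-- front of `toll` ensure that it cannot stay.
--
-- A tuple is kept only with all its variables, so the number of kept variables limits the number of
-- kept tuples. This limit turns the inequalities for the budget and for the places ahead of the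
-- favourite into equalities.

infixr 7 _`×_
infixr 6 _`⊎_

data Ty : Set where
  unit bool nat bin : Ty
  _`×_ _`⊎_         : Ty → Ty → Ty
  list              : Ty → Ty

⟦_⟧ : Ty → Set
⟦ unit ⟧   = ⊤
⟦ bool ⟧   = Bool
⟦ nat ⟧    = ℕ
⟦ bin ⟧    = ℕ
⟦ A `× B ⟧ = ⟦ A ⟧ × ⟦ B ⟧
⟦ A `⊎ B ⟧ = ⟦ A ⟧ ⊎ ⟦ B ⟧
⟦ list A ⟧ = List ⟦ A ⟧

enc : ∀ A → ⟦ A ⟧ → Tree
enc unit     _        = leaf
enc bool     false    = leaf
enc bool     true     = node leaf leaf
enc nat      n        = unary n
enc bin      n        = binary n
enc (A `× B) (a , b)  = node (enc A a) (enc B b)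
enc (A `⊎ B) (inj₁ a) = node leaf (enc A a)
enc (A `⊎ B) (inj₂ b) = node (node leaf leaf) (enc B b)
enc (list A) l        = listTree (map (enc A) l)

sz : ∀ A → ⟦ A ⟧ → ℕ
sz A a = size (enc A a)

size≥1 : ∀ x → 1 ≤ size x
size≥1 leaf       = s≤s z≤n
size≥1 (node _ _) = s≤s z≤n

size≤time : ∀ {P x y t} → P ∙ x ⇓ y ⟨ t ⟩ → size y ≤ t
size≤time ⇓id               = ≤-refl
size≤time (⇓nil {x})        = size≥1 x
size≤time ⇓hd-leaf          = ≤-refl
size≤time ⇓hd-node          = m≤n⇒m≤1+n (m≤m+n _ _)
size≤time ⇓tl-leaf          = ≤-refl
size≤time (⇓tl-node {l})    = m≤n⇒m≤1+n (m≤n+m _ (size l))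
size≤time (⇓cons p q)       = s≤s (+-mono-≤ (size≤time p) (size≤time q))
size≤time (⇓⨾ {s = s} p q)  = m≤n⇒m≤1+n (≤-trans (size≤time q) (m≤n+m _ s))
size≤time (⇓cond-true {s = s} p q)  = m≤n⇒m≤1+n (≤-trans (size≤time q) (m≤n+m _ s))
size≤time (⇓cond-false {s = s} p q) = m≤n⇒m≤1+n (≤-trans (size≤time q) (m≤n+m _ s))
size≤time (⇓while-stop {s = s} p)   = m≤n+m _ s
size≤time (⇓while-step {s = s} {t} p q r) = m≤n⇒m≤1+n (≤-trans (size≤time r) (m≤n+m _ (s + t)))

-- Polynomial bounds

infixl 6 _⊕_
infixl 7 _⊗_
infixr 9 _⊚_

-- Bounds are syntax closed under composition, so that a composed program gets its bound without
-- computation; monotonicity and the form `a * n ^ c` are proved once for all of them.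
data Bound : Set where
  var         : Bound
  con         : ℕ → Bound
  _⊕_ _⊗_ _⊚_ : Bound → Bound → Bound

eval : Bound → ℕ → ℕ
eval var     n = n
eval (con c) n = c
eval (b ⊕ c) n = eval b n + eval c n
eval (b ⊗ c) n = eval b n * eval c n
eval (b ⊚ c) n = eval b (eval c n)

eval-mono : ∀ b {m n} → m ≤ n → eval b m ≤ eval b n
eval-mono var     p = p
eval-mono (con c) p = ≤-refl
eval-mono (b ⊕ c) p = +-mono-≤ (eval-mono b p) (eval-mono c p)
eval-mono (b ⊗ c) p = *-mono-≤ (eval-mono b p) (eval-mono c p)
eval-mono (b ⊚ c) p = eval-mono b (eval-mono c p)

^≥1 : ∀ {n} → 1 ≤ n → ∀ c → 1 ≤ n ^ c
^≥1 {n} p c = ≤-trans (≤-reflexive (sym (^-zeroˡ c))) (^-monoˡ-≤ c p)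

^-exponent-mono : ∀ {n} → 1 ≤ n → ∀ {c d} → c ≤ d → n ^ c ≤ n ^ d
^-exponent-mono {suc n} p q = ^-monoʳ-≤ (suc n) q

^-*-distrib : ∀ m n c → (m * n) ^ c ≡ m ^ c * n ^ c
^-*-distrib m n zero    = refl
^-*-distrib m n (suc c) = begin
  m * n * (m * n) ^ c       ≡⟨ cong (m * n *_) (^-*-distrib m n c) ⟩
  m * n * (m ^ c * n ^ c)   ≡⟨ [m*n]*[o*p]≡[m*o]*[n*p] m n (m ^ c) (n ^ c) ⟩
  m * m ^ c * (n * n ^ c)   ∎
  where open ≡-Reasoning

eval-polynomial : ∀ b → ∃[ a ] ∃[ c ] ∀ n → 1 ≤ n → eval b n ≤ a * n ^ c
eval-polynomial var = 1 , 1 , λ n p → ≤-reflexive (sym (trans (*-identityˡ _) (*-identityʳ n)))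
eval-polynomial (con k) = k , 0 , λ n p → ≤-reflexive (sym (*-identityʳ k))
eval-polynomial (b ⊕ d) =
  let (a₁ , c₁ , p₁) = eval-polynomial b
      (a₂ , c₂ , p₂) = eval-polynomial d
  in a₁ + a₂ , c₁ + c₂ , λ n p →
     ≤-trans (+-mono-≤ (≤-trans (p₁ n p) (*-monoʳ-≤ a₁ (^-exponent-mono p (m≤m+n c₁ c₂))))
                       (≤-trans (p₂ n p) (*-monoʳ-≤ a₂ (^-exponent-mono p (m≤n+m c₂ c₁)))))
             (≤-reflexive (sym (*-distribʳ-+ (n ^ (c₁ + c₂)) a₁ a₂)))
eval-polynomial (b ⊗ d) =
  let (a₁ , c₁ , p₁) = eval-polynomial b
      (a₂ , c₂ , p₂) = eval-polynomial d
  in a₁ * a₂ , c₁ + c₂ , λ n p →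
     ≤-trans (*-mono-≤ (p₁ n p) (p₂ n p))
             (≤-reflexive (trans ([m*n]*[o*p]≡[m*o]*[n*p] a₁ (n ^ c₁) a₂ (n ^ c₂))
                                 (cong (a₁ * a₂ *_) (sym (^-distribˡ-+-* n c₁ c₂)))))
eval-polynomial (b ⊚ d) =
  let (a₁ , c₁ , p₁) = eval-polynomial b
      (a₂ , c₂ , p₂) = eval-polynomial d
  in a₁ * suc a₂ ^ c₁ , c₂ * c₁ , λ n p →
     -- The bound for `b` holds from 1 on only, and `a₂` may be 0; with `suc a₂` the inner value is
     -- at least 1.
     let q = ≤-trans (p₂ n p) (*-monoˡ-≤ (n ^ c₂) (n≤1+n a₂))
         r = *-mono-≤ (s≤s (z≤n {a₂})) (^≥1 p c₂)
     in ≤-trans (eval-mono b q)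
       (≤-trans (p₁ _ r)
       (≤-reflexive (trans (cong (a₁ *_) (trans (^-*-distrib (suc a₂) (n ^ c₂) c₁)
                                                (cong (suc a₂ ^ c₁ *_) (^-*-assoc n c₂ c₁))))
                           (sym (*-assoc a₁ _ _)))))

-- Combinators for polynomial-time programs

record FP (A B : Ty) (f : ⟦ A ⟧ → ⟦ B ⟧) : Set where
  constructor fp
  field
    prog  : Prog
    bound : Bound
    runs  : ∀ a → ∃[ t ] prog ∙ enc A a ⇓ enc B (f a) ⟨ t ⟩ × t ≤ eval bound (sz A a)

open FP

-- Time bounds the size of the output, so the bound of one program can be fed into the bound of the
-- next.
output≤ : ∀ {A B f} (F : FP A B f) a → sz B (f a) ≤ eval (bound F) (sz A a)
output≤ F a = let (t , d , p) = runs F a in ≤-trans (size≤time d) p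

≗FP : ∀ {A B f g} → (∀ a → f a ≡ g a) → FP A B f → FP A B g
≗FP {A} {B} e F = fp (prog F) (bound F) λ a →
  let (t , d , p) = runs F a in t , subst (λ y → prog F ∙ enc A a ⇓ enc B y ⟨ t ⟩) (e a) d , p

-- A change of type that leaves the tree alone is the identity program. In this way a unary number
-- becomes a list of units and inherits the loops over lists.
recode : ∀ {A B f} → (∀ a → enc A a ≡ enc B (f a)) → FP A B f
recode {A} e = fp id var λ a → _ , subst (λ y → id ∙ enc A a ⇓ y ⟨ sz A a ⟩) (e a) ⇓id , ≤-refl

idF : ∀ {A} → FP A A (λ a → a)
idF = recode (λ _ → refl)

quote′ : Tree → Prog
quote′ leaf       = nil
quote′ (node l r) = cons (quote′ l) (quote′ r)

quoteBound : Tree → Bound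
quoteBound leaf       = var
quoteBound (node l r) = con 1 ⊕ (quoteBound l ⊕ quoteBound r)

quote-runs : ∀ x y → quote′ y ∙ x ⇓ y ⟨ eval (quoteBound y) (size x) ⟩
quote-runs x leaf       = ⇓nil
quote-runs x (node l r) = ⇓cons (quote-runs x l) (quote-runs x r)

constF : ∀ {Γ A} (a : ⟦ A ⟧) → FP Γ A (λ _ → a)
constF {Γ} {A} a = fp (quote′ (enc A a)) (quoteBound (enc A a)) λ γ → _ , quote-runs (enc Γ γ) (enc A a) , ≤-refl

infixr 9 _∘F_

_∘F_ : ∀ {A B C g f} → FP B C g → FP A B f → FP A C (λ a → g (f a))
_∘F_ {f = f} G F = fp (prog F ⨾ prog G) (con 1 ⊕ (bound F ⊕ bound G ⊚ bound F)) λ a →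
  let (s , d , p) = runs F a
      (t , e , q) = runs G (f a)
  in _ , ⇓⨾ d e , s≤s (+-mono-≤ p (≤-trans q (eval-mono (bound G) (output≤ F a))))

infixr 4 _,F_

_,F_ : ∀ {Γ A B f g} → FP Γ A f → FP Γ B g → FP Γ (A `× B) (λ γ → f γ , g γ)
F ,F G = fp (cons (prog F) (prog G)) (con 1 ⊕ (bound F ⊕ bound G)) λ γ →
  let (s , d , p) = runs F γ
      (t , e , q) = runs G γ
  in _ , ⇓cons d e , s≤s (+-mono-≤ p q)

fstF : ∀ {A B} → FP (A `× B) A proj₁
fstF = fp hd var λ _ → _ , ⇓hd-node , ≤-refl

sndF : ∀ {A B} → FP (A `× B) B proj₂
sndF = fp tl var λ _ → _ , ⇓tl-node , ≤-refl

inj₁F : ∀ {Γ A B f} → FP Γ A f → FP Γ (A `⊎ B) (λ γ → inj₁ (f γ))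
inj₁F {B = B} F = fp (prog P) (bound P) (runs P)
  where P = constF {A = unit} tt ,F F

inj₂F : ∀ {Γ A B f} → FP Γ B f → FP Γ (A `⊎ B) (λ γ → inj₂ (f γ))
inj₂F F = fp (prog P) (bound P) (runs P)
  where P = constF {A = bool} true ,F F

infixr 5 _∷F_

_∷F_ : ∀ {Γ A f g} → FP Γ A f → FP Γ (list A) g → FP Γ (list A) (λ γ → f γ ∷ g γ)
F ∷F G = fp (prog P) (bound P) (runs P)
  where P = F ,F G

[]F : ∀ {Γ A} → FP Γ (list A) (λ _ → [])
[]F = constF []

ifF : ∀ {Γ A b f g} → FP Γ bool b → FP Γ A f → FP Γ A g → FP Γ A (λ γ → if b γ then f γ else g γ)
ifF {Γ} {A} {b} {f} {g} B F G = fp (cond (prog B) (prog F) (prog G)) (con 1 ⊕ (bound B ⊕ (bound F ⊕ bound G))) λ γ →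
  let (s , d , p) = runs B γ
      (t , e , q) = runs F γ
      (u , h , r) = runs G γ
  in lemma γ (b γ) d p e q h r
  where
  lemma : ∀ γ b {s t u} → prog B ∙ enc Γ γ ⇓ enc bool b ⟨ s ⟩ → s ≤ eval (bound B) (sz Γ γ) →
          prog F ∙ enc Γ γ ⇓ enc A (f γ) ⟨ t ⟩ → t ≤ eval (bound F) (sz Γ γ) →
          prog G ∙ enc Γ γ ⇓ enc A (g γ) ⟨ u ⟩ → u ≤ eval (bound G) (sz Γ γ) →
          ∃[ t ] cond (prog B) (prog F) (prog G) ∙ enc Γ γ ⇓ enc A (if b then f γ else g γ) ⟨ t ⟩
               × t ≤ eval (con 1 ⊕ (bound B ⊕ (bound F ⊕ bound G))) (sz Γ γ)
  lemma γ true  d p e q h r = _ , ⇓cond-true d e , s≤s (+-mono-≤ p (≤-trans q (m≤m+n _ _)))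
  lemma γ false d p e q h r = _ , ⇓cond-false d h , s≤s (+-mono-≤ p (≤-trans r (m≤n+m _ _)))

caseList : ∀ {A B : Set} → List A → B → (A → List A → B) → B
caseList []       n c = n
caseList (a ∷ as) n c = c a as

-- A nonempty list has the same code as the pair of its head and tail. It therefore serves both as
-- the test and, unchanged, as the extension of the environment.
caseListF : ∀ {Γ A B l n c} → FP Γ (list A) l → FP Γ B n → FP (Γ `× (A `× list A)) B c →
            FP Γ B (λ γ → caseList (l γ) (n γ) (λ a as → c (γ , a , as)))
caseListF {Γ} {A} {B} {l} {n} {c} L N C = fp (cond (prog L) (cons id (prog L) ⨾ prog C) (prog N)) b λ γ →
  let (s , d , p) = runs L γ in lemma γ (l γ) d p
  where
  b : Bound
  b = con 1 ⊕ (bound L ⊕ ((con 1 ⊕ ((con 1 ⊕ (var ⊕ bound L)) ⊕ bound C ⊚ (con 1 ⊕ (var ⊕ bound L)))) ⊕ bound N))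
  lemma : ∀ γ l {s} → prog L ∙ enc Γ γ ⇓ enc (list A) l ⟨ s ⟩ → s ≤ eval (bound L) (sz Γ γ) →
          ∃[ t ] cond (prog L) (cons id (prog L) ⨾ prog C) (prog N) ∙ enc Γ γ
                   ⇓ enc B (caseList l (n γ) (λ a as → c (γ , a , as))) ⟨ t ⟩
               × t ≤ eval b (sz Γ γ)
  lemma γ [] d p = let (t , e , q) = runs N γ in
    _ , ⇓cond-false d e , s≤s (+-mono-≤ p (≤-trans q (m≤n+m _ _)))
  lemma γ (a ∷ as) d p =
    let (t , e , q) = runs C (γ , a , as)
        i = s≤s (+-monoʳ-≤ (sz Γ γ) p)
    in _ , ⇓cond-true d (⇓⨾ (⇓cons ⇓id d) e) ,
       s≤s (+-mono-≤ p (≤-trans (s≤s (+-mono-≤ i (≤-trans q (eval-mono (bound C)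
             (≤-trans (s≤s (+-monoʳ-≤ (sz Γ γ) (size≤time d))) i))))) (m≤m+n _ _)))

caseSumF : ∀ {Γ A B C s f g} → FP Γ (A `⊎ B) s → FP (Γ `× A) C f → FP (Γ `× B) C g →
           FP Γ C (λ γ → [ (λ a → f (γ , a)) , (λ b → g (γ , b)) ] (s γ))
caseSumF {Γ} {A} {B} {C} {s} {f} {g} S F G = fp P b λ γ →
  let (_ , d , p) = runs S γ in lemma γ (s γ) d p
  where
  P : Prog
  P = cond (prog S ⨾ hd) (cons id (prog S ⨾ tl) ⨾ prog G) (cons id (prog S ⨾ tl) ⨾ prog F)
  h c b : Bound
  h = con 1 ⊕ (bound S ⊕ bound S)
  c = con 1 ⊕ (var ⊕ h)
  b = con 1 ⊕ (h ⊕ ((con 1 ⊕ (c ⊕ bound F ⊚ c)) ⊕ (con 1 ⊕ (c ⊕ bound G ⊚ c))))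
  lemma : ∀ γ s {t} → prog S ∙ enc Γ γ ⇓ enc (A `⊎ B) s ⟨ t ⟩ → t ≤ eval (bound S) (sz Γ γ) →
          ∃[ t ] P ∙ enc Γ γ ⇓ enc C ([ (λ a → f (γ , a)) , (λ b → g (γ , b)) ] s) ⟨ t ⟩
               × t ≤ eval b (sz Γ γ)
  lemma γ (inj₁ a) d p =
    let (t , e , q) = runs F (γ , a)
        i = s≤s (+-mono-≤ p (≤-trans (size≤time d) p))
        j = s≤s (+-monoʳ-≤ (sz Γ γ) i)
        k = ⇓cons ⇓id (⇓⨾ d ⇓tl-node)
    in _ , ⇓cond-false (⇓⨾ d ⇓hd-node) (⇓⨾ k e) ,
       s≤s (+-mono-≤ i (≤-trans (s≤s (+-mono-≤ j (≤-trans q (eval-mono (bound F)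
             (≤-trans (size≤time k) j))))) (m≤m+n _ _)))
  lemma γ (inj₂ a) d p =
    let (t , e , q) = runs G (γ , a)
        i = s≤s (+-mono-≤ p (≤-trans (size≤time d) p))
        j = s≤s (+-monoʳ-≤ (sz Γ γ) i)
        k = ⇓cons ⇓id (⇓⨾ d ⇓tl-node)
    in _ , ⇓cond-true (⇓⨾ d ⇓hd-node) (⇓⨾ k e) ,
       s≤s (+-mono-≤ i (≤-trans (s≤s (+-mono-≤ j (≤-trans q (eval-mono (bound G)
             (≤-trans (size≤time k) j))))) (m≤n+m _ (eval (con 1 ⊕ (c ⊕ bound F ⊚ c)) (sz Γ γ)))))

-- Loops over lists

length≤sz : ∀ {A} (l : List ⟦ A ⟧) → length l ≤ sz (list A) l
length≤sz []      = z≤n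
length≤sz {A} (a ∷ l) = s≤s (≤-trans (length≤sz l) (m≤n+m _ (sz A a)))

sz-++ : ∀ {A} (l m : List ⟦ A ⟧) → sz (list A) (l ++ m) ≤ sz (list A) l + sz (list A) m
sz-++ []      m = n≤1+n _
sz-++ {A} (a ∷ l) m = s≤s (≤-trans (+-monoʳ-≤ (sz A a) (sz-++ l m)) (≤-reflexive (sym (+-assoc (sz A a) _ _))))

sz-++ʳ : ∀ {A} (l m : List ⟦ A ⟧) → sz (list A) m ≤ sz (list A) (l ++ m)
sz-++ʳ []      m = ≤-refl
sz-++ʳ {A} (a ∷ l) m = m≤n⇒m≤1+n (≤-trans (sz-++ʳ l m) (m≤n+m _ (sz A a)))

sz-++ˡ : ∀ {A} (l m : List ⟦ A ⟧) → sz (list A) l ≤ sz (list A) (l ++ m)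
sz-++ˡ {A} []  m = size≥1 (enc (list A) m)
sz-++ˡ {A} (a ∷ l) m = s≤s (+-monoʳ-≤ (sz A a) (sz-++ˡ l m))

module _ {Γ A B : Ty} {s : ⟦ Γ ⟧ × ⟦ B ⟧ × ⟦ A ⟧ → ⟦ B ⟧} (S : FP (Γ `× B `× A) B s) where

  private
    State : Ty
    State = Γ `× B `× list A

    step : ⟦ Γ ⟧ → ⟦ B ⟧ → ⟦ A ⟧ → ⟦ B ⟧
    step γ b a = s (γ , b , a)

    body : FP (Γ `× B `× A `× list A) State (λ (γ , b , a , l) → γ , s (γ , b , a) , l)
    body = fstF ,F S ∘F (fstF ,F fstF ∘F sndF ,F fstF ∘F sndF ∘F sndF) ,F sndF ∘F sndF ∘F sndF

    test : FP State (list A) (λ (_ , _ , l) → l)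
    test = sndF ∘F sndF

    iterationBound : Bound
    iterationBound = con 1 ⊕ (bound test ⊕ bound body) ⊕ var

    loop : Prog
    loop = while (prog test) (prog body)

    loop-runs : ∀ γ b l n → (∀ l₁ l₂ → l ≡ l₁ ++ l₂ → sz State (γ , foldl (step γ) b l₁ , l₂) ≤ n) →
                ∃[ t ] loop ∙ enc State (γ , b , l) ⇓ enc State (γ , foldl (step γ) b l , []) ⟨ t ⟩
                     × t ≤ suc (length l) * eval iterationBound n
    loop-runs γ b [] n h =
      let (t , d , p) = runs test (γ , b , [])
          q = h [] [] refl
      in _ , ⇓while-stop d ,
         ≤-trans (+-mono-≤ (≤-trans p (eval-mono (bound test) q)) q)
         (≤-trans (m≤n⇒m≤1+n (+-monoˡ-≤ n (m≤m+n _ (eval (bound body) n))))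
                  (≤-reflexive (sym (*-identityˡ (eval iterationBound n)))))
    loop-runs γ b (a ∷ l) n h =
      let (t , d , p) = runs test (γ , b , a ∷ l)
          (u , e , q) = runs body (γ , b , a , l)
          (v , f , r) = loop-runs γ (step γ b a) l n (λ l₁ l₂ eq → h (a ∷ l₁) l₂ (cong (a ∷_) eq))
          i = h [] (a ∷ l) refl
      in _ , ⇓while-step d e f ,
         +-mono-≤ (≤-trans (s≤s (+-mono-≤ (≤-trans p (eval-mono (bound test) i))
                                          (≤-trans q (eval-mono (bound body) i))))
                           (m≤m+n _ n)) r

  -- Every intermediate accumulator is the result for a prefix of the list, so
  -- that a bound on the results bounds the time of all iterations.
  foldlF′ : (q : Bound) → (∀ γ b l → sz B (foldl (step γ) b l) ≤ eval q (sz Γ γ + (sz B b + sz (list A) l))) →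
            FP State B (λ (γ , b , l) → foldl (step γ) b l)
  foldlF′ q h = fp (loop ⨾ tl ⨾ hd) b λ (γ , b , l) → lemma γ b l
    where
    y c b : Bound
    -- A state consists of two pair nodes, the environment, the accumulator and the rest of the
    -- list.
    y = con 2 ⊕ var ⊕ q ⊕ var
    c = (con 1 ⊕ var) ⊗ iterationBound ⊚ y
    b = con 1 ⊕ (c ⊕ (con 1 ⊕ (c ⊕ c)))

    lemma : ∀ γ b₀ l → ∃[ t ] (loop ⨾ tl ⨾ hd) ∙ enc State (γ , b₀ , l) ⇓ enc B (foldl (step γ) b₀ l) ⟨ t ⟩
                             × t ≤ eval b (sz State (γ , b₀ , l))
    lemma γ b₀ l =
      let n = sz State (γ , b₀ , l)
          m = sz Γ γ + (sz B b₀ + sz (list A) l)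
          m≤n : m ≤ n
          m≤n = m≤n⇒m≤1+n (+-monoʳ-≤ (sz Γ γ) (n≤1+n _))
          γ≤n : sz Γ γ ≤ n
          γ≤n = ≤-trans (m≤m+n _ _) m≤n
          l≤n : sz (list A) l ≤ n
          l≤n = ≤-trans (≤-trans (m≤n+m _ (sz B b₀)) (m≤n+m _ (sz Γ γ))) m≤n
          states : ∀ l₁ l₂ → l ≡ l₁ ++ l₂ → sz State (γ , foldl (step γ) b₀ l₁ , l₂) ≤ eval y n
          states l₁ l₂ eq =
            ≤-trans (≤-reflexive (cong suc (+-suc (sz Γ γ) _)))
            (≤-trans (≤-reflexive (cong (2 +_) (sym (+-assoc (sz Γ γ) _ _))))
            (s≤s (s≤s (+-mono-≤ (+-mono-≤ γ≤n
               (≤-trans (h γ b₀ l₁) (eval-mono q (≤-trans (+-monoʳ-≤ (sz Γ γ) (+-monoʳ-≤ (sz B b₀)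
                  (subst (λ z → sz (list A) l₁ ≤ sz (list A) z) (sym eq) (sz-++ˡ l₁ l₂)))) m≤n))))
               (≤-trans (subst (λ z → sz (list A) l₂ ≤ sz (list A) z) (sym eq) (sz-++ʳ l₁ l₂)) l≤n)))))
          (t , d , p) = loop-runs γ b₀ l (eval y n) states
          p′ = ≤-trans p (*-monoˡ-≤ (eval iterationBound (eval y n)) (s≤s (≤-trans (length≤sz l) l≤n)))
          i = ≤-trans (size≤time d) p′
          j = ≤-trans (m≤n⇒m≤1+n (m≤n+m _ (sz Γ γ))) i
      in _ , ⇓⨾ d (⇓⨾ ⇓tl-node ⇓hd-node) , s≤s (+-mono-≤ p′ (s≤s (+-mono-≤ i j)))

foldl-size : ∀ {Γ A B : Ty} (s : ⟦ Γ ⟧ × ⟦ B ⟧ × ⟦ A ⟧ → ⟦ B ⟧) (r : Bound) →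
             (∀ γ b a → sz B (s (γ , b , a)) ≤ sz B b + eval r (sz Γ γ + sz A a)) →
             ∀ γ b l → sz B (foldl (λ b a → s (γ , b , a)) b l)
                     ≤ sz B b + length l * eval r (sz Γ γ + sz (list A) l)
foldl-size s r h γ b [] = m≤m+n _ _
foldl-size {Γ} {A} {B} s r h γ b (a ∷ l) =
  ≤-trans (foldl-size s r h γ _ l)
  (≤-trans (+-mono-≤ (≤-trans (h γ b a) (+-monoʳ-≤ (sz B b) (eval-mono r (+-monoʳ-≤ (sz Γ γ) (m≤n⇒m≤1+n (m≤m+n _ _))))))
                     (*-monoʳ-≤ (length l) (eval-mono r (+-monoʳ-≤ (sz Γ γ) (m≤n⇒m≤1+n (m≤n+m _ (sz A a)))))))
           (≤-reflexive (+-assoc (sz B b) _ _)))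

-- A step may enlarge the accumulator only by an amount that does not depend on the accumulator.
-- This excludes repeated doubling and makes every intermediate result polynomial in the input.
foldlF : ∀ {Γ A B s z l} → FP (Γ `× B `× A) B s → (r : Bound) →
         (∀ γ b a → sz B (s (γ , b , a)) ≤ sz B b + eval r (sz Γ γ + sz A a)) →
         FP Γ B z → FP Γ (list A) l → FP Γ B (λ γ → foldl (λ b a → s (γ , b , a)) (z γ) (l γ))
foldlF {Γ} {A} {B} {s} S r h Z L =
  foldlF′ S (var ⊕ var ⊗ r) (λ γ b l → ≤-trans (foldl-size {Γ} {A} {B} s r h γ b l)
    (+-mono-≤ (≤-trans (m≤m+n _ _) (m≤n+m _ (sz Γ γ)))
              (*-mono-≤ (≤-trans (length≤sz l) (≤-trans (m≤n+m _ (sz B b)) (m≤n+m _ (sz Γ γ))))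
                        (eval-mono r (+-monoʳ-≤ (sz Γ γ) (m≤n+m _ (sz B b)))))))
  ∘F (idF ,F Z ,F L)

consF : ∀ {A} → FP (A `× list A) (list A) (λ (a , l) → a ∷ l)
consF = recode (λ _ → refl)

reverseF : ∀ {Γ A l} → FP Γ (list A) l → FP Γ (list A) (λ γ → reverse (l γ))
reverseF {A = A} L = foldlF {s = λ (_ , b , a) → a ∷ b} (sndF ∘F sndF ∷F fstF ∘F sndF) (con 1 ⊕ var)
  (λ γ b a → ≤-trans (s≤s (≤-trans (≤-reflexive (+-comm (sz A a) _)) (+-monoʳ-≤ (sz (list A) b) (m≤n+m (sz A a) _))))
                     (≤-reflexive (sym (+-suc _ _))))
  []F L

foldrF : ∀ {Γ A B s z l} → FP (Γ `× A `× B) B s → (r : Bound) →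
         (∀ γ a b → sz B (s (γ , a , b)) ≤ sz B b + eval r (sz Γ γ + sz A a)) →
         FP Γ B z → FP Γ (list A) l → FP Γ B (λ γ → foldr (λ a b → s (γ , a , b)) (z γ) (l γ))
foldrF {Γ} {A} {B} {s} {z} {l} S r h Z L =
  ≗FP (λ γ → reverse-foldl (λ b a → s (γ , a , b)) (z γ) (l γ))
  (foldlF {s = λ (γ , b , a) → s (γ , a , b)} (S ∘F (fstF ,F sndF ∘F sndF ,F fstF ∘F sndF)) r
     (λ γ b a → h γ a b) Z (reverseF L))

-- De Bruijn variables of an environment.
v0 : ∀ {Γ A} → FP (Γ `× A) A proj₂
v0 = sndF

v1 : ∀ {Γ A B} → FP ((Γ `× A) `× B) A (λ γ → proj₂ (proj₁ γ))
v1 = sndF ∘F fstF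

appendF : ∀ {Γ A l m} → FP Γ (list A) l → FP Γ (list A) m → FP Γ (list A) (λ γ → l γ ++ m γ)
appendF {A = A} {l} {m} L M =
  ≗FP (λ γ → lemma (l γ) (m γ))
  (foldrF {s = λ (_ , a , b) → a ∷ b} (consF ∘F sndF) (con 1 ⊕ var)
    (λ γ a b → ≤-trans (s≤s (≤-trans (≤-reflexive (+-comm (sz A a) _)) (+-monoʳ-≤ (sz (list A) b) (m≤n+m (sz A a) _))))
                       (≤-reflexive (sym (+-suc _ _)))) M L)
  where
  lemma : ∀ l m → foldr _∷_ m l ≡ l ++ m
  lemma []      m = refl
  lemma (a ∷ l) m = cong (a ∷_) (lemma l m)

mapF : ∀ {Γ A B f l} → FP (Γ `× A) B f → FP Γ (list A) l → FP Γ (list B) (λ γ → map (λ a → f (γ , a)) (l γ))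
mapF {Γ} {A} {B} {f} {l} F L =
  ≗FP (λ γ → lemma γ (l γ))
  (foldrF {s = λ (γ , a , b) → f (γ , a) ∷ b} (F ∘F (fstF ,F fstF ∘F sndF) ∷F sndF ∘F sndF)
    (con 1 ⊕ bound F ⊚ (con 1 ⊕ var))
    (λ γ a b → ≤-trans (≤-reflexive (trans (cong suc (+-comm (sz B (f (γ , a))) _)) (sym (+-suc _ _))))
                       (+-monoʳ-≤ (sz (list B) b) (s≤s (output≤ F (γ , a)))))
    []F L)
  where
  lemma : ∀ γ l → foldr (λ a b → f (γ , a) ∷ b) [] l ≡ map (λ a → f (γ , a)) l
  lemma γ []      = refl
  lemma γ (a ∷ l) = cong (f (γ , a) ∷_) (lemma γ l)

concatMapF : ∀ {Γ A B f l} → FP (Γ `× A) (list B) f → FP Γ (list A) l →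
             FP Γ (list B) (λ γ → concatMap (λ a → f (γ , a)) (l γ))
concatMapF {Γ} {A} {B} {f} {l} F L =
  ≗FP (λ γ → lemma γ (l γ))
  (foldrF {s = λ (γ , a , b) → f (γ , a) ++ b} (appendF (F ∘F (fstF ,F fstF ∘F sndF)) (sndF ∘F sndF))
    (bound F ⊚ (con 1 ⊕ var))
    (λ γ a b → ≤-trans (sz-++ (f (γ , a)) b) (≤-trans (≤-reflexive (+-comm (sz (list B) (f (γ , a))) _))
                       (+-monoʳ-≤ (sz (list B) b) (output≤ F (γ , a)))))
    []F L)
  where
  lemma : ∀ γ l → foldr (λ a b → f (γ , a) ++ b) [] l ≡ concatMap (λ a → f (γ , a)) l
  lemma γ []      = refl
  lemma γ (a ∷ l) = cong (f (γ , a) ++_) (lemma γ l)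

-- Unary arithmetic and comparisons

unary-replicate : ∀ n → unary n ≡ enc (list unit) (replicate n tt)
unary-replicate zero    = refl
unary-replicate (suc n) = cong (node leaf) (unary-replicate n)

unitsF : ∀ {Γ n} → FP Γ nat n → FP Γ (list unit) (λ γ → replicate (n γ) tt)
unitsF N = recode {f = λ n → replicate n tt} unary-replicate ∘F N

countUnitsF : FP (list unit) nat length
countUnitsF = recode lemma
  where
  lemma : ∀ l → enc (list unit) l ≡ unary (length l)
  lemma []      = refl
  lemma (_ ∷ l) = cong (node leaf) (lemma l)

sucF : ∀ {Γ n} → FP Γ nat n → FP Γ nat (λ γ → suc (n γ))
sucF N = fp (prog P) (bound P) (runs P)
  where P = constF {A = unit} tt ,F N

caseNat : ∀ {A : Set} → ℕ → A → (ℕ → A) → A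
caseNat zero    z s = z
caseNat (suc n) z s = s n

caseNatF : ∀ {Γ A n z s} → FP Γ nat n → FP Γ A z → FP (Γ `× nat) A s →
           FP Γ A (λ γ → caseNat (n γ) (z γ) (λ m → s (γ , m)))
caseNatF {n = n} {z} {s} N Z S =
  ≗FP (λ γ → lemma γ (n γ))
  (caseListF (unitsF N) Z (S ∘F (fstF ,F countUnitsF ∘F sndF ∘F sndF)))
  where
  lemma : ∀ γ n → caseList (replicate n tt) (z γ) (λ _ l → s (γ , length l)) ≡ caseNat n (z γ) (λ m → s (γ , m))
  lemma γ zero    = refl
  lemma γ (suc n) = cong (λ m → s (γ , m)) (length-replicate n)

sz-nat : ∀ n → sz nat n ≡ suc (n + n)
sz-nat zero    = refl
sz-nat (suc n) = trans (cong (2 +_) (sz-nat n)) (cong (2 +_) (sym (+-suc n n)))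

sz-suc : ∀ n → sz nat (suc n) ≡ sz nat n + 2
sz-suc n = +-comm 2 (sz nat n)

sz-+ : ∀ m n → sz nat (m + n) ≤ sz nat n + sz nat m
sz-+ zero    n = m≤m+n _ _
sz-+ (suc m) n = ≤-trans (s≤s (s≤s (sz-+ m n))) (≤-reflexive (sym (trans (+-suc _ _) (cong suc (+-suc _ _)))))

addF : ∀ {Γ m n} → FP Γ nat m → FP Γ nat n → FP Γ nat (λ γ → m γ + n γ)
addF {m = m} {n} M N =
  ≗FP (λ γ → lemma (m γ) (n γ))
  (foldrF {s = λ (_ , _ , b) → suc b} (sucF (sndF ∘F sndF)) (con 2) (λ _ _ b → ≤-reflexive (sz-suc b)) N (unitsF M))
  where
  lemma : ∀ m n → foldr (λ _ → suc) n (replicate m tt) ≡ m + n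
  lemma zero    n = refl
  lemma (suc m) n = cong suc (lemma m n)

mulF : ∀ {Γ m n} → FP Γ nat m → FP Γ nat n → FP Γ nat (λ γ → m γ * n γ)
mulF {Γ} {m} {n} M N =
  ≗FP (λ γ → lemma (m γ) (n γ))
  (foldrF {s = λ (γ , _ , b) → n γ + b} (addF (N ∘F fstF) (sndF ∘F sndF)) (bound N)
    (λ γ _ b → ≤-trans (sz-+ (n γ) b) (+-monoʳ-≤ (sz nat b) (≤-trans (output≤ N γ) (eval-mono (bound N) (m≤m+n _ _)))))
    (constF 0) (unitsF M))
  where
  lemma : ∀ m n → foldr (λ _ → n +_) 0 (replicate m tt) ≡ m * n
  lemma zero    n = refl
  lemma (suc m) n = cong (n +_) (lemma m n)

monusF : ∀ {Γ m n} → FP Γ nat m → FP Γ nat n → FP Γ nat (λ γ → m γ ∸ n γ)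
monusF {m = m} {n} M N =
  ≗FP (λ γ → lemma (m γ) (n γ))
  (foldlF {s = λ (_ , b , _) → caseNat b 0 (λ b → b)} (caseNatF (fstF ∘F sndF) (constF 0) sndF) (con 0)
    (λ _ b _ → shrink b) M (unitsF N))
  where
  shrink : ∀ b → sz nat (caseNat b 0 (λ b → b)) ≤ sz nat b + 0
  shrink zero    = ≤-refl
  shrink (suc b) = ≤-trans (m≤n+m _ 2) (m≤m+n _ 0)
  lemma : ∀ m n → foldl (λ b _ → caseNat b 0 (λ b → b)) m (replicate n tt) ≡ m ∸ n
  lemma m       zero    = refl
  lemma zero    (suc n) = trans (lemma zero n) (0∸n≡0 n)
  lemma (suc m) (suc n) = lemma m n

dropF : ∀ {Γ A n l} → FP Γ nat n → FP Γ (list A) l → FP Γ (list A) (λ γ → drop (n γ) (l γ))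
dropF {A = A} {n} {l} N L =
  ≗FP (λ γ → lemma (n γ) (l γ))
  (foldlF {s = λ (_ , b , _) → caseList b [] (λ _ b → b)} (caseListF (fstF ∘F sndF) []F (sndF ∘F sndF)) (con 0)
    (λ _ b _ → shrink b) L (unitsF N))
  where
  shrink : ∀ b → sz (list A) (caseList b [] (λ _ b → b)) ≤ sz (list A) b + 0
  shrink []      = ≤-refl
  shrink (a ∷ b) = ≤-trans (m≤n+m _ (suc (sz A a))) (m≤m+n _ 0)
  lemma : ∀ n l → foldl (λ b _ → caseList b [] (λ _ b → b)) l (replicate n tt) ≡ drop n l
  lemma zero    l       = refl
  lemma (suc n) []      = trans (lemma n []) (drop-[] n)
  lemma (suc n) (_ ∷ l) = lemma n l

lengthF : ∀ {Γ A l} → FP Γ (list A) l → FP Γ nat (λ γ → length (l γ))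
lengthF L = foldrF {s = λ (_ , _ , b) → suc b} (sucF (sndF ∘F sndF)) (con 2) (λ _ _ b → ≤-reflexive (sz-suc b)) (constF 0) L

sumF : ∀ {Γ l} → FP Γ (list nat) l → FP Γ nat (λ γ → sum (l γ))
sumF {Γ} L = foldrF {s = λ (_ , a , b) → a + b} (addF (fstF ∘F sndF) (sndF ∘F sndF)) var
  (λ γ a b → ≤-trans (sz-+ a b) (+-monoʳ-≤ (sz nat b) (m≤n+m _ (sz Γ γ)))) (constF 0) L

notF : ∀ {Γ a} → FP Γ bool a → FP Γ bool (λ γ → not (a γ))
notF {a = a} A = ≗FP (λ γ → lemma (a γ)) (ifF A (constF false) (constF true))
  where
  lemma : ∀ a → (if a then false else true) ≡ not a
  lemma true  = refl
  lemma false = refl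

andF : ∀ {Γ a b} → FP Γ bool a → FP Γ bool b → FP Γ bool (λ γ → a γ ∧ b γ)
andF {a = a} {b} A B = ≗FP (λ γ → lemma (a γ) (b γ)) (ifF A B (constF false))
  where
  lemma : ∀ a b → (if a then b else false) ≡ a ∧ b
  lemma true  b = refl
  lemma false b = refl

orF : ∀ {Γ a b} → FP Γ bool a → FP Γ bool b → FP Γ bool (λ γ → a γ ∨ b γ)
orF {a = a} {b} A B = ≗FP (λ γ → lemma (a γ) (b γ)) (ifF A (constF true) B)
  where
  lemma : ∀ a b → (if a then true else b) ≡ a ∨ b
  lemma true  b = refl
  lemma false b = refl

xorF : ∀ {Γ a b} → FP Γ bool a → FP Γ bool b → FP Γ bool (λ γ → a γ xor b γ)
xorF {a = a} {b} A B = ≗FP (λ γ → lemma (a γ) (b γ)) (ifF A (notF B) B)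
  where
  lemma : ∀ a b → (if a then not b else b) ≡ a xor b
  lemma true  b = refl
  lemma false b = refl

eqF : ∀ {Γ m n} → FP Γ nat m → FP Γ nat n → FP Γ bool (λ γ → m γ ≡ᵇ n γ)
eqF {m = m} {n} M N =
  ≗FP (λ γ → lemma (m γ) (n γ))
  (caseNatF (addF (monusF M N) (monusF N M)) (constF true) (constF false))
  where
  lemma : ∀ m n → caseNat (m ∸ n + (n ∸ m)) true (λ _ → false) ≡ (m ≡ᵇ n)
  lemma zero    zero    = refl
  lemma zero    (suc n) = refl
  lemma (suc m) zero    = refl
  lemma (suc m) (suc n) = lemma m n

member : ℕ → List ℕ → Bool
member x = foldr (λ y b → (x ≡ᵇ y) ∨ b) false

sz-bool : ∀ b → sz bool b ≤ 3
sz-bool true  = ≤-refl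
sz-bool false = s≤s z≤n

memberF : ∀ {Γ x l} → FP Γ nat x → FP Γ (list nat) l → FP Γ bool (λ γ → member (x γ) (l γ))
memberF {x = x} X L = foldrF {s = λ (γ , y , b) → (x γ ≡ᵇ y) ∨ b}
  (orF (eqF (X ∘F fstF) (fstF ∘F sndF)) (sndF ∘F sndF)) (con 3)
  (λ γ y b → ≤-trans (sz-bool ((x γ ≡ᵇ y) ∨ b)) (m≤n+m 3 (sz bool b))) (constF false) L

eqList : List ℕ → List ℕ → Bool
eqList []      []      = true
eqList []      (_ ∷ _) = false
eqList (_ ∷ _) []      = false
eqList (x ∷ l) (y ∷ m) = (x ≡ᵇ y) ∧ eqList l m

-- The accumulator holds the verdict so far and the part of `m` not yet compared. If `m` ends too
-- early the verdict becomes false; if something of it is left over, `finish` rejects.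
eqListF : ∀ {Γ l m} → FP Γ (list nat) l → FP Γ (list nat) m → FP Γ bool (λ γ → eqList (l γ) (m γ))
eqListF {Γ} {l} {m} L M =
  ≗FP (λ γ → lemma (l γ) true (m γ))
  (finish ∘F foldlF {B = bool `× list nat}
    {s = λ (_ , (b , m) , x) → caseList m (false , []) (λ y m → b ∧ (x ≡ᵇ y) , m)}
    (caseListF (sndF ∘F fstF ∘F sndF) (constF false ,F []F)
      (andF (fstF ∘F fstF ∘F sndF ∘F fstF) (eqF (sndF ∘F sndF ∘F fstF) (fstF ∘F sndF)) ,F sndF ∘F sndF))
    (con 3) (λ _ b x → growth b x) (constF true ,F M) L)
  where
  finish : FP (bool `× list nat) bool (λ (b , m) → caseList m b (λ _ _ → false))
  finish = caseListF sndF fstF (constF false)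
  growth : ∀ s x → sz (bool `× list nat) (caseList (proj₂ s) (false , []) (λ y m → proj₁ s ∧ (x ≡ᵇ y) , m))
                   ≤ sz (bool `× list nat) s + 3
  growth (b , [])    x = m≤n+m 3 (sz (bool `× list nat) (b , []))
  growth (b , y ∷ m) x = ≤-trans (s≤s (≤-trans (+-mono-≤ (sz-bool (b ∧ (x ≡ᵇ y))) ≤-refl)
    (≤-trans (≤-reflexive (+-comm 3 _)) (+-monoˡ-≤ 3 (≤-trans (m≤n+m _ (suc (sz nat y))) (m≤n+m _ (sz bool b))))))) ≤-refl
  lemma : ∀ l b m → (let (c , k) = foldl (λ (b , m) x → caseList m (false , []) (λ y m → b ∧ (x ≡ᵇ y) , m)) (b , m) l
                     in caseList k c (λ _ _ → false)) ≡ b ∧ eqList l m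
  lemma []      true  []      = refl
  lemma []      false []      = refl
  lemma []      true  (_ ∷ _) = refl
  lemma []      false (_ ∷ _) = refl
  lemma (x ∷ l) true  []      = lemma l false []
  lemma (x ∷ l) false []      = lemma l false []
  lemma (x ∷ l) true  (y ∷ m) = lemma l (x ≡ᵇ y) m
  lemma (x ∷ l) false (y ∷ m) = lemma l false m

-- The next entry is `length b`. Written as `n ∸ (n ∸ length b)` it is at most `n` for every
-- accumulator, also for those that never occur, as the growth condition of the fold demands.
downFromF : ∀ {Γ n} → FP Γ nat n → FP Γ (list nat) (λ γ → downFrom (n γ))
downFromF {n = n} N =
  ≗FP (λ γ → lemma (n γ) (n γ) ≤-refl)
  (foldrF {s = λ (γ , _ , b) → n γ ∸ (n γ ∸ length b) ∷ b}
    (monusF (N ∘F fstF) (monusF (N ∘F fstF) (lengthF (sndF ∘F sndF))) ∷F sndF ∘F sndF) (con 1 ⊕ bound N)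
    (λ γ _ b → ≤-trans (≤-reflexive (trans (cong suc (+-comm (sz nat (n γ ∸ (n γ ∸ length b))) _)) (sym (+-suc _ _))))
       (+-monoʳ-≤ (sz (list nat) b) (s≤s (≤-trans (sz-∸ (n γ) (n γ ∸ length b)) (≤-trans (output≤ N γ) (eval-mono (bound N) (m≤m+n _ _)))))))
    []F (unitsF N))
  where
  sz-∸ : ∀ m n → sz nat (m ∸ n) ≤ sz nat m
  sz-∸ m n = ≤-trans (≤-reflexive (sz-nat _))
    (≤-trans (s≤s (+-mono-≤ (m∸n≤m m n) (m∸n≤m m n))) (≤-reflexive (sym (sz-nat m))))
  lemma : ∀ n k → k ≤ n → foldr (λ _ b → n ∸ (n ∸ length b) ∷ b) [] (replicate k tt) ≡ downFrom k
  lemma n zero    p = refl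
  lemma n (suc k) p rewrite lemma n k (<⇒≤ p) | length-downFrom k = cong (_∷ downFrom k) (m∸[m∸n]≡n (<⇒≤ p))

upToF : ∀ {Γ n} → FP Γ nat n → FP Γ (list nat) (λ γ → upTo (n γ))
upToF {n = n} N = ≗FP (λ γ → reverse-downFrom (n γ)) (reverseF (downFromF N))

-- Conversion from unary to binary

-- Zeroless binary digits, low digit first; true is the digit 1, false the digit 2.
bits : ℕᵇ → List Bool
bits 0ᵇ       = []
bits 2[1+ b ] = false ∷ bits b
bits 1+[2 b ] = true ∷ bits b

binary-bits : ∀ b → binary (toℕᵇ b) ≡ enc (list bool) (bits b)
binary-bits b with fromℕᵇ (toℕᵇ b) | fromℕ-toℕ b
binary-bits 0ᵇ       | _ | refl = refl
binary-bits 2[1+ b ] | _ | refl = cong (node leaf) (trans lemma (binary-bits b))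
  where
  lemma : _ ≡ binary (toℕᵇ b)
  lemma rewrite fromℕ-toℕ b = refl
binary-bits 1+[2 b ] | _ | refl = cong (node (node leaf leaf)) (trans lemma (binary-bits b))
  where
  lemma : _ ≡ binary (toℕᵇ b)
  lemma rewrite fromℕ-toℕ b = refl

-- A pair of the carry and the reversed list of the digits produced so far.
carryStep : Bool × List Bool → Bool → Bool × List Bool
carryStep (c , o) d = (c ∧ not d) , (if c then not d ∷ o else d ∷ o)

carryEnd : Bool × List Bool → List Bool
carryEnd (c , o) = reverse o ++ (if c then true ∷ [] else [])

increment : List Bool → List Bool
increment l = carryEnd (foldl carryStep (true , []) l)

increment-bits : ∀ b → increment (bits b) ≡ bits (sucᵇ b)
increment-bits = carried []
  where
  settled : ∀ o l → carryEnd (foldl carryStep (false , o) l) ≡ reverse o ++ l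
  settled o []      = refl
  settled o (d ∷ l) = trans (settled (d ∷ o) l)
    (trans (cong (_++ l) (unfold-reverse d o)) (++-assoc (reverse o) (d ∷ []) l))
  carried : ∀ o b → carryEnd (foldl carryStep (true , o) (bits b)) ≡ reverse o ++ bits (sucᵇ b)
  carried o 0ᵇ       = refl
  carried o 2[1+ b ] = trans (carried (true ∷ o) b)
    (trans (cong (_++ bits (sucᵇ b)) (unfold-reverse true o)) (++-assoc (reverse o) (true ∷ []) _))
  carried o 1+[2 b ] = trans (settled (false ∷ o) (bits b))
    (trans (cong (_++ bits b) (unfold-reverse false o)) (++-assoc (reverse o) (false ∷ []) _))

incrementF : FP (list bool) (list bool) increment
incrementF = carryEndF ∘F foldlF {B = bool `× list bool} {s = λ (_ , b , d) → carryStep b d}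
  (carryStepF ∘F sndF) (con 4) (λ _ b d → growth b d) (constF (true , [])) idF
  where
  carryStepF : FP ((bool `× list bool) `× bool) (bool `× list bool) (λ (b , d) → carryStep b d)
  carryStepF = andF (fstF ∘F fstF) (notF sndF)
    ,F ifF (fstF ∘F fstF) (notF sndF ∷F sndF ∘F fstF) (sndF ∷F sndF ∘F fstF)
  carryEndF : FP (bool `× list bool) (list bool) carryEnd
  carryEndF = appendF (reverseF sndF) (ifF fstF (constF (true ∷ [])) (constF []))
  growth : ∀ b d → sz (bool `× list bool) (carryStep b d) ≤ sz (bool `× list bool) b + 4
  growth (true  , o) true  = m≤m+n _ 4
  growth (true  , o) false = +-monoʳ-≤ 4 (≤-reflexive (+-comm 4 (sz (list bool) o)))
  growth (false , o) true  = +-monoʳ-≤ 2 (≤-reflexive (+-comm 4 (sz (list bool) o)))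
  growth (false , o) false = +-monoʳ-≤ 2 (≤-trans (≤-reflexive (+-comm 2 (sz (list bool) o))) (+-monoʳ-≤ _ (m≤m+n 2 2)))

length-increment : ∀ l → length (increment l) ≤ suc (length l)
length-increment l = ≤-trans (end (foldl carryStep (true , []) l)) (≤-reflexive (cong suc (digits (true , []) l)))
  where
  digits : ∀ s l → length (proj₂ (foldl carryStep s l)) ≡ length (proj₂ s) + length l
  digits s           []      = sym (+-identityʳ _)
  digits (true  , o) (d ∷ l) = trans (digits _ l) (sym (+-suc (length o) (length l)))
  digits (false , o) (d ∷ l) = trans (digits _ l) (sym (+-suc (length o) (length l)))
  end : ∀ s → length (carryEnd s) ≤ suc (length (proj₂ s))
  end (true  , o) = ≤-reflexive (trans (length-++ (reverse o)) (trans (+-comm _ 1) (cong suc (length-reverse o))))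
  end (false , o) = m≤n⇒m≤1+n (≤-reflexive (trans (cong length (++-identityʳ (reverse o))) (length-reverse o)))

sz-bools : ∀ l → sz (list bool) l ≤ suc (length l * 4)
sz-bools []      = ≤-refl
sz-bools (b ∷ l) = s≤s (≤-trans (+-mono-≤ (sz-bool b) (sz-bools l)) (≤-reflexive (+-suc 3 _)))

-- Incrementing `n` times is affordable because `n` is given in unary. One increment can lengthen
-- the code of every digit, so its growth is not bounded independently of the accumulator; the
-- number of digits, which grows by at most one, bounds all results instead.
toBinaryF : ∀ {Γ n} → FP Γ nat n → FP Γ bin n
toBinaryF {n = n} N = fp (prog F) (bound F) λ γ →
    let (t , d , p) = runs F γ in t , subst (λ y → prog F ∙ _ ⇓ y ⟨ t ⟩) (encoded (n γ)) d , p
  where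
  grows : ∀ b (l : List ⊤) → length (foldl (λ b _ → increment b) b l) ≤ length b + length l
  grows b []      = m≤m+n _ 0
  grows b (_ ∷ l) = ≤-trans (grows _ l) (≤-trans (+-monoˡ-≤ (length l) (length-increment b)) (≤-reflexive (sym (+-suc _ _))))
  F = foldlF′ {Γ = unit} {A = unit} {B = list bool} {s = λ (_ , b , _) → increment b}
    (incrementF ∘F fstF ∘F sndF) (con 1 ⊕ var ⊗ con 4) (λ _ b l → ≤-trans (sz-bools (foldl (λ b _ → increment b) b l))
      (s≤s (*-monoˡ-≤ 4 (≤-trans (grows b l) (≤-trans (+-mono-≤ (length≤sz b) (length≤sz l)) (n≤1+n _))))))
    ∘F (constF tt ,F constF [] ,F unitsF N)
  counts : ∀ b n → foldl (λ b _ → increment b) (bits b) (replicate n tt) ≡ bits (fromℕᵇ (toℕᵇ b + n))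
  counts b zero    = cong bits (sym (trans (cong fromℕᵇ (+-identityʳ (toℕᵇ b))) (fromℕ-toℕ b)))
  counts b (suc n) = trans (cong (λ c → foldl (λ b _ → increment b) c (replicate n tt)) (increment-bits b))
    (trans (counts (sucᵇ b) n) (cong (λ m → bits (fromℕᵇ m)) (trans (cong (_+ n) (toℕ-suc b)) (sym (+-suc (toℕᵇ b) n)))))
  encoded : ∀ n → enc (list bool) (foldl (λ b _ → increment b) [] (replicate n tt)) ≡ binary n
  encoded n = trans (cong (enc (list bool)) (counts 0ᵇ n))
    (trans (sym (binary-bits (fromℕᵇ n))) (cong binary (toℕᵇ-fromℕᵇ n)))

-- Bribing a single vote

≡⇒T : ∀ {b} → b ≡ true → T b
≡⇒T refl = tt

T⇒≡ : ∀ {b} → T b → b ≡ true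
T⇒≡ {true} _ = refl

sum-middle : ∀ {A : Set} (w : A → ℕ) xs x ys → sum (map w (xs ++ x ∷ ys)) ≡ w x + sum (map w (xs ++ ys))
sum-middle w []       x ys = refl
sum-middle w (z ∷ xs) x ys = trans (cong (w z +_) (sum-middle w xs x ys)) (trans (sym (+-assoc (w z) (w x) _))
  (trans (cong (_+ sum (map w (xs ++ ys))) (+-comm (w z) (w x))) (+-assoc (w x) (w z) _)))

∈-middle⁻ : ∀ {A : Set} {x y : A} xs {ys} → x ∈ xs ++ y ∷ ys → x ≢ y → x ∈ xs ++ ys
∈-middle⁻ []       (here x≡y) x≢y = contradiction x≡y x≢y
∈-middle⁻ []       (there i)  x≢y = i
∈-middle⁻ (z ∷ xs) (here x≡z) x≢y = here x≡z
∈-middle⁻ (z ∷ xs) (there i)  x≢y = there (∈-middle⁻ xs i x≢y)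

-- Each entry of `xs` is removed from `ys` in turn; uniqueness keeps the later ones in place. It
-- yields the lower bound on the cost of a bribery from the swaps it cannot avoid, and with weight 1
-- a pigeonhole principle.
Unique-⊆-sum : ∀ {A : Set} (w : A → ℕ) {xs ys} → Unique xs → (∀ {x} → x ∈ xs → x ∈ ys) →
               sum (map w xs) ≤ sum (map w ys)
Unique-⊆-sum w []       ⊆ = z≤n
Unique-⊆-sum w {x ∷ xs} (x∉ ∷ u) ⊆ with ∈-∃++ (⊆ (here refl))
... | as , bs , refl = ≤-trans
  (+-monoʳ-≤ (w x) (Unique-⊆-sum w u (λ i → ∈-middle⁻ as (⊆ (there i)) (λ eq → All.lookup x∉ i (sym eq)))))
  (≤-reflexive (sym (sum-middle w as x bs)))

sum-const1 : ∀ {A : Set} (xs : List A) → sum (map (const 1) xs) ≡ length xs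
sum-const1 []       = refl
sum-const1 (x ∷ xs) = cong suc (sum-const1 xs)

Unique-⊆-length : ∀ {A : Set} {xs ys : List A} → Unique xs → (∀ {x} → x ∈ xs → x ∈ ys) → length xs ≤ length ys
Unique-⊆-length {xs = xs} {ys} u ⊆ =
  ≤-trans (≤-reflexive (sym (sum-const1 xs))) (≤-trans (Unique-⊆-sum (const 1) u ⊆) (≤-reflexive (sum-const1 ys)))

transpose-fst : ∀ {m} (a b : Fin m) → transpose a b ⟨$⟩ʳ a ≡ b
transpose-fst a b rewrite dec-true (a ≟ a) refl = refl

transpose-snd : ∀ {m} (a b : Fin m) → transpose a b ⟨$⟩ʳ b ≡ a
transpose-snd a b with b ≟ a
... | yes b≡a = b≡a
... | no  _ rewrite dec-true (b ≟ b) refl = refl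

transpose-other : ∀ {m} {a b c : Fin m} → c ≢ a → c ≢ b → transpose a b ⟨$⟩ʳ c ≡ c
transpose-other {a = a} {b} {c} c≢a c≢b rewrite dec-false (c ≟ a) c≢a | dec-false (c ≟ b) c≢b = refl

position : ∀ {m} → Votes 1 m → Fin m → ℕ
position V c = toℕ (V zero ⟨$⟩ʳ c)

position-injective : ∀ {m} (V : Votes 1 m) {a b} → position V a ≡ position V b → a ≡ b
position-injective V eq =
  trans (sym (inverseˡ (V zero))) (trans (cong (V zero ⟨$⟩ˡ_) (toℕ-injective eq)) (inverseˡ (V zero)))

-- Sequences of adjacent swaps

-- A stretch of a vote, read off from position `o` on. Swaps are then followed on lists, without
-- computing with permutations.
data Ranked {C : Set} (f : C → ℕ) : ℕ → List C → Set where
  []  : ∀ {o} → Ranked f o []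
  _∷_ : ∀ {o x xs} → f x ≡ o → Ranked f (suc o) xs → Ranked f o (x ∷ xs)

module _ {C : Set} {f : C → ℕ} where

  Ranked-≥ : ∀ {o} xs {x ys} → Ranked f o (xs ++ x ∷ ys) → o ≤ f x
  Ranked-≥ []       (eq ∷ r) = ≤-reflexive (sym eq)
  Ranked-≥ (z ∷ xs) (eq ∷ r) = <⇒≤ (Ranked-≥ xs r)

  Ranked-next : ∀ {o} xs {a b ys} → Ranked f o (xs ++ a ∷ b ∷ ys) → f b ≡ suc (f a)
  Ranked-next []       (eq ∷ eq′ ∷ r) = trans eq′ (cong suc (sym eq))
  Ranked-next (z ∷ xs) (eq ∷ r)       = Ranked-next xs r

  Ranked-length : ∀ {o} xs {x ys} → Ranked f o (xs ++ x ∷ ys) → f x ≡ o + length xs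
  Ranked-length []       (eq ∷ r) = trans eq (sym (+-identityʳ _))
  Ranked-length (z ∷ xs) (eq ∷ r) = trans (Ranked-length xs r) (sym (+-suc _ _))

  module _ {τ : C → C} {a b : C} (τa : τ a ≡ b) (τb : τ b ≡ a) (τo : ∀ {c} → c ≢ a → c ≢ b → τ c ≡ c) where

    Ranked-after : ∀ {o xs} → f a < o → f b < o → Ranked f o xs → Ranked (f ∘ τ) o xs
    Ranked-after a<o b<o []       = []
    Ranked-after a<o b<o (eq ∷ r) =
      trans (cong f (τo (λ { refl → <-irrefl eq a<o }) (λ { refl → <-irrefl eq b<o }))) eq
      ∷ Ranked-after (m≤n⇒m≤1+n a<o) (m≤n⇒m≤1+n b<o) r

    Ranked-swap : ∀ {o} xs {ys} → Ranked f o (xs ++ a ∷ b ∷ ys) → Ranked (f ∘ τ) o (xs ++ b ∷ a ∷ ys)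
    Ranked-swap [] (eq ∷ eq′ ∷ r) =
      trans (cong f τb) eq ∷ trans (cong f τa) eq′ ∷
      Ranked-after (s≤s (≤-trans (≤-reflexive eq) (n≤1+n _))) (s≤s (≤-reflexive eq′)) r
    Ranked-swap (x ∷ xs) (eq ∷ r) =
      trans (cong f (τo (λ { refl → <-irrefl (sym eq) (Ranked-≥ xs r) })
                        (λ { refl → <-irrefl (sym eq) (<⇒≤ (≤-trans (s≤s (Ranked-≥ xs r)) (≤-reflexive (sym (Ranked-next xs r))))) }))) eq
      ∷ Ranked-swap xs r

module _ {m : ℕ} where

  ⟦⟧-++ : ∀ {U V W : Votes 1 m} {Γ Δ} → U ⟦ Γ ⟧↦ V → V ⟦ Δ ⟧↦ W → U ⟦ Γ ++ Δ ⟧↦ W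
  ⟦⟧-++ []       q = q
  ⟦⟧-++ (a ∷ p) q = a ∷ ⟦⟧-++ p q

  swapsWith : Fin m → List (Fin m) → List (Swap 1 m)
  swapsWith x = map (λ y → zero , x , y)

  block-moves : ∀ (V : Votes 1 m) {o} xs x ys zs → Ranked (position V) o (xs ++ x ∷ ys ++ zs) →
                ∃[ V′ ] V ⟦ swapsWith x ys ⟧↦ V′ × Ranked (position V′) o (xs ++ ys ++ x ∷ zs)
  block-moves V xs x []       zs r = V , [] , r
  block-moves V xs x (y ∷ ys) zs r =
    let r′ = Ranked-swap (transpose-fst x y) (transpose-snd x y) transpose-other xs r
        (V′ , d , r″) = block-moves (apply (zero , x , y) V) (xs ++ y ∷ []) x ys zs
                          (subst (Ranked _ _) (sym (++-assoc xs (y ∷ []) (x ∷ ys ++ zs))) r′)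
    in V′ , cong suc (sym (Ranked-next xs r)) ∷ d , subst (Ranked _ _) (++-assoc xs (y ∷ []) (ys ++ x ∷ zs)) r″

  -- An adjacent swap changes the relative order of the two swapped candidates only.
  inverted⇒swapped : ∀ {V V′ : Votes 1 m} {Δ a b} → V ⟦ Δ ⟧↦ V′ → position V a < position V b →
                     position V′ b < position V′ a → (zero , a , b) ∈ Δ
  inverted⇒swapped [] p q = contradiction q (<-asym p)
  inverted⇒swapped {V} {Δ = (zero , x , y) ∷ Δ} {a} {b} (adm ∷ d) p q with a ≟ x | b ≟ y
  ... | yes refl | yes refl = here refl
  ... | yes refl | no b≢y   = there (inverted⇒swapped d p′ q)
    where
    y≡ : suc (position V a) ≡ position V y
    y≡ = suc-injective adm
    p′ : position (apply (zero , a , y) V) a < position (apply (zero , a , y) V) b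
    p′ rewrite transpose-fst a y | transpose-other {a = a} {y} {b} (λ { refl → <-irrefl refl p }) b≢y =
      -- Nobody stands between `a` and `y`; hence `b`, which is behind `a` and is not `y`, is behind
      -- `y` too.
      ≤∧≢⇒< (≤-trans (≤-reflexive (sym y≡)) p) (λ eq → b≢y (position-injective V (sym eq)))
  ... | no a≢x | yes refl = there (inverted⇒swapped d p′ q)
    where
    y≡ : suc (position V x) ≡ position V b
    y≡ = suc-injective adm
    p′ : position (apply (zero , x , b) V) a < position (apply (zero , x , b) V) b
    p′ rewrite transpose-snd x b | transpose-other {a = x} {b} {a} a≢x (λ { refl → <-irrefl refl p }) =
      ≤∧≢⇒< (s≤s⁻¹ (≤-trans p (≤-reflexive (sym y≡)))) (λ eq → a≢x (position-injective V eq))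
  ... | no a≢x | no b≢y with a ≟ y | b ≟ x
  ...   | yes refl | yes refl = contradiction p (<-asym (≤-reflexive (suc-injective adm)))
  ...   | yes refl | no b≢x   = there (inverted⇒swapped d p′ q)
    where
    p′ : position (apply (zero , x , a) V) a < position (apply (zero , x , a) V) b
    p′ rewrite transpose-snd x a | transpose-other {a = x} {a} {b} b≢x b≢y =
      <-trans (≤-reflexive (suc-injective adm)) p
  ...   | no a≢y | yes refl = there (inverted⇒swapped d p′ q)
    where
    p′ : position (apply (zero , b , y) V) a < position (apply (zero , b , y) V) b
    p′ rewrite transpose-fst b y | transpose-other {a = b} {y} {a} a≢x a≢y =
      <-trans p (≤-reflexive (suc-injective adm))
  ...   | no a≢y | no b≢x = there (inverted⇒swapped d p′ q)
    where
    p′ : position (apply (zero , x , y) V) a < position (apply (zero , x , y) V) b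
    p′ rewrite transpose-other {a = x} {y} {a} a≢x a≢y | transpose-other {a = x} {y} {b} b≢x b≢y = p

  module _ (keep : Fin m → Bool) (p : Fin m) where

    kept gone : List (Fin m) → List (Fin m)
    kept []       = []
    kept (x ∷ xs) = if keep x then x ∷ kept xs else kept xs
    gone []       = []
    gone (x ∷ xs) = if keep x then gone xs else x ∷ gone xs

    -- The inversions needed to move p, which is behind xs, in front of all
    -- candidates of xs that are not kept.
    swaps : List (Fin m) → List (Swap 1 m)
    swaps []       = []
    swaps (x ∷ xs) = swaps xs ++ (if keep x then [] else swapsWith x (kept xs ++ p ∷ []))

    kept⊆ : ∀ {x} xs → x ∈ kept xs → x ∈ xs × keep x ≡ true
    kept⊆ (z ∷ xs) i with keep z in eq
    kept⊆ (z ∷ xs) i           | false = let (j , e) = kept⊆ xs i in there j , e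
    kept⊆ (z ∷ xs) (here refl) | true  = here refl , eq
    kept⊆ (z ∷ xs) (there i)   | true  = let (j , e) = kept⊆ xs i in there j , e

    kept-unique : ∀ {xs} → Unique xs → Unique (kept xs)
    kept-unique [] = []
    kept-unique {x ∷ xs} (x∉ ∷ u) with keep x
    ... | true  = All.tabulate (λ i → All.lookup x∉ (proj₁ (kept⊆ xs i))) ∷ kept-unique u
    ... | false = kept-unique u

    -- The tail is settled before `x`. A candidate `x` that is not kept then finds exactly the kept
    -- ones of the tail and `p` behind it, passes these, and stops in front of the gone ones, whose
    -- order never changes. So no pair is swapped without need.
    swaps-run : ∀ (V : Votes 1 m) {o} ws xs → Ranked (position V) o (ws ++ xs ++ p ∷ []) →
                ∃[ V′ ] V ⟦ swaps xs ⟧↦ V′ × Ranked (position V′) o (ws ++ kept xs ++ p ∷ gone xs)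
    swaps-run V ws []       r = V , [] , r
    swaps-run V {o} ws (x ∷ xs) r with keep x
    ... | true =
      let (V′ , d , r′) = swaps-run V (ws ++ x ∷ []) xs (subst (Ranked _ _) (sym (++-assoc ws (x ∷ []) (xs ++ p ∷ []))) r)
      in V′ , ⟦⟧-++ d [] , subst (Ranked _ _) (++-assoc ws (x ∷ []) (kept xs ++ p ∷ gone xs)) r′
    ... | false =
      let (V′ , d , r′) = swaps-run V (ws ++ x ∷ []) xs (subst (Ranked _ _) (sym (++-assoc ws (x ∷ []) (xs ++ p ∷ []))) r)
          (V″ , e , r″) = block-moves V′ ws x (kept xs ++ p ∷ []) (gone xs)
                            (subst (Ranked _ _) (trans (++-assoc ws (x ∷ []) (kept xs ++ p ∷ gone xs))
                                                       (cong (λ l → ws ++ x ∷ l) (sym (++-assoc (kept xs) (p ∷ []) (gone xs))))) r′)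
      in V″ , ⟦⟧-++ d e , subst (Ranked _ _) (cong (ws ++_) (++-assoc (kept xs) (p ∷ []) (x ∷ gone xs))) r″

    ∈-swaps : ∀ {s} xs → s ∈ swaps xs → proj₁ (proj₂ s) ∈ xs
    ∈-swaps (x ∷ xs) i with ∈-++⁻ (swaps xs) i
    ... | inj₁ j = there (∈-swaps xs j)
    ... | inj₂ j with keep x
    ...   | false = let (_ , _ , eq) = ∈-map⁻ _ j in here (cong (proj₁ ∘ proj₂) eq)

    swaps-unique : ∀ {xs} → Unique xs → p ∉ xs → Unique (swaps xs)
    swaps-unique [] p∉ = []
    swaps-unique {x ∷ xs} (x∉ ∷ u) p∉ = Uniqueₚ.++⁺ (swaps-unique u (p∉ ∘ there)) block
      (λ (i , j) → All.lookup x∉ (∈-swaps xs i) (sym (fst j)))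
      where
      block : Unique (if keep x then [] else swapsWith x (kept xs ++ p ∷ []))
      block with keep x
      ... | true  = []
      ... | false = Uniqueₚ.map⁺ (λ { refl → refl }) (Uniqueₚ.++⁺ (kept-unique u) ([] ∷ [])
              (λ { (i , here refl) → p∉ (there (proj₁ (kept⊆ xs i))) }))
      fst : ∀ {s} → s ∈ (if keep x then [] else swapsWith x (kept xs ++ p ∷ [])) → proj₁ (proj₂ s) ≡ x
      fst j with keep x
      ... | false = let (_ , _ , eq) = ∈-map⁻ _ j in cong (proj₁ ∘ proj₂) eq

    -- f is the initial order and g the final order.
    swaps-inverted : ∀ (f g : Fin m → ℕ) {o} xs → Ranked f o (xs ++ p ∷ []) →
                     (∀ x → keep x ≡ true → g x < g p) → (∀ x → x ∈ xs → keep x ≡ false → g p < g x) →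
                     ∀ {s} → s ∈ swaps xs → let (_ , a , b) = s in f a < f b × g b < g a
    swaps-inverted f g (x ∷ xs) (eq ∷ r) h k i with ∈-++⁻ (swaps xs) i
    ... | inj₁ j = swaps-inverted f g xs r h (λ y → k y ∘ there) j
    ... | inj₂ j with keep x in e
    ...   | false with ∈-map⁻ _ j
    ...     | y , y∈ , refl with ∈-++⁻ (kept xs) y∈
    ...       | inj₂ (here refl) = ≤-trans (s≤s (≤-reflexive eq)) (Ranked-≥ xs r) , k x (here refl) e
    ...       | inj₁ y∈kept = let (y∈xs , ky) = kept⊆ xs y∈kept
                                  (as , bs , eq′) = ∈-∃++ y∈xs
                              in ≤-trans (s≤s (≤-reflexive eq))
                                   (Ranked-≥ as {ys = bs ++ p ∷ []} (subst (Ranked f _) (trans (cong (_++ p ∷ []) eq′) (++-assoc as (y ∷ bs) (p ∷ []))) r))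
                               , <-trans (h y ky) (k x (here refl) e)

-- Briberies as labellings of the candidates

module _ {A : Set} where

  at : List A → A → ℕ → A
  at []       d n       = d
  at (x ∷ xs) d zero    = x
  at (x ∷ xs) d (suc n) = at xs d n

  tabulate-at : ∀ xs d → tabulate {n = suc (length xs)} (λ i → at xs d (toℕ i)) ≡ xs ++ d ∷ []
  tabulate-at []       d = refl
  tabulate-at (x ∷ xs) d = cong (x ∷_) (tabulate-at xs d)

  tabulate-at-inject₁ : ∀ xs d → tabulate {n = length xs} (λ i → at xs d (toℕ (inject₁ i))) ≡ xs
  tabulate-at-inject₁ []       d = refl
  tabulate-at-inject₁ (x ∷ xs) d = cong (x ∷_) (tabulate-at-inject₁ xs d)

  at-length : ∀ xs d → at xs d (length xs) ≡ d
  at-length []       d = refl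
  at-length (x ∷ xs) d = at-length xs d

-- The label true marks the candidates that stay ahead of p.
module Labelling {A : Set} (cost : A → A → ℕ) (p : A) where

  keptCost : A → List (A × Bool) → ℕ
  keptCost x []            = 0
  keptCost x ((y , b) ∷ l) = (if b then cost x y else 0) + keptCost x l

  totalCost : List (A × Bool) → ℕ
  totalCost []            = 0
  totalCost ((x , b) ∷ l) = (if b then 0 else cost x p + keptCost x l) + totalCost l

  countTrue : List (A × Bool) → ℕ
  countTrue []            = 0
  countTrue ((x , b) ∷ l) = (if b then 1 else 0) + countTrue l

module _ {A : Set} (body : List A) (p : A) (cost : A → A → ℕ) (budget κ : ℕ) where

  open Labelling cost p

  private
    m : ℕ
    m = length body

    P : Fin (suc m)
    P = fromℕ m

    -- The index `m` lies just beyond `body`, so the default value of `at` describes the last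
    -- candidate as `p`.
    desc : Fin (suc m) → A
    desc i = at body p (toℕ i)

    initial : Votes 1 (suc m)
    initial _ = idPerm

    swapCost : Swap 1 (suc m) → ℕ
    swapCost (_ , a , b) = cost (desc a) (desc b)

    others : List (Fin (suc m))
    others = tabulate inject₁

    desc-P : desc P ≡ p
    desc-P = trans (cong (at body p) (toℕ-fromℕ m)) (at-length body p)

  oneVote : BriberyInstance
  oneVote = record
    -- The place in addition to `κ` is for the preferred candidate itself.
    { votes = initial ; preferred = P ; cost = swapCost ; budget = budget ; approvals = suc κ }

  private
    ranked : ∀ k {n} (g : Fin n → Fin (suc m)) → (∀ i → toℕ (g i) ≡ k + toℕ i) → ∀ q → toℕ q ≡ k + n →
             Ranked (position initial) k (tabulate g ++ q ∷ [])
    ranked k {zero}  g h q e = trans e (+-identityʳ k) ∷ []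
    ranked k {suc n} g h q e = trans (h zero) (+-identityʳ k)
      ∷ ranked (suc k) (g ∘ suc) (λ i → trans (h (suc i)) (+-suc k (toℕ i))) q (trans e (+-suc k n))

    initially-ranked : Ranked (position initial) 0 (others ++ P ∷ [])
    initially-ranked = ranked 0 inject₁ toℕ-inject₁ P (toℕ-fromℕ m)

    P∉others : P ∉ others
    P∉others i = let (j , eq) = ∈-tabulate⁻ i in
      <-irrefl (trans (sym (toℕ-inject₁ j)) (trans (cong toℕ (sym eq)) (toℕ-fromℕ m))) (toℕ<n j)

    others-unique : Unique others
    others-unique = Uniqueₚ.tabulate⁺ (λ {i} {j} eq →
      toℕ-injective (trans (sym (toℕ-inject₁ i)) (trans (cong toℕ eq) (toℕ-inject₁ j))))

    module _ (keep : Fin (suc m) → Bool) where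

      label : List (Fin (suc m)) → List (A × Bool)
      label = map (λ x → desc x , keep x)

      kept-cost : ∀ x xs → sum (map swapCost (swapsWith x (kept keep P xs ++ P ∷ [])))
                           ≡ cost (desc x) p + keptCost (desc x) (label xs)
      kept-cost x []       = cong (λ a → cost (desc x) a + 0) desc-P
      kept-cost x (y ∷ xs) with keep y
      ... | true  = trans (cong (cost (desc x) (desc y) +_) (kept-cost x xs))
                    (trans (sym (+-assoc (cost (desc x) (desc y)) _ _))
                    (trans (cong (_+ keptCost (desc x) (label xs)) (+-comm (cost (desc x) (desc y)) _)) (+-assoc (cost (desc x) p) _ _)))
      ... | false = kept-cost x xs

      swaps-cost : ∀ xs → sum (map swapCost (swaps keep P xs)) ≡ totalCost (label xs)
      swaps-cost []       = refl
      swaps-cost (x ∷ xs) =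
        trans (cong sum (map-++ swapCost (swaps keep P xs) _))
        (trans (sum-++ (map swapCost (swaps keep P xs)) _)
        (trans (+-comm (sum (map swapCost (swaps keep P xs))) _) (cong₂ _+_ block (swaps-cost xs))))
        where
        block : sum (map swapCost (if keep x then [] else swapsWith x (kept keep P xs ++ P ∷ [])))
                ≡ (if keep x then 0 else cost (desc x) p + keptCost (desc x) (label xs))
        block with keep x
        ... | true  = refl
        ... | false = kept-cost x xs

      kept-count : ∀ xs → length (kept keep P xs) ≡ countTrue (label xs)
      kept-count []       = refl
      kept-count (x ∷ xs) with keep x
      ... | true  = cong suc (kept-count xs)
      ... | false = kept-count xs

  Outcome : List (A × Bool) → Set
  Outcome ls = map proj₁ ls ≡ body × countTrue ls ≤ κ × totalCost ls ≤ budget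

  outcome⇒bribery : ∀ ls → Outcome ls → Problem.Yes SwapBribery oneVote
  outcome⇒bribery ls (erases , few , cheap) = Γ , V′ ,
      (swaps-unique keep P others-unique P∉others , Γ , ↭-refl , d) ,
      ≤-trans (≤-reflexive (trans (swaps-cost keep others) (cong totalCost labels))) cheap ,
      winner
    where
    keep : Fin (suc m) → Bool
    keep i = at (map proj₂ ls) false (toℕ i)
    relabel : ∀ (ls : List (A × Bool)) → tabulate {n = length (map proj₁ ls)} (λ i → at (map proj₁ ls) p (toℕ i) , at (map proj₂ ls) false (toℕ i)) ≡ ls
    relabel []       = refl
    relabel (x ∷ ls) = cong (x ∷_) (relabel ls)
    labels : label keep others ≡ ls
    labels = trans (map-tabulate inject₁ (λ x → desc x , keep x))
      (trans (tabulate-toℕ (λ k → at body p k , at (map proj₂ ls) false k) m)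
             (subst (λ b → tabulate {n = length b} (λ i → at b p (toℕ i) , at (map proj₂ ls) false (toℕ i)) ≡ ls) erases (relabel ls)))
      where
      tabulate-toℕ : ∀ {B : Set} (g : ℕ → B) n → tabulate {n = n} (λ i → g (toℕ (inject₁ i))) ≡ tabulate {n = n} (λ i → g (toℕ i))
      tabulate-toℕ g zero    = refl
      tabulate-toℕ g (suc n) = cong (g 0 ∷_) (tabulate-toℕ (g ∘ suc) n)
    Γ : List (Swap 1 (suc m))
    Γ = swaps keep P others
    run : ∃[ V′ ] initial ⟦ Γ ⟧↦ V′ × Ranked (position V′) 0 (kept keep P others ++ P ∷ gone keep P others)
    run = swaps-run keep P initial [] others initially-ranked
    V′ = proj₁ run
    d  = proj₁ (proj₂ run)
    rank≤ : rank P (V′ zero) ≤ suc κ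
    rank≤ = s≤s (≤-trans (≤-reflexive (trans (Ranked-length (kept keep P others) (proj₂ (proj₂ run)))
      (trans (kept-count keep others) (cong countTrue labels)))) few)
    winner : ApprovalWinner (suc κ) V′ P
    winner c rewrite T⇒≡ (≤⇒≤ᵇ rank≤) with rank c (V′ zero) ≤ᵇ suc κ
    ... | true  = ≤-refl
    ... | false = z≤n

  bribery⇒outcome : Problem.Yes SwapBribery oneVote → ∃ Outcome
  bribery⇒outcome (Γ , V′ , (_ , Δ , Δ↭Γ , d) , cheap , winner) = label keep others ,
      erases , few , ≤-trans (≤-reflexive (sym (swaps-cost keep others)))
        (≤-trans (Unique-⊆-sum swapCost (swaps-unique keep P others-unique P∉others) swaps⊆Γ) cheap)
    where
    pos = position V′
    keep : Fin (suc m) → Bool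
    keep c = pos c <ᵇ pos P
    erases : map proj₁ (label keep others) ≡ body
    erases = trans (cong (map proj₁) (map-tabulate inject₁ _))
      (trans (map-tabulate (λ i → desc (inject₁ i) , keep (inject₁ i)) proj₁) (tabulate-at-inject₁ body p))
    -- The candidate in first place has a point, since `suc κ` is positive; a winner must match it.
    rank≤ : rank P (V′ zero) ≤ suc κ
    rank≤ = ≤ᵇ⇒≤ _ _ (≡⇒T (approved (rank (V′ zero ⟨$⟩ˡ zero) (V′ zero) ≤ᵇ suc κ) (rank P (V′ zero) ≤ᵇ suc κ)
      (cong (λ i → suc (toℕ i) ≤ᵇ suc κ) (inverseʳ (V′ zero) {zero})) (winner (V′ zero ⟨$⟩ˡ zero))))
      where
      approved : ∀ b c → b ≡ true → (if b then 1 else 0) + 0 ≤ (if c then 1 else 0) + 0 → c ≡ true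
      approved true true refl le = refl
    swaps⊆Γ : ∀ {s} → s ∈ swaps keep P others → s ∈ Γ
    swaps⊆Γ {zero , a , b} i =
      let (u , v) = swaps-inverted keep P (position initial) pos others initially-ranked
                      (λ x e → <ᵇ⇒< _ _ (≡⇒T e)) behind i
      in ∈-resp-↭ Δ↭Γ (inverted⇒swapped d u v)
      where
      behind : ∀ x → x ∈ others → keep x ≡ false → pos P < pos x
      behind x x∈ e = ≤∧≢⇒< (≮⇒≥ (λ lt → contradiction (trans (sym e) (T⇒≡ (<⇒<ᵇ lt))) λ ()))
                            (λ eq → P∉others (subst (_∈ others) (position-injective V′ (sym eq)) x∈))
    few : countTrue (label keep others) ≤ κ
    -- The kept candidates occupy distinct positions ahead of `P`, of which there are at most `κ`.
    few = ≤-trans (≤-reflexive (sym (kept-count keep others)))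
      (≤-trans (≤-trans (≤-reflexive (sym (length-map pos (kept keep P others))))
        (≤-trans (Unique-⊆-length {ys = upTo (pos P)} (Uniqueₚ.map⁺ (position-injective V′) (kept-unique keep P others-unique))
           (λ i → let (y , y∈ , eq) = ∈-map⁻ pos i in
             ∈-upTo⁺ (subst (_< pos P) (sym eq) (<ᵇ⇒< _ _ (≡⇒T (proj₂ (kept⊆ keep P others y∈)))))))
          (≤-reflexive (length-upTo (pos P)))))
        (s≤s⁻¹ rank≤))

-- Circuits as polynomials

open import Data.Integer using (+_)


-- Integer polynomials in 0/1-valued variables, as lists of signed monomials;
-- true is the negative sign.
Monomial : Set
Monomial = Bool × List ℕ

Polynomial : Set
Polynomial = List Monomial

cartesian : ∀ {A B C : Set} → (A → B → C) → List A → List B → List C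
cartesian f as bs = concatMap (λ a → map (f a) bs) as

_*ₘ_ : Monomial → Monomial → Monomial
(s , m) *ₘ (t , n) = s xor t , m ++ n

_*ₚ_ : Polynomial → Polynomial → Polynomial
_*ₚ_ = cartesian _*ₘ_

one : Polynomial
one = (false , []) ∷ []

literal : ℕ → Polynomial
literal x = (false , x ∷ []) ∷ []

complementIf : Bool → Polynomial → Polynomial
complementIf b p = if b then (false , []) ∷ map (λ (s , m) → not s , m) p else p

-- Used for small gates only, which have at most two inputs.
fold₂ : ∀ {A : Set} → A → (A → A → A) → List A → A
fold₂ e _∙_ []          = e
fold₂ e _∙_ (a ∷ [])    = a
fold₂ e _∙_ (a ∷ b ∷ _) = a ∙ b

-- A gate as its code is read: the kind, and the input nodes; for a NOT gate
-- the list [0, …, 0] whose length is the input node, which has the same code.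
RawGate : Set
RawGate = ℕ × List ℕ

-- (o , i , js) is the gate  o xor ⋀ⱼ (i xor j).
parse : RawGate → Bool × Bool × List ℕ
parse (k , js) = caseNat k (true , false , length js ∷ [])
                 (λ k → caseNat k (false , false , js) (λ _ → true , true , js))

exactGate : Bool × Bool × List ℕ → (ℕ → Polynomial) → Polynomial
exactGate (o , i , js) p = complementIf o (fold₂ one _*ₚ_ (map (λ j → complementIf i (p j)) js))

-- Meaningful for nodes of depth at most d that depend on no large gate.
exact : ℕ → List RawGate → ℕ → Polynomial
exact zero    gs x = literal (x ∸ length gs)
exact (suc d) gs x = caseList (drop x gs) (literal (x ∸ length gs)) (λ g hs → exactGate (parse g) (exact d hs))

-- The value of a decision list is the label of its first polynomial that is positive.
DecisionList : Set
DecisionList = List (Polynomial × Bool)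

literalList : ℕ → DecisionList
literalList x = (literal x , true) ∷ (one , false) ∷ []

flipIf : Bool → DecisionList → DecisionList
flipIf b = map (λ (p , c) → p , b xor c)

_∧ᴰ_ : DecisionList → DecisionList → DecisionList
_∧ᴰ_ = cartesian (λ (p , b) (q , c) → p *ₚ q , b ∧ c)

-- The first polynomial counts the inputs that violate the conjunction. One violation gives the gate
-- the value `o`, none gives `not o`.
largeGate : Bool × Bool × List ℕ → (ℕ → Polynomial) → DecisionList
largeGate (o , i , js) p = (concatMap (λ j → complementIf (not i) (p j)) js , o) ∷ (one , not o) ∷ []

smallGate : Bool × Bool × List ℕ → (ℕ → DecisionList) → DecisionList
smallGate (o , i , js) l = flipIf o (fold₂ ((one , true) ∷ []) _∧ᴰ_ (map (λ j → flipIf i (l j)) js))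

decisions : ℕ → List RawGate → ℕ → DecisionList
decisions zero    gs x = literalList (x ∸ length gs)
decisions (suc d) gs x = caseList (drop x gs) (literalList (x ∸ length gs)) (λ g hs →
  if 2 <ᵇ length (proj₂ (proj₂ (parse g)))
  then largeGate (parse g) (exact d hs)
  else smallGate (parse g) (decisions d hs))

-- Each polynomial of the list gets a factor that exceeds the absolute value of
-- all that follows, so that the sign is decided by the first positive one.
-- Only the first n entries are used.
flatten : ℕ → DecisionList → Polynomial
flatten zero    l = []
flatten (suc n) l = caseList l [] (λ (p , b) l →
  (map (λ _ → not b , []) ((false , []) ∷ flatten n l) *ₚ p) ++ flatten n l)

-- Values of polynomials and decision lists

holds : (ℕ → Bool) → List ℕ → Bool
holds χ = foldr (λ x b → χ x ∧ b) true

sign : Bool → ℤ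
sign s = if s then -1ℤ else 1ℤ

monomialValue : (ℕ → Bool) → Monomial → ℤ
monomialValue χ (s , m) = if holds χ m then sign s else 0ℤ

⟪_⟫ : Polynomial → (ℕ → Bool) → ℤ
⟪ p ⟫ χ = foldr (λ a z → monomialValue χ a ℤ.+ z) 0ℤ p

⟨_⟩ᵇ : Bool → ℤ
⟨ b ⟩ᵇ = if b then 1ℤ else 0ℤ

module _ (χ : ℕ → Bool) where

  holds-++ : ∀ l m → holds χ (l ++ m) ≡ holds χ l ∧ holds χ m
  holds-++ []      m = refl
  holds-++ (x ∷ l) m with χ x
  ... | true  = holds-++ l m
  ... | false = refl

  *ₘ-value : ∀ a b → monomialValue χ (a *ₘ b) ≡ monomialValue χ a ℤ.* monomialValue χ b
  *ₘ-value (s , l) (t , m) rewrite holds-++ l m with holds χ l | holds χ m | s | t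
  ... | true  | true  | true  | true  = refl
  ... | true  | true  | true  | false = refl
  ... | true  | true  | false | true  = refl
  ... | true  | true  | false | false = refl
  ... | true  | false | true  | _     = refl
  ... | true  | false | false | _     = refl
  ... | false | true  | _     | true  = refl
  ... | false | true  | _     | false = refl
  ... | false | false | _     | _     = refl

  ++-value : ∀ p q → ⟪ p ++ q ⟫ χ ≡ ⟪ p ⟫ χ ℤ.+ ⟪ q ⟫ χ
  ++-value []      q = sym (ℤₚ.+-identityˡ _)
  ++-value (a ∷ p) q = trans (cong (λ z → monomialValue χ a ℤ.+ z) (++-value p q)) (sym (ℤₚ.+-assoc (monomialValue χ a) _ _))

  map-*ₘ-value : ∀ a q → ⟪ map (a *ₘ_) q ⟫ χ ≡ monomialValue χ a ℤ.* ⟪ q ⟫ χ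
  map-*ₘ-value a []      = sym (ℤₚ.*-zeroʳ (monomialValue χ a))
  map-*ₘ-value a (b ∷ q) = trans (cong₂ ℤ._+_ (*ₘ-value a b) (map-*ₘ-value a q))
                                 (sym (ℤₚ.*-distribˡ-+ (monomialValue χ a) (monomialValue χ b) (⟪ q ⟫ χ)))

  *ₚ-value : ∀ p q → ⟪ p *ₚ q ⟫ χ ≡ ⟪ p ⟫ χ ℤ.* ⟪ q ⟫ χ
  *ₚ-value []      q = sym (ℤₚ.*-zeroˡ (⟪ q ⟫ χ))
  *ₚ-value (a ∷ p) q = trans (++-value (map (a *ₘ_) q) (p *ₚ q))
    (trans (cong₂ ℤ._+_ (map-*ₘ-value a q) (*ₚ-value p q))
           (sym (ℤₚ.*-distribʳ-+ (⟪ q ⟫ χ) (monomialValue χ a) (⟪ p ⟫ χ))))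

  negate-value : ∀ p → ⟪ map (λ (s , m) → not s , m) p ⟫ χ ≡ ℤ.- ⟪ p ⟫ χ
  negate-value [] = refl
  negate-value ((s , m) ∷ p) =
    trans (cong₂ ℤ._+_ (lemma s) (negate-value p)) (sym (ℤₚ.neg-distrib-+ (monomialValue χ (s , m)) (⟪ p ⟫ χ)))
    where
    lemma : ∀ s → monomialValue χ (not s , m) ≡ ℤ.- monomialValue χ (s , m)
    lemma s with holds χ m | s
    ... | true  | true  = refl
    ... | true  | false = refl
    ... | false | _     = refl

  complementIf-exact : ∀ b p {c} → ⟪ p ⟫ χ ≡ ⟨ c ⟩ᵇ → ⟪ complementIf b p ⟫ χ ≡ ⟨ b xor c ⟩ᵇ
  complementIf-exact false p eq = eq
  complementIf-exact true  p {c} eq = trans (cong (λ z → 1ℤ ℤ.+ z) (trans (negate-value p) (cong ℤ.-_ eq))) (lemma c)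
    where
    lemma : ∀ c → 1ℤ ℤ.+ ℤ.- ⟨ c ⟩ᵇ ≡ ⟨ not c ⟩ᵇ
    lemma true  = refl
    lemma false = refl

  *ₚ-exact : ∀ p q {b c} → ⟪ p ⟫ χ ≡ ⟨ b ⟩ᵇ → ⟪ q ⟫ χ ≡ ⟨ c ⟩ᵇ → ⟪ p *ₚ q ⟫ χ ≡ ⟨ b ∧ c ⟩ᵇ
  *ₚ-exact p q {b} {c} e f = trans (*ₚ-value p q) (trans (cong₂ ℤ._*_ e f) (lemma b c))
    where
    lemma : ∀ b c → ⟨ b ⟩ᵇ ℤ.* ⟨ c ⟩ᵇ ≡ ⟨ b ∧ c ⟩ᵇ
    lemma true  true  = refl
    lemma true  false = refl
    lemma false true  = refl
    lemma false false = refl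

  -- Entries before the deciding one have to be 0, not merely non-positive: a product of two
  -- negative values would be positive, and a negative entry would disturb the sum built by
  -- `flatten`.
  data Decides : DecisionList → Bool → Set where
    here  : ∀ {p b l} → 0ℤ ℤ.< ⟪ p ⟫ χ → Decides ((p , b) ∷ l) b
    there : ∀ {p b c l} → ⟪ p ⟫ χ ≡ 0ℤ → Decides l c → Decides ((p , b) ∷ l) c

  flipIf-decides : ∀ o {l b} → Decides l b → Decides (flipIf o l) (o xor b)
  flipIf-decides o (here x)    = here x
  flipIf-decides o (there x d) = there x (flipIf-decides o d)

  literalList-decides : ∀ x → Decides (literalList x) (χ x)
  literalList-decides x with χ x in eq
  ... | true  = here (subst (λ b → 0ℤ ℤ.< (if b ∧ true then 1ℤ else 0ℤ) ℤ.+ 0ℤ) (sym eq) (+<+ (s≤s z≤n)))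
  ... | false = there (cong (λ b → (if b ∧ true then 1ℤ else 0ℤ) ℤ.+ 0ℤ) eq) (here (+<+ (s≤s z≤n)))

  -- The pairs come in lexicographic order. Until both deciding entries meet, one of the two factors
  -- is 0, and so is the product.
  ∧ᴰ-decides : ∀ {l b m c} → Decides l b → Decides m c → Decides (l ∧ᴰ m) (b ∧ c)
  ∧ᴰ-decides {l} {m = m} (here {p} {b} {l′} x) d = go d
    where
    go : ∀ {m c r} → Decides m c → Decides (map (λ (q , c) → p *ₚ q , b ∧ c) m ++ r) (b ∧ c)
    go (here {q} y)    = here (subst (0ℤ ℤ.<_) (sym (*ₚ-value p q)) (pos*pos x y))
      where
      pos*pos : ∀ {x y} → 0ℤ ℤ.< x → 0ℤ ℤ.< y → 0ℤ ℤ.< x ℤ.* y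
      pos*pos {+ suc _} {+ suc _} (+<+ _) (+<+ _) = +<+ (s≤s z≤n)
    go (there {q} y d) = there (trans (*ₚ-value p q) (trans (cong (⟪ p ⟫ χ ℤ.*_) y) (ℤₚ.*-zeroʳ (⟪ p ⟫ χ)))) (go d)
  ∧ᴰ-decides {m = m} (there {p} x d) e = go m (∧ᴰ-decides d e)
    where
    go : ∀ m {r b c} → Decides r c → Decides (map (λ (q , c) → p *ₚ q , b ∧ c) m ++ r) c
    go []            d = d
    go ((q , _) ∷ m) d = there (trans (*ₚ-value p q) (trans (cong (ℤ._* ⟪ q ⟫ χ) x) (ℤₚ.*-zeroˡ (⟪ q ⟫ χ)))) (go m d)


  ⟪⟫≤length : ∀ p → ⟪ p ⟫ χ ℤ.≤ + length p
  ⟪⟫≤length []            = ℤₚ.≤-refl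
  ⟪⟫≤length ((s , m) ∷ p) = ℤₚ.+-mono-≤ (lemma s) (⟪⟫≤length p)
    where
    lemma : ∀ s → monomialValue χ (s , m) ℤ.≤ 1ℤ
    lemma s with holds χ m | s
    ... | true  | true  = -≤+
    ... | true  | false = ℤₚ.≤-refl
    ... | false | _     = +≤+ z≤n

  -length≤⟪⟫ : ∀ p → ℤ.- (+ length p) ℤ.≤ ⟪ p ⟫ χ
  -length≤⟪⟫ []            = ℤₚ.≤-refl
  -length≤⟪⟫ ((s , m) ∷ p) =
    ℤₚ.≤-trans (ℤₚ.≤-reflexive (ℤₚ.neg-distrib-+ 1ℤ (+ length p))) (ℤₚ.+-mono-≤ (lemma s) (-length≤⟪⟫ p))
    where
    lemma : ∀ s → -1ℤ ℤ.≤ monomialValue χ (s , m)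
    lemma s with holds χ m | s
    ... | true  | true  = ℤₚ.≤-refl
    ... | true  | false = -≤+
    ... | false | _     = -≤+

  -- Coefficients other than 1 and -1 exist only as repetitions, so an integer factor is written as
  -- that many constant monomials.
  constants-value : ∀ b (p : Polynomial) → ⟪ map (λ _ → b , []) p ⟫ χ ≡ sign b ℤ.* + length p
  constants-value b []      = sym (ℤₚ.*-zeroʳ (sign b))
  constants-value b (_ ∷ p) = trans (cong (λ z → sign b ℤ.+ z) (constants-value b p))
    (trans (cong (λ z → z ℤ.+ sign b ℤ.* + length p) (sym (ℤₚ.*-identityʳ (sign b))))
           (sym (ℤₚ.*-distribˡ-+ (sign b) 1ℤ (+ length p))))

  HasSign : Bool → ℤ → Set
  HasSign b z = if b then 0ℤ ℤ.< z else z ℤ.< 0ℤ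

  private
    dominate : ∀ b {x r} n → 0ℤ ℤ.< x → r ℤ.≤ + n → ℤ.- (+ n) ℤ.≤ r →
               HasSign b ((sign (not b) ℤ.* + suc n) ℤ.* x ℤ.+ r)
    dominate true  {+ suc k} {r} n (+<+ _) ≤n ≥n =
      subst (λ z → 0ℤ ℤ.< z ℤ.+ r) (sym (trans (cong (ℤ._* + suc k) (ℤₚ.*-identityˡ (+ suc n))) (sym (ℤₚ.pos-* (suc n) (suc k)))))
      (ℤₚ.≤-<-trans (ℤₚ.≤-reflexive (sym (ℤₚ.+-inverseʳ (+ M))))
        (ℤₚ.+-monoʳ-< (+ M) (ℤₚ.<-≤-trans (ℤₚ.neg-mono-< (+<+ (m≤m*n (suc n) (suc k)))) ≥n)))
      where M = suc n * suc k
    dominate false {+ suc k} {r} n (+<+ _) ≤n ≥n =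
      subst (λ z → z ℤ.+ r ℤ.< 0ℤ) (sym (trans (cong (ℤ._* + suc k) (ℤₚ.-1*i≡-i (+ suc n)))
        (trans (sym (ℤₚ.neg-distribˡ-* (+ suc n) (+ suc k))) (cong ℤ.-_ (sym (ℤₚ.pos-* (suc n) (suc k)))))))
      (ℤₚ.<-≤-trans (ℤₚ.+-monoʳ-< (ℤ.- (+ M)) (ℤₚ.≤-<-trans ≤n (+<+ (m≤m*n (suc n) (suc k)))))
                    (ℤₚ.≤-reflexive (ℤₚ.+-inverseˡ (+ M))))
      where M = suc n * suc k

  -- The factor is, up to sign, one more than the number of monomials in the remainder. A monomial
  -- has absolute value at most 1 and a positive integer is at least 1, so a positive first entry
  -- outweighs the remainder; an entry of value 0 vanishes whatever its factor.
  flatten-sign : ∀ n l {b} → length l ≤ n → Decides l b → HasSign b (⟪ flatten n l ⟫ χ)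
  flatten-sign (suc n) ((p , b) ∷ l) le d = subst (HasSign _) (sym value≡) (lemma d)
    where
    r = flatten n l
    k = (sign (not b) ℤ.* + suc (length r))
    value≡ : ⟪ flatten (suc n) ((p , b) ∷ l) ⟫ χ ≡ k ℤ.* ⟪ p ⟫ χ ℤ.+ ⟪ r ⟫ χ
    value≡ = trans (++-value (map (λ _ → not b , []) ((false , []) ∷ r) *ₚ p) r)
      (cong (ℤ._+ ⟪ r ⟫ χ) (trans (*ₚ-value (map (λ _ → not b , []) ((false , []) ∷ r)) p)
        (cong (ℤ._* ⟪ p ⟫ χ) (constants-value (not b) ((false , []) ∷ r)))))
    lemma : ∀ {c} → Decides ((p , b) ∷ l) c → HasSign c (k ℤ.* ⟪ p ⟫ χ ℤ.+ ⟪ r ⟫ χ)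
    lemma (here x)    = dominate b (length r) x (⟪⟫≤length r) (-length≤⟪⟫ r)
    lemma (there x d) = subst (HasSign _) (sym (trans (cong (λ z → k ℤ.* z ℤ.+ ⟪ r ⟫ χ) x)
      (trans (cong (ℤ._+ ⟪ r ⟫ χ) (ℤₚ.*-zeroʳ k)) (ℤₚ.+-identityˡ _)))) (flatten-sign n l (s≤s⁻¹ le) d)

  allXor : ∀ {j} → Bool → (Fin j → Bool) → List (Fin j) → Bool
  allXor i u = foldr (λ x b → (i xor u x) ∧ b) true

  -- Every summand is 0 or 1, so a sum without violation is exactly 0, as `Decides` requires for
  -- passing on to the next entry.
  violations : ∀ {j} i (p : ℕ → Polynomial) (u : Fin j → Bool) is → All (λ x → ⟪ p (toℕ x) ⟫ χ ≡ ⟨ u x ⟩ᵇ) is →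
               let z = ⟪ concatMap (λ j → complementIf (not i) (p j)) (map toℕ is) ⟫ χ
               in if allXor i u is then z ≡ 0ℤ else 0ℤ ℤ.< z
  violations i p u []       []       = refl
  violations i p u (x ∷ is) (e ∷ es) = subst (λ z → if allXor i u (x ∷ is) then z ≡ 0ℤ else 0ℤ ℤ.< z)
      (sym (trans (++-value (complementIf (not i) (p (toℕ x))) _) (cong (ℤ._+ _) (complementIf-exact (not i) (p (toℕ x)) e))))
      (lemma i (u x) (allXor i u is) (violations i p u is es))
    where
    grow : ∀ {z} → 0ℤ ℤ.< z → 0ℤ ℤ.< 1ℤ ℤ.+ z
    grow (+<+ _) = +<+ (s≤s z≤n)
    lemma : ∀ i u a {z} → (if a then z ≡ 0ℤ else 0ℤ ℤ.< z) →
            if (i xor u) ∧ a then ⟨ not i xor u ⟩ᵇ ℤ.+ z ≡ 0ℤ else 0ℤ ℤ.< ⟨ not i xor u ⟩ᵇ ℤ.+ z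
    lemma true  true  true  refl = +<+ (s≤s z≤n)
    lemma true  true  false h    = grow h
    lemma true  false true  refl = refl
    lemma true  false false h    = subst (0ℤ ℤ.<_) (sym (ℤₚ.+-identityˡ _)) h
    lemma false true  true  refl = refl
    lemma false true  false h    = subst (0ℤ ℤ.<_) (sym (ℤₚ.+-identityˡ _)) h
    lemma false false true  refl = +<+ (s≤s z≤n)
    lemma false false false h    = grow h

  largeGate-decides : ∀ {j} o i (p : ℕ → Polynomial) (u : Fin j → Bool) is → All (λ x → ⟪ p (toℕ x) ⟫ χ ≡ ⟨ u x ⟩ᵇ) is →
                      Decides (largeGate (o , i , map toℕ is) p) (o xor allXor i u is)
  largeGate-decides o i p u is es with allXor i u is | violations i p u is es
  ... | true  | z≡0 = there z≡0 (subst (Decides _) (lemma o) (here (+<+ (s≤s z≤n))))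
    where
    lemma : ∀ o → not o ≡ o xor true
    lemma true  = refl
    lemma false = refl
  ... | false | 0<z = subst (Decides _) (sym (xor-identityʳ o)) (here 0<z)

  -- The relation `R` between a representation and its truth value lets polynomials and decision
  -- lists share the argument for small gates.
  fold₂-allXor : ∀ {j} {A : Set} (R : A → Bool → Set) {e _∙_} → R e true → (∀ {a b c d} → R a b → R c d → R (a ∙ c) (b ∧ d)) →
                 ∀ i (f : ℕ → A) (u : Fin j → Bool) is → length is ≤ 2 → All (λ x → R (f (toℕ x)) (i xor u x)) is →
                 R (fold₂ e _∙_ (map f (map toℕ is))) (allXor i u is)
  fold₂-allXor R e m i f u []               le []           = e
  fold₂-allXor R e m i f u (x ∷ [])         le (r ∷ [])     = subst (R _) (sym (∧-identityʳ (i xor u x))) r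
  fold₂-allXor R e m i f u (x ∷ y ∷ [])     le (r ∷ q ∷ []) = subst (R _) (cong ((i xor u x) ∧_) (sym (∧-identityʳ (i xor u y)))) (m r q)
  fold₂-allXor R e m i f u (x ∷ y ∷ z ∷ is) (s≤s (s≤s ()))

-- Circuits as lists of gates

rawGate : ∀ {j} → Gate j → RawGate
rawGate (NOT i)  = 0 , replicate (toℕ i) 0
rawGate (AND is) = 1 , map toℕ is
rawGate (OR is)  = 2 , map toℕ is

rawGates : ∀ {n j} → Circuit n j → List RawGate
rawGates inputs  = []
rawGates (C ▹ g) = rawGate g ∷ rawGates C

flags : ∀ {j} → Gate j → Bool × Bool
flags (NOT i)  = true , false
flags (AND is) = false , false
flags (OR is)  = true , true

parse-rawGate : ∀ {j} (g : Gate j) → parse (rawGate g) ≡ (proj₁ (flags g) , proj₂ (flags g) , map toℕ (fanIn g))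
parse-rawGate (NOT i)  = cong (λ k → true , false , k ∷ []) (length-replicate (toℕ i))
parse-rawGate (AND is) = refl
parse-rawGate (OR is)  = refl

gateValue-flags : ∀ {j} (g : Gate j) v → gateValue g v ≡ proj₁ (flags g) xor foldr (λ x b → (proj₂ (flags g) xor v x) ∧ b) true (fanIn g)
gateValue-flags (NOT i) v with v i
... | true  = refl
... | false = refl
gateValue-flags (AND is) v = lemma is
  where
  lemma : ∀ is → all v is ≡ foldr (λ x b → v x ∧ b) true is
  lemma []       = refl
  lemma (x ∷ is) = cong (v x ∧_) (lemma is)
gateValue-flags (OR is) v = lemma is
  where
  lemma : ∀ is → any v is ≡ not (foldr (λ x b → not (v x) ∧ b) true is)
  lemma []       = refl
  lemma (x ∷ is) with v x
  ... | true  = refl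
  ... | false = lemma is

-- Node numbers are de Bruijn indices, so dropping `x` gates leaves the gate of node `x` followed by
-- the circuit to which its inputs refer. If nothing is left, `x` is a variable, numbered after all
-- gates. The equation for every weight `w` covers depth and weft at once.
data Located {n} : ∀ {j} → Circuit n j → Fin j → Set where
  variable′ : ∀ {j} {C : Circuit n j} {x} (i : Fin n) →
              drop (toℕ x) (rawGates C) ≡ [] → toℕ x ∸ length (rawGates C) ≡ toℕ i →
              (∀ S → value C S x ≡ lookup S i) → Located C x
  gate : ∀ {j k} {C : Circuit n j} {x} (B : Circuit n k) (g : Gate k) →
         drop (toℕ x) (rawGates C) ≡ rawGate g ∷ rawGates B →
         (∀ S → value C S x ≡ gateValue g (value B S)) →
         (∀ (w : ∀ {j} → Gate j → ℕ) → longest w C x ≡ w g + foldr _⊔_ 0 (map (longest w B) (fanIn g))) → Located C x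

locate : ∀ {n j} (C : Circuit n j) x → Located C x
locate inputs x = variable′ x (drop-[] (toℕ x)) refl (λ _ → refl)
locate (C ▹ g) zero = gate C g refl (λ _ → refl) (λ _ → refl)
locate (C ▹ g) (suc x) with locate C x
... | variable′ i e f h = variable′ i e f h
... | gate B g′ e f h   = gate B g′ e f h

max≤⇒All≤ : ∀ {A : Set} (f : A → ℕ) l {d} → foldr _⊔_ 0 (map f l) ≤ d → All (λ a → f a ≤ d) l
max≤⇒All≤ f []      le = []
max≤⇒All≤ f (a ∷ l) le = m⊔n≤o⇒m≤o (f a) _ le ∷ max≤⇒All≤ f l (m⊔n≤o⇒n≤o (f a) _ le)

depth-children : ∀ {j k} (g : Gate j) (f : Fin j → ℕ) → 1 + foldr _⊔_ 0 (map f (fanIn g)) ≤ suc k → All (λ y → f y ≤ k) (fanIn g)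
depth-children g f le = max≤⇒All≤ f (fanIn g) (s≤s⁻¹ le)

-- Degrees and lengths

WellFormed : ℕ → ℕ → Polynomial → Set
WellFormed d n = All (λ (_ , m) → length m ≤ d × All (_< n) m)

fold₂-All : ∀ {A : Set} (P Q : A → Set) {e _∙_} → Q e → (∀ {a} → P a → Q a) → (∀ {a b} → P a → P b → Q (a ∙ b)) →
            ∀ {l} → All P l → Q (fold₂ e _∙_ l)
fold₂-All P Q e i m []          = e
fold₂-All P Q e i m (a ∷ [])    = i a
fold₂-All P Q e i m (a ∷ b ∷ _) = m a b

module _ {n : ℕ} where

  literal-wf : ∀ {d x} → 1 ≤ d → x < n → WellFormed d n (literal x)
  literal-wf p q = (p , q ∷ []) ∷ []

  one-wf : ∀ {d} → WellFormed d n one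
  one-wf = (z≤n , []) ∷ []

  weaken-wf : ∀ {d e p} → d ≤ e → WellFormed d n p → WellFormed e n p
  weaken-wf le = All.map (λ (u , v) → ≤-trans u le , v)

  complementIf-wf : ∀ {d} b {p} → WellFormed d n p → WellFormed d n (complementIf b p)
  complementIf-wf false w = w
  complementIf-wf true  w = (z≤n , []) ∷ Allₚ.map⁺ w

  *ₚ-wf : ∀ {d e p q} → WellFormed d n p → WellFormed e n q → WellFormed (d + e) n (p *ₚ q)
  *ₚ-wf []                v = []
  *ₚ-wf {p = (_ , l) ∷ _} ((a , b) ∷ w) v = Allₚ.++⁺ (Allₚ.map⁺ (All.map (λ {(_ , m)} (c , d) →
    ≤-trans (≤-reflexive (length-++ l)) (+-mono-≤ a c) , Allₚ.++⁺ b d) v)) (*ₚ-wf w v)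

  2^-double : ∀ d → 2 ^ d + 2 ^ d ≡ 2 ^ suc d
  2^-double d = cong (λ k → 2 ^ d + k) (sym (+-identityʳ (2 ^ d)))

  2^≤ : ∀ d → 2 ^ d ≤ 2 ^ suc d
  2^≤ d = m≤m+n _ _

  All-toℕ : ∀ {j} {A : Set} {P : A → Set} (f : ℕ → A) {is : List (Fin j)} → All (λ x → P (f (toℕ x))) is → All P (map f (map toℕ is))
  All-toℕ f = Allₚ.map⁺ ∘ Allₚ.map⁺

  -- Each level at most doubles the degree, since `fold₂` never multiplies more than two factors;
  -- the bound thus holds for gates of every fan-in.
  exact-wf : ∀ d {j} (C : Circuit n j) x → depth C x ≤ d → WellFormed (2 ^ d) n (exact d (rawGates C) (toℕ x))
  exact-wf zero C x le with locate C x
  ... | variable′ i e f h = literal-wf ≤-refl (subst (_< n) (sym f) (toℕ<n i))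
  ... | gate B g e f h    = contradiction (≤-trans (≤-reflexive (sym (h (λ _ → 1)))) le) λ ()
  exact-wf (suc d) C x le with locate C x
  ... | variable′ i e f h rewrite e = literal-wf (m^n>0 2 (suc d)) (subst (_< n) (sym f) (toℕ<n i))
  ... | gate B g e f h rewrite e | parse-rawGate g =
    complementIf-wf (proj₁ (flags g)) (fold₂-All (WellFormed (2 ^ d) n) (WellFormed (2 ^ suc d) n)
      one-wf (weaken-wf (2^≤ d)) (λ {p} {q} v w → subst (λ d → WellFormed d n (p *ₚ q)) (2^-double d) (*ₚ-wf v w))
      (All-toℕ _ (All.map (λ {y} p → complementIf-wf (proj₂ (flags g)) (exact-wf d B y p))
        (depth-children g (depth B) (≤-trans (≤-reflexive (sym (h (λ _ → 1)))) le)))))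

  WellFormedᴰ : ℕ → DecisionList → Set
  WellFormedᴰ d = All (WellFormed d n ∘ proj₁)

  ∧ᴰ-wf : ∀ {d e l m} → WellFormedᴰ d l → WellFormedᴰ e m → WellFormedᴰ (d + e) (l ∧ᴰ m)
  ∧ᴰ-wf []      v = []
  ∧ᴰ-wf (a ∷ w) v = Allₚ.++⁺ (Allₚ.map⁺ (All.map (*ₚ-wf a) v)) (∧ᴰ-wf w v)

  flipIf-wf : ∀ {d} b {l} → WellFormedᴰ d l → WellFormedᴰ d (flipIf b l)
  flipIf-wf b = Allₚ.map⁺

  literalList-wf : ∀ {d x} → 1 ≤ d → x < n → WellFormedᴰ d (literalList x)
  literalList-wf p q = literal-wf p q ∷ one-wf ∷ []

  concatMap-wf : ∀ {d} (f : ℕ → Polynomial) {js} → All (WellFormed d n ∘ f) js → WellFormed d n (concatMap f js)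
  concatMap-wf f []       = []
  concatMap-wf f (w ∷ ws) = Allₚ.++⁺ w (concatMap-wf f ws)

  decisions-wf : ∀ d {j} (C : Circuit n j) x → depth C x ≤ d → WellFormedᴰ (2 ^ d) (decisions d (rawGates C) (toℕ x))
  decisions-wf zero C x le with locate C x
  ... | variable′ i e f h = literalList-wf ≤-refl (subst (_< n) (sym f) (toℕ<n i))
  ... | gate B g e f h    = contradiction (≤-trans (≤-reflexive (sym (h (λ _ → 1)))) le) λ ()
  decisions-wf (suc d) C x le with locate C x
  ... | variable′ i e f h rewrite e = literalList-wf (m^n>0 2 (suc d)) (subst (_< n) (sym f) (toℕ<n i))
  ... | gate B g e f h rewrite e | parse-rawGate g = cases (2 <ᵇ length (map toℕ (fanIn g)))
    where
    children : All (λ y → depth B y ≤ d) (fanIn g)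
    children = depth-children g (depth B) (≤-trans (≤-reflexive (sym (h (λ _ → 1)))) le)
    i = proj₂ (flags g)
    cases : ∀ b → WellFormedᴰ (2 ^ suc d) (if b then largeGate (proj₁ (flags g) , i , map toℕ (fanIn g)) (exact d (rawGates B))
                                               else smallGate (proj₁ (flags g) , i , map toℕ (fanIn g)) (decisions d (rawGates B)))
    cases true  = concatMap-wf _ (Allₚ.map⁺ (All.map (λ {y} p → weaken-wf (2^≤ d) (complementIf-wf (not i) (exact-wf d B y p))) children))
                  ∷ one-wf ∷ []
    cases false = flipIf-wf (proj₁ (flags g)) (fold₂-All (WellFormedᴰ (2 ^ d)) (WellFormedᴰ (2 ^ suc d))
      (one-wf ∷ []) (All.map (weaken-wf (2^≤ d))) (λ {l} {m} v w → subst (λ d → WellFormedᴰ d (l ∧ᴰ m)) (2^-double d) (∧ᴰ-wf v w))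
      (All-toℕ _ (All.map (λ {y} p → flipIf-wf i (decisions-wf d B y p)) children)))

  flatten-wf : ∀ {d} k {l} → WellFormedᴰ d l → WellFormed d n (flatten k l)
  flatten-wf zero    w       = []
  flatten-wf (suc k) []      = []
  flatten-wf {d} (suc k) {(p , b) ∷ l} (w ∷ ws) =
    Allₚ.++⁺ (*ₚ-wf {d = 0} (constants-wf ((false , []) ∷ flatten k l)) w) (flatten-wf k ws)
    where
    constants-wf : ∀ q → WellFormed 0 n (map (λ _ → not b , []) q)
    constants-wf []      = []
    constants-wf (_ ∷ q) = (z≤n , []) ∷ constants-wf q

-- Variables and large gates give 2 entries; a small gate gives 1, those of its only input, or a
-- product of two lengths. The sum covers all cases and depends on the depth only, so flattening is
-- a constant number of nested steps.
entries : ℕ → ℕ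
entries zero    = 2
entries (suc d) = 2 + entries d + entries d * entries d

∧ᴰ-length : ∀ l m → length (l ∧ᴰ m) ≡ length l * length m
∧ᴰ-length []            m = refl
∧ᴰ-length ((p , b) ∷ l) m = trans (length-++ (map _ m)) (cong₂ _+_ (length-map _ m) (∧ᴰ-length l m))

decisions-length : ∀ d gs x → length (decisions d gs x) ≤ entries d
decisions-length zero    gs x = ≤-refl
decisions-length (suc d) gs x with drop x gs
... | []     = s≤s (s≤s z≤n)
... | g ∷ hs = cases (2 <ᵇ length (proj₂ (proj₂ (parse g))))
  where
  o = proj₁ (parse g)
  i = proj₁ (proj₂ (parse g))
  cases : ∀ b → length (if b then largeGate (parse g) (exact d hs) else smallGate (parse g) (decisions d hs)) ≤ entries (suc d)
  cases true  = s≤s (s≤s z≤n)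
  cases false = ≤-trans (≤-reflexive (length-map _ (fold₂ ((one , true) ∷ []) _∧ᴰ_ (map child js))))
    (fold₂-All {A = DecisionList} (λ l → length l ≤ entries d) (λ l → length l ≤ entries (suc d))
      (s≤s z≤n) (λ p → ≤-trans p (m≤n⇒m≤1+n (m≤n⇒m≤1+n (m≤m+n _ _))))
      (λ {l} {m} p q → ≤-trans (≤-reflexive (∧ᴰ-length l m)) (≤-trans (*-mono-≤ p q) (m≤n+m _ (2 + entries d))))
      (Allₚ.map⁺ (All.universal (λ j → ≤-trans (≤-reflexive (length-map _ (decisions d hs j))) (decisions-length d hs j)) js)))
    where
    js = proj₂ (proj₂ (parse g))
    child : ℕ → DecisionList
    child j = flipIf i (decisions d hs j)

-- Correctness of the polynomial of a circuit

module _ {n : ℕ} (S : Subset n) (χ : ℕ → Bool) (agrees : ∀ i → lookup S i ≡ χ (toℕ i)) where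

  private
    largeWeight : ∀ {j} → Gate j → ℕ
    largeWeight g = if 2 <ᵇ length (fanIn g) then 1 else 0

    literal-value : ∀ x → ⟪ literal x ⟫ χ ≡ ⟨ χ x ⟩ᵇ
    literal-value x with χ x
    ... | true  = refl
    ... | false = refl

    small : ∀ {j} (g : Gate j) m → (2 <ᵇ length (fanIn g)) ≡ false → largeWeight g + m ≡ m × length (fanIn g) ≤ 2
    small g m eq = cong (λ b → (if b then 1 else 0) + m) eq , ≮⇒≥ (λ lt → contradiction (trans (sym eq) (T⇒≡ (<⇒<ᵇ lt))) λ ())

  exact-value : ∀ d {j} (C : Circuit n j) x → depth C x ≤ d → weft C x ≤ 0 →
                ⟪ exact d (rawGates C) (toℕ x) ⟫ χ ≡ ⟨ value C S x ⟩ᵇ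
  exact-value zero C x le we with locate C x
  ... | variable′ i e f h = trans (literal-value _) (cong ⟨_⟩ᵇ (trans (cong χ f) (sym (trans (h S) (agrees i)))))
  ... | gate B g e f h    = contradiction (≤-trans (≤-reflexive (sym (h (λ _ → 1)))) le) λ ()
  exact-value (suc d) C x le we with locate C x
  ... | variable′ i e f h rewrite e = trans (literal-value _) (cong ⟨_⟩ᵇ (trans (cong χ f) (sym (trans (h S) (agrees i)))))
  ... | gate B g e f h rewrite e | parse-rawGate g | f S | gateValue-flags g (value B S) = cases (2 <ᵇ length (fanIn g)) refl
    where
    o = proj₁ (flags g)
    i = proj₂ (flags g)
    we′ : largeWeight g + foldr _⊔_ 0 (map (weft B) (fanIn g)) ≤ 0
    we′ = ≤-trans (≤-reflexive (sym (h largeWeight))) we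
    cases : ∀ b → (2 <ᵇ length (fanIn g)) ≡ b → ⟪ exactGate (o , i , map toℕ (fanIn g)) (exact d (rawGates B)) ⟫ χ
                                                ≡ ⟨ o xor allXor χ i (value B S) (fanIn g) ⟩ᵇ
    -- A large gate would contribute 1 to a weft that is 0.
    cases true  eq = contradiction (subst (λ b → (if b then 1 else 0) + foldr _⊔_ 0 (map (weft B) (fanIn g)) ≤ 0) eq we′) λ ()
    cases false eq = complementIf-exact χ o _ (fold₂-allXor χ (λ p b → ⟪ p ⟫ χ ≡ ⟨ b ⟩ᵇ) refl (λ {a} {b} {c} → *ₚ-exact χ a c) i _ (value B S) (fanIn g)
      (proj₂ (small g 0 eq)) (All.zipWith (λ {y} (p , q) → complementIf-exact χ i _ (exact-value d B y p q))
        (depth-children g (depth B) (≤-trans (≤-reflexive (sym (h (λ _ → 1)))) le) ,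
         max≤⇒All≤ (weft B) (fanIn g) (≤-trans (≤-reflexive (sym (proj₁ (small g _ eq)))) we′))))

  decisions-decide : ∀ d {j} (C : Circuit n j) x → depth C x ≤ d → weft C x ≤ 1 →
                     Decides χ (decisions d (rawGates C) (toℕ x)) (value C S x)
  decisions-decide zero C x le we with locate C x
  ... | variable′ i e f h = subst (Decides χ _) (trans (cong χ f) (sym (trans (h S) (agrees i)))) (literalList-decides χ _)
  ... | gate B g e f h    = contradiction (≤-trans (≤-reflexive (sym (h (λ _ → 1)))) le) λ ()
  decisions-decide (suc d) C x le we with locate C x
  ... | variable′ i e f h rewrite e = subst (Decides χ _) (trans (cong χ f) (sym (trans (h S) (agrees i)))) (literalList-decides χ _)
  ... | gate B g e f h rewrite e | parse-rawGate g | length-map toℕ (fanIn g) | f S | gateValue-flags g (value B S) =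
    cases (2 <ᵇ length (fanIn g)) refl
    where
    o = proj₁ (flags g)
    i = proj₂ (flags g)
    we′ : largeWeight g + foldr _⊔_ 0 (map (weft B) (fanIn g)) ≤ 1
    we′ = ≤-trans (≤-reflexive (sym (h largeWeight))) we
    children : All (λ y → depth B y ≤ d) (fanIn g)
    children = depth-children g (depth B) (≤-trans (≤-reflexive (sym (h (λ _ → 1)))) le)
    cases : ∀ b → (2 <ᵇ length (fanIn g)) ≡ b →
            Decides χ (if b then largeGate (o , i , map toℕ (fanIn g)) (exact d (rawGates B))
                            else smallGate (o , i , map toℕ (fanIn g)) (decisions d (rawGates B)))
                      (o xor allXor χ i (value B S) (fanIn g))
    -- A large gate uses up the whole weft; its inputs have weft 0 and are represented exactly.
    cases true  eq = largeGate-decides χ o i _ (value B S) (fanIn g) (All.zipWith (λ {y} (p , q) → exact-value d B y p q)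
      (children , max≤⇒All≤ (weft B) (fanIn g) (s≤s⁻¹ (subst (λ b → (if b then 1 else 0) + foldr _⊔_ 0 (map (weft B) (fanIn g)) ≤ 1) eq we′))))
    cases false eq = flipIf-decides χ o (fold₂-allXor χ (Decides χ) (here (+<+ (s≤s z≤n))) (∧ᴰ-decides χ) i _ (value B S) (fanIn g)
      (proj₂ (small g 0 eq)) (All.zipWith (λ {y} (p , q) → flipIf-decides χ i (decisions-decide d B y p q))
        (children , max≤⇒All≤ (weft B) (fanIn g) (≤-trans (≤-reflexive (sym (proj₁ (small g _ eq)))) we′))))

polynomial : ℕ → List RawGate → ℕ → Polynomial
polynomial d gs x = flatten (entries d) (decisions d gs x)

polynomial-wf : ∀ d {n j} (C : Circuit n j) x → depth C x ≤ d → WellFormed (2 ^ d) n (polynomial d (rawGates C) (toℕ x))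
polynomial-wf d C x le = flatten-wf (entries d) (decisions-wf d C x le)

polynomial-sign : ∀ d {n j} (C : Circuit n j) x → depth C x ≤ d → weft C x ≤ 1 →
                  ∀ S χ → (∀ i → lookup S i ≡ χ (toℕ i)) → HasSign χ (value C S x) (⟪ polynomial d (rawGates C) (toℕ x) ⟫ χ)
polynomial-sign d C x le we S χ agrees =
  flatten-sign χ (entries d) _ (decisions-length d (rawGates C) (toℕ x)) (decisions-decide S χ agrees d C x le we)

-- The candidates and their costs

total : ∀ {A : Set} → (A → ℕ) → List A → ℕ
total w l = sum (map w l)

count : ∀ {A : Set} → (A → Bool) → List A → ℕ
count f = total (λ a → if f a then 1 else 0)

module _ {A : Set} where

  total-++ : ∀ (w : A → ℕ) l m → total w (l ++ m) ≡ total w l + total w m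
  total-++ w l m = trans (cong sum (map-++ w l m)) (sum-++ (map w l) (map w m))

  total-cong : ∀ {v w : A → ℕ} l → (∀ a → v a ≡ w a) → total v l ≡ total w l
  total-cong l e = cong sum (map-cong e l)

  total-+ : ∀ (v w : A → ℕ) l → total (λ a → v a + w a) l ≡ total v l + total w l
  total-+ v w []      = refl
  total-+ v w (a ∷ l) = trans (cong (λ k → v a + w a + k) (total-+ v w l)) (+-interchange (v a) (w a) (total v l) (total w l))
    where
    +-interchange : ∀ a b c d → (a + b) + (c + d) ≡ (a + c) + (b + d)
    +-interchange = solve 4 (λ a b c d → (a :+ b) :+ (c :+ d) := (a :+ c) :+ (b :+ d)) refl
      where open +-*-Solver

  total-0 : ∀ (w : A → ℕ) l → (∀ a → w a ≡ 0) → total w l ≡ 0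
  total-0 w []      e = refl
  total-0 w (a ∷ l) e = cong₂ _+_ (e a) (total-0 w l e)

  total-*ʳ : ∀ (w : A → ℕ) c l → total (λ a → w a * c) l ≡ total w l * c
  total-*ʳ w c []      = refl
  total-*ʳ w c (a ∷ l) = trans (cong (λ k → w a * c + k) (total-*ʳ w c l)) (sym (*-distribʳ-+ c (w a) (total w l)))

  total-concatMap : ∀ {B : Set} (w : A → ℕ) (h : B → List A) l → total w (concatMap h l) ≡ total (λ b → total w (h b)) l
  total-concatMap w h []      = refl
  total-concatMap w h (b ∷ l) = trans (total-++ w (h b) (concatMap h l)) (cong (λ k → total w (h b) + k) (total-concatMap w h l))

  total-map : ∀ {B : Set} (w : A → ℕ) (h : B → A) l → total w (map h l) ≡ total (w ∘ h) l
  total-map w h l = cong sum (sym (map-∘ l))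

-- Tuples and coefficients

-- Repetitions and all orders are included because monomials are concatenated without being
-- normalised; every monomial is then literally one of the tuples.
tuples : ℕ → List ℕ → List (List ℕ)
tuples zero    xs = [] ∷ []
tuples (suc s) xs = [] ∷ concatMap (λ x → map (x ∷_) (tuples s xs)) xs

-- The geometric sum `1 + k + ... + k ^ s`.
tupleCount : ℕ → ℕ → ℕ
tupleCount zero    k = 1
tupleCount (suc s) k = suc (k * tupleCount s k)

tupleCount-mono-< : ∀ s {j k} → j < k → tupleCount (suc s) j < tupleCount (suc s) k
tupleCount-mono-< s {j} {k} j<k = s≤s (≤-trans (s≤s (*-monoʳ-≤ j (mono s (<⇒≤ j<k))))
  (≤-trans (+-monoˡ-≤ (j * tupleCount s k) (pos s k)) (*-monoˡ-≤ (tupleCount s k) j<k)))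
  where
  pos : ∀ s k → 1 ≤ tupleCount s k
  pos zero    k = ≤-refl
  pos (suc s) k = s≤s z≤n
  mono : ∀ s {j k} → j ≤ k → tupleCount s j ≤ tupleCount s k
  mono zero    p = ≤-refl
  mono (suc s) p = s≤s (*-mono-≤ p (mono s p))

count-tuples : ∀ χ s xs → count (holds χ) (tuples s xs) ≡ tupleCount s (count χ xs)
count-tuples χ zero    xs = refl
count-tuples χ (suc s) xs = cong suc
  (trans (total-concatMap (λ a → if holds χ a then 1 else 0) (λ x → map (x ∷_) (tuples s xs)) xs)
  (trans (total-cong xs (λ x → trans (total-map (λ a → if holds χ a then 1 else 0) (x ∷_) (tuples s xs)) (starting x)))
         (total-*ʳ (λ x → if χ x then 1 else 0) (tupleCount s (count χ xs)) xs)))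
  where
  starting : ∀ x → count (λ a → χ x ∧ holds χ a) (tuples s xs) ≡ (if χ x then 1 else 0) * tupleCount s (count χ xs)
  starting x with χ x
  ... | true  = trans (count-tuples χ s xs) (sym (+-identityʳ _))
  ... | false = total-0 _ (tuples s xs) (λ _ → refl)

≡ᵇ-refl : ∀ x → (x ≡ᵇ x) ≡ true
≡ᵇ-refl zero    = refl
≡ᵇ-refl (suc x) = ≡ᵇ-refl x

≡ᵇ-≢ : ∀ {x y} → x ≢ y → (x ≡ᵇ y) ≡ false
≡ᵇ-≢ {zero}  {zero}  n = contradiction refl n
≡ᵇ-≢ {zero}  {suc y} n = refl
≡ᵇ-≢ {suc x} {zero}  n = refl
≡ᵇ-≢ {suc x} {suc y} n = ≡ᵇ-≢ (n ∘ cong suc)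

total-single : ∀ (g : ℕ → ℕ) {x xs} → Unique xs → x ∈ xs → total (λ y → if x ≡ᵇ y then g y else 0) xs ≡ g x
total-single g {x} (x∉ ∷ u) (here refl) = trans (cong₂ _+_ (cong (λ b → if b then g x else 0) (≡ᵇ-refl x)) (rest x∉)) (+-identityʳ (g x))
  where
  rest : ∀ {ys} → All (x ≢_) ys → total (λ y → if x ≡ᵇ y then g y else 0) ys ≡ 0
  rest []      = refl
  rest {y ∷ ys} (n ∷ ns) = cong₂ _+_ (cong (λ b → if b then g y else 0) (≡ᵇ-≢ n)) (rest ns)
total-single g {x} {y ∷ ys} (x∉ ∷ u) (there i) = cong₂ _+_ (cong (λ b → if b then g y else 0)
  (≡ᵇ-≢ (λ eq → All.lookup x∉ i (sym eq)))) (total-single g u i)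

-- As the entries of `xs` are distinct, `m` occurs once among the tuples. The test `f` is arbitrary
-- so that the induction can replace it by `f ∘ (y ∷_)`.
tuple-once : ∀ (f : List ℕ → Bool) {s m xs} → Unique xs → length m ≤ s → All (_∈ xs) m →
             total (λ a → if f a ∧ eqList m a then 1 else 0) (tuples s xs) ≡ (if f m then 1 else 0)
tuple-once f {zero}  {[]} u le [] with f []
... | true  = refl
... | false = refl
tuple-once f {suc s} {[]} {xs} u le [] = trans (cong₂ _+_ (head (f []))
    (trans (total-concatMap _ (λ x → map (x ∷_) (tuples s xs)) xs)
           (total-0 _ xs (λ x → trans (total-map _ (x ∷_) (tuples s xs)) (total-0 _ (tuples s xs) (λ a → empty (f (x ∷ a))))))))
    (+-identityʳ _)
  where
  head : ∀ b → (if b ∧ true then 1 else 0) ≡ (if b then 1 else 0)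
  head true  = refl
  head false = refl
  empty : ∀ b → (if b ∧ false then 1 else 0) ≡ 0
  empty true  = refl
  empty false = refl
tuple-once f {suc s} {x ∷ m} {xs} u (s≤s le) (x∈ ∷ m⊆) = trans (cong₂ _+_ (head (f []))
    (trans (total-concatMap _ (λ y → map (y ∷_) (tuples s xs)) xs)
           (total-cong xs (λ y → trans (total-map _ (y ∷_) (tuples s xs)) (starting y)))))
    (total-single (λ y → if f (y ∷ m) then 1 else 0) u x∈)
  where
  head : ∀ b → (if b ∧ false then 1 else 0) ≡ 0
  head true  = refl
  head false = refl
  starting : ∀ y → total (λ a → if f (y ∷ a) ∧ ((x ≡ᵇ y) ∧ eqList m a) then 1 else 0) (tuples s xs)
                   ≡ (if x ≡ᵇ y then (if f (y ∷ m) then 1 else 0) else 0)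
  starting y with x ≡ᵇ y
  ... | true  = tuple-once (f ∘ (y ∷_)) u le m⊆
  ... | false = total-0 _ (tuples s xs) (λ a → head (f (y ∷ a)))

-- Occurrences of either sign (`true` is negative) are counted apart and not cancelled, which gives
-- natural numbers that can serve as costs.
coefficient : Bool → Polynomial → List ℕ → ℕ
coefficient b p a = total (λ (s , m) → if not (b xor s) ∧ eqList m a then 1 else 0) p

within : (ℕ → Bool) → (List ℕ → ℕ) → List (List ℕ) → ℕ
within χ w = total (λ a → if holds χ a then w a else 0)

within-+ : ∀ χ v w l → within χ (λ a → v a + w a) l ≡ within χ v l + within χ w l
within-+ χ v w l = trans (total-cong l (λ a → lemma (holds χ a)))
                         (total-+ (λ a → if holds χ a then v a else 0) (λ a → if holds χ a then w a else 0) l)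
  where
  lemma : ∀ b {m n} → (if b then m + n else 0) ≡ (if b then m else 0) + (if b then n else 0)
  lemma true  = refl
  lemma false = refl

-- The negative part stands on the left, so both sums remain natural numbers and the sign of the
-- value becomes a comparison of two sums over kept tuples.
value-coefficients : ∀ χ {s n} p → WellFormed s n p → let ts = tuples s (upTo n) in
  ⟪ p ⟫ χ ℤ.+ + within χ (coefficient true p) ts ≡ + within χ (coefficient false p) ts
value-coefficients χ {s} {n} [] [] =
  cong +_ (trans (total-0 _ (tuples s (upTo n)) (λ a → if-eta (holds χ a))) (sym (total-0 _ (tuples s (upTo n)) (λ a → if-eta (holds χ a)))))
value-coefficients χ {s} {n} ((t , m) ∷ p) ((short , vars) ∷ wf) =
  trans (cong (λ z → ⟪ (t , m) ∷ p ⟫ χ ℤ.+ + z) (split true))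
  (trans (combine t (holds χ m) (⟪ p ⟫ χ) (value-coefficients χ p wf)) (cong +_ (sym (split false))))
  where
  ts = tuples s (upTo n)
  indicator : Bool → List ℕ → ℕ
  indicator b a = if not (b xor t) ∧ eqList m a then 1 else 0
  indicator-total : ∀ b → within χ (indicator b) ts ≡ (if not (b xor t) then (if holds χ m then 1 else 0) else 0)
  indicator-total b with not (b xor t)
  ... | true  = trans (total-cong ts (λ a → lemma (holds χ a) (eqList m a)))
                      (tuple-once (holds χ) (Uniqueₚ.upTo⁺ n) short (All.map ∈-upTo⁺ vars))
    where
    lemma : ∀ b c → (if b then (if c then 1 else 0) else 0) ≡ (if b ∧ c then 1 else 0)
    lemma true  _ = refl
    lemma false _ = refl
  ... | false = total-0 _ ts (λ a → if-eta (holds χ a))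
  split : ∀ b → within χ (coefficient b ((t , m) ∷ p)) ts
              ≡ (if not (b xor t) then (if holds χ m then 1 else 0) else 0) + within χ (coefficient b p) ts
  split b = trans (within-+ χ (indicator b) (coefficient b p) ts) (cong (_+ within χ (coefficient b p) ts) (indicator-total b))
  combine : ∀ t h z {u v} → z ℤ.+ + u ≡ + v →
            ((if h then sign t else 0ℤ) ℤ.+ z) ℤ.+ + ((if not (true xor t) then (if h then 1 else 0) else 0) + u)
            ≡ + ((if not (false xor t) then (if h then 1 else 0) else 0) + v)
  combine t     false z {u} {v} e = trans (cong (ℤ._+ + ((if not (true xor t) then 0 else 0) + u)) (ℤₚ.+-identityˡ z))
    (trans (cong (λ k → z ℤ.+ + (k + u)) (if-eta (not (true xor t)))) (trans e (cong (λ k → + (k + v)) (sym (if-eta (not (false xor t)))))))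
  combine true  true z {u} {v} e = trans (cong (ℤ._+ + suc u) (ℤₚ.+-comm -1ℤ z))
    (trans (ℤₚ.+-assoc z -1ℤ (+ suc u)) e)
  combine false true z {u} {v} e = trans (ℤₚ.+-assoc 1ℤ z (+ u)) (cong (λ k → 1ℤ ℤ.+ k) e)

positive⇔ : ∀ χ {s n} p → WellFormed s n p → let ts = tuples s (upTo n) in
  (0ℤ ℤ.< ⟪ p ⟫ χ → within χ (coefficient true p) ts < within χ (coefficient false p) ts) ×
  (within χ (coefficient true p) ts < within χ (coefficient false p) ts → 0ℤ ℤ.< ⟪ p ⟫ χ)
positive⇔ χ {s} {n} p wf = lemma (⟪ p ⟫ χ) (value-coefficients χ p wf)
  where
  lemma : ∀ z {u v} → z ℤ.+ + u ≡ + v → (0ℤ ℤ.< z → u < v) × (u < v → 0ℤ ℤ.< z)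
  lemma z {u} {v} e = (λ lt → ℤₚ.drop‿+<+ (subst₂ ℤ._<_ (ℤₚ.+-identityˡ (+ u)) e (ℤₚ.+-monoˡ-< (+ u) lt))) ,
    (λ lt → ℤₚ.≰⇒> (λ z≤0 → <⇒≱ lt (ℤₚ.drop‿+≤+ (subst₂ ℤ._≤_ e (ℤₚ.+-identityˡ (+ u)) (ℤₚ.+-monoˡ-≤ (+ u) z≤0)))))

∣∣-count : ∀ {n} (S : Subset n) (χ : ℕ → Bool) (f : ℕ → ℕ) → (∀ i → lookup S i ≡ χ (f (toℕ i))) → ∣ S ∣ ≡ count χ (applyUpTo f n)
∣∣-count Vec.[]       χ f e = refl
∣∣-count (true  Vec.∷ S) χ f e = cong₂ _+_ (cong (λ b → if b then 1 else 0) (e zero)) (∣∣-count S χ (f ∘ suc) (e ∘ suc))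
∣∣-count (false Vec.∷ S) χ f e = cong₂ _+_ (cong (λ b → if b then 1 else 0) (e zero)) (∣∣-count S χ (f ∘ suc) (e ∘ suc))

-- The constructed instance

-- A sum of encoded types, so that programs can compute with candidates directly.
Candidate : Set
Candidate = ⊤ ⊎ ⊤ ⊎ ℕ ⊎ List ℕ ⊎ ⊤

pattern dummy     = inj₁ tt
pattern toll      = inj₂ (inj₁ tt)
pattern vertex x  = inj₂ (inj₂ (inj₁ x))
pattern tuple a   = inj₂ (inj₂ (inj₂ (inj₁ a)))
pattern favourite = inj₂ (inj₂ (inj₂ (inj₂ tt)))

match : ∀ {A : Set} → Candidate → A → A → (ℕ → A) → (List ℕ → A) → A → A
match dummy      a b f g c = a
match toll       a b f g c = b
match (vertex x) a b f g c = f x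
match (tuple x)  a b f g c = g x
match favourite  a b f g c = c

-- Keeping a tuple ahead of the favourite forces its vertices to be kept, and
-- keeping the toll candidate would force all dummies to be kept.
candidateCost : ℕ → ℕ → ℕ → (List ℕ → ℕ) → (List ℕ → ℕ) → Candidate → Candidate → ℕ
candidateCost forbidden fee base pos neg c d = match c
  (match d 0 forbidden (λ _ → 0) (λ _ → 0) 0)
  (match d 0 0 (λ _ → 0) neg fee)
  (λ x → match d 0 0 (λ _ → 0) (λ a → if member x a then forbidden else 0) 0)
  (λ a → match d 0 0 (λ _ → 0) (λ _ → 0) (base + pos a))
  0

member⇒∈ : ∀ {x} a → member x a ≡ true → x ∈ a
member⇒∈ {x} (y ∷ a) e with x ≡ᵇ y in eq
... | true  = here (≡ᵇ⇒≡ x y (subst T (sym eq) tt))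
... | false = there (member⇒∈ a e)

∈⇒member : ∀ {x a} → x ∈ a → member x a ≡ true
∈⇒member {x} (here refl) rewrite ≡ᵇ-refl x = refl
∈⇒member {x} {y ∷ a} (there i) with x ≡ᵇ y
... | true  = refl
... | false = ∈⇒member i

holds⇒ : ∀ χ {a} → holds χ a ≡ true → ∀ {x} → x ∈ a → χ x ≡ true
holds⇒ χ {y ∷ a} e i with χ y in eq
holds⇒ χ {y ∷ a} e (here refl) | true = eq
holds⇒ χ {y ∷ a} e (there i)   | true = holds⇒ χ e i

holds⇐ : ∀ χ {a} → (∀ {x} → x ∈ a → χ x ≡ true) → holds χ a ≡ true
holds⇐ χ {[]}    h = refl
holds⇐ χ {y ∷ a} h rewrite h (here refl) = holds⇐ χ (h ∘ there)

tuples-⊆ : ∀ s xs → All (All (_∈ xs)) (tuples s xs)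
tuples-⊆ zero    xs = [] ∷ []
tuples-⊆ (suc s) xs = [] ∷ go xs (λ i → i)
  where
  go : ∀ ys → (∀ {y} → y ∈ ys → y ∈ xs) → All (All (_∈ xs)) (concatMap (λ x → map (x ∷_) (tuples s xs)) ys)
  go []       h = []
  go (y ∷ ys) h = Allₚ.++⁺ (Allₚ.map⁺ (All.map (h (here refl) ∷_) (tuples-⊆ s xs))) (go ys (h ∘ there))

split-labels : ∀ {A : Set} (ls : List (A × Bool)) xs {ys} → map proj₁ ls ≡ xs ++ ys →
               ∃[ ks ] ∃[ ms ] ls ≡ ks ++ ms × map proj₁ ks ≡ xs × map proj₁ ms ≡ ys
split-labels ls       []       e = [] , ls , refl , refl , e
split-labels (l ∷ ls) (x ∷ xs) e =
  let (ks , ms , p , q , r) = split-labels ls xs (∷-injectiveʳ e)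
  in l ∷ ks , ms , cong (l ∷_) p , cong₂ _∷_ (∷-injectiveˡ e) q , r

module Reduction (n k s : ℕ) (P : Polynomial) where

  pos neg : List ℕ → ℕ
  pos = coefficient false P
  neg = coefficient true P

  ts : List (List ℕ)
  ts = tuples (suc s) (upTo n)

  -- The budget is the price of dropping all tuples. Keeping `τ` of them saves `τ * base` and their
  -- positive coefficients, and has to make up for the fee and their negative coefficients. All
  -- positive coefficients together amount to `base` only, so fewer than `N` tuples save at most
  -- `N * base`, which is less than the fee. With exactly `N` tuples the `suc` in the fee demands
  -- that the positive part be strictly larger.
  N κ base fee budget : ℕ
  N      = tupleCount (suc s) k
  κ      = k + N
  base   = total pos ts
  fee    = suc (N * base)
  budget = total (λ a → base + pos a) ts

  cost : Candidate → Candidate → ℕ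
  cost = candidateCost (suc budget) fee base pos neg

  -- A pair costs something only if its front member leaves and the other one stays. Hence dummies
  -- precede `toll`, which they guard, and `toll` and the vertices precede the tuples for which they
  -- are charged.
  body : List Candidate
  body = map (const dummy) (replicate κ tt) ++ toll ∷ (map vertex (upTo n) ++ map tuple ts)

  open Labelling cost favourite

  Labels : Set
  Labels = List (Candidate × Bool)

  vertexLabels : (ℕ → Bool) → List ℕ → Labels
  vertexLabels χ = map (λ x → vertex x , χ x)

  tupleLabels : List (List ℕ × Bool) → Labels
  tupleLabels = map (λ (a , b) → tuple a , b)

  keptCost-0 : ∀ x {l} → All (λ (y , b) → b ≡ true → cost x y ≡ 0) l → keptCost x l ≡ 0
  keptCost-0 x []                        = refl
  keptCost-0 x (_∷_ {_ , true}  p ps) = cong₂ _+_ (p refl) (keptCost-0 x ps)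
  keptCost-0 x (_∷_ {_ , false} p ps) = keptCost-0 x ps

  keptCost-++ : ∀ x l m → keptCost x (l ++ m) ≡ keptCost x l + keptCost x m
  keptCost-++ x []            m = refl
  keptCost-++ x ((y , b) ∷ l) m = trans (cong (λ z → (if b then cost x y else 0) + z) (keptCost-++ x l m)) (sym (+-assoc (if b then cost x y else 0) _ _))

  countTrue-++ : ∀ l m → countTrue (l ++ m) ≡ countTrue l + countTrue m
  countTrue-++ []            m = refl
  countTrue-++ ((_ , b) ∷ l) m = trans (cong (λ z → (if b then 1 else 0) + z) (countTrue-++ l m)) (sym (+-assoc (if b then 1 else 0) _ _))

  tupleLabels-kept : ∀ qs → keptCost toll (tupleLabels qs) ≡ total (λ (a , b) → if b then neg a else 0) qs
  tupleLabels-kept []             = refl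
  tupleLabels-kept ((a , b) ∷ qs) = cong (λ z → (if b then neg a else 0) + z) (tupleLabels-kept qs)

  tupleLabels-cost : ∀ qs → totalCost (tupleLabels qs) ≡ total (λ (a , b) → if b then 0 else base + pos a) qs
  tupleLabels-cost []                 = refl
  tupleLabels-cost ((a , true)  ∷ qs) = tupleLabels-cost qs
  tupleLabels-cost ((a , false) ∷ qs) = cong₂ _+_ (trans (cong (λ z → base + pos a + z)
    (keptCost-0 (tuple a) (Allₚ.map⁺ (All.universal (λ _ _ → refl) qs)))) (+-identityʳ _)) (tupleLabels-cost qs)

  tupleLabels-count : ∀ qs → countTrue (tupleLabels qs) ≡ count proj₂ qs
  tupleLabels-count []             = refl
  tupleLabels-count ((a , b) ∷ qs) = cong (λ z → (if b then 1 else 0) + z) (tupleLabels-count qs)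

  vertexLabels-count : ∀ χ xs → countTrue (vertexLabels χ xs) ≡ count χ xs
  vertexLabels-count χ []       = refl
  vertexLabels-count χ (x ∷ xs) = cong (λ z → (if χ x then 1 else 0) + z) (vertexLabels-count χ xs)

  -- The price of the dropped tuples reappears in the total cost; separated here, it cancels.
  budget-split : ∀ qs → map proj₁ qs ≡ ts →
    budget ≡ (count proj₂ qs * base + total (λ (a , b) → if b then pos a else 0) qs) + total (λ (a , b) → if b then 0 else base + pos a) qs
  budget-split qs e = trans (cong (total (λ a → base + pos a)) (sym e)) (go qs)
    where
    go : ∀ qs → total (λ a → base + pos a) (map proj₁ qs)
              ≡ (count proj₂ qs * base + total (λ (a , b) → if b then pos a else 0) qs) + total (λ (a , b) → if b then 0 else base + pos a) qs
    go []                 = refl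
    go ((a , true)  ∷ qs) = trans (cong (λ z → base + pos a + z) (go qs))
      (solve 5 (λ m p x y z → (m :+ p) :+ ((x :+ y) :+ z) := ((m :+ x) :+ (p :+ y)) :+ z) refl base (pos a) (count proj₂ qs * base) _ _)
      where open +-*-Solver
    go ((a , false) ∷ qs) = trans (cong (λ z → base + pos a + z) (go qs))
      (solve 4 (λ q x y z → q :+ ((x :+ y) :+ z) := (x :+ y) :+ (q :+ z)) refl (base + pos a) (count proj₂ qs * base) _ _)
      where open +-*-Solver

  Accepted : (ℕ → Bool) → Set
  Accepted χ = count χ (upTo n) ≡ k × 0ℤ ℤ.< ⟪ P ⟫ χ

  accepted⇒outcome : WellFormed (suc s) n P → ∀ χ → Accepted χ → ∃ (Outcome body favourite cost budget κ)
  accepted⇒outcome wf χ (size≡k , positive) = ls , erases , few , cheap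
    where
    qs : List (List ℕ × Bool)
    qs = map (λ a → a , holds χ a) ts
    vs us : Labels
    vs = vertexLabels χ (upTo n)
    us = vs ++ tupleLabels qs
    ls : Labels
    ls = map (const (dummy , false)) (replicate κ tt) ++ (toll , false) ∷ us
    qs-erases : map proj₁ qs ≡ ts
    qs-erases = trans (sym (map-∘ ts)) (map-id ts)
    erases : map proj₁ ls ≡ body
    erases = trans (map-++ proj₁ (map (const (dummy , false)) (replicate κ tt)) _) (cong₂ _++_ (sym (map-∘ (replicate κ tt)))
      (cong (toll ∷_) (trans (map-++ proj₁ vs (tupleLabels qs)) (cong₂ _++_ (sym (map-∘ (upTo n)))
        (trans (sym (map-∘ qs)) (trans (map-∘ qs) (cong (map tuple) qs-erases)))))))
    hits : count proj₂ qs ≡ N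
    hits = trans (total-map (λ (_ , b) → if b then 1 else 0) (λ a → a , holds χ a) ts)
      (trans (count-tuples χ (suc s) (upTo n)) (cong (tupleCount (suc s)) size≡k))
    dummies-count : ∀ (l : List ⊤) m → countTrue (map (const (dummy , false)) l ++ m) ≡ countTrue m
    dummies-count []      m = refl
    dummies-count (_ ∷ l) m = dummies-count l m
    few : countTrue ls ≤ κ
    few = ≤-reflexive (trans (dummies-count (replicate κ tt) _) (trans (countTrue-++ vs (tupleLabels qs))
      (cong₂ _+_ (trans (vertexLabels-count χ (upTo n)) size≡k) (trans (tupleLabels-count qs) hits))))
    dummies-cost : ∀ (l : List ⊤) → totalCost (map (const (dummy , false)) l ++ (toll , false) ∷ us) ≡ totalCost ((toll , false) ∷ us)
    dummies-cost []      = refl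
    dummies-cost (_ ∷ l) = cong₂ _+_ (keptCost-0 dummy (Allₚ.++⁺ (Allₚ.map⁺ (All.universal (λ _ ()) l))
      ((λ ()) ∷ Allₚ.++⁺ (Allₚ.map⁺ (All.universal (λ _ _ → refl) (upTo n))) (Allₚ.map⁺ (All.universal (λ _ _ → refl) qs))))) (dummies-cost l)
    vertices-cost : ∀ xs → totalCost (vertexLabels χ xs ++ tupleLabels qs) ≡ totalCost (tupleLabels qs)
    vertices-cost []       = refl
    vertices-cost (x ∷ xs) with χ x in eq
    ... | true  = vertices-cost xs
    ... | false = cong₂ _+_ (keptCost-0 (vertex x) (Allₚ.++⁺ (Allₚ.map⁺ (All.universal (λ _ _ → refl) xs))
        (Allₚ.map⁺ (Allₚ.map⁺ (All.universal closed ts))))) (vertices-cost xs)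
      where
      closed : ∀ a → holds χ a ≡ true → (if member x a then suc budget else 0) ≡ 0
      closed a h with member x a in m
      ... | false = refl
      ... | true  = contradiction (trans (sym eq) (holds⇒ χ {a} h (member⇒∈ a m))) λ ()
    lost : ℕ
    lost = total (λ (a , b) → if b then 0 else base + pos a) qs
    positive′ : within χ neg ts < within χ pos ts
    positive′ = proj₁ (positive⇔ χ P wf) positive
    cost≡ : totalCost ls ≡ (fee + within χ neg ts) + lost
    cost≡ = trans (dummies-cost (replicate κ tt)) (cong₂ _+_ (cong (λ z → fee + z)
      (trans (keptCost-++ toll vs (tupleLabels qs)) (cong₂ _+_ (keptCost-0 toll (Allₚ.map⁺ (All.universal (λ _ _ → refl) (upTo n))))
        (trans (tupleLabels-kept qs) (total-map (λ (a , b) → if b then neg a else 0) (λ a → a , holds χ a) ts)))))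
      (trans (vertices-cost (upTo n)) (tupleLabels-cost qs)))
    cheap : totalCost ls ≤ budget
    -- The strict inequality between the two parts of `P` pays for the `suc` in the fee.
    cheap = ≤-trans (≤-reflexive cost≡) (≤-trans (+-monoˡ-≤ lost (≤-trans (≤-reflexive (sym (+-suc (N * base) _))) (+-monoʳ-≤ (N * base) positive′)))
      (≤-reflexive (sym (trans (budget-split qs qs-erases) (cong (_+ lost) (cong₂ _+_ (cong (_* base) hits)
        (total-map (λ (a , b) → if b then pos a else 0) (λ a → a , holds χ a) ts)))))))

  -- From a cheap labelling to an accepted set

  keptCost-∈ : ∀ x {y} {l} → (y , true) ∈ l → cost x y ≤ keptCost x l
  keptCost-∈ x (here refl)         = m≤m+n _ _
  keptCost-∈ x {l = (y , b) ∷ _} (there i) = ≤-trans (keptCost-∈ x i) (m≤n+m _ (if b then cost x y else 0))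

  totalCost-++ : ∀ l m → totalCost m ≤ totalCost (l ++ m)
  totalCost-++ []            m = ≤-refl
  totalCost-++ ((x , b) ∷ l) m = ≤-trans (totalCost-++ l m) (m≤n+m _ (if b then 0 else cost x favourite + keptCost x (l ++ m)))

  pair-cost : ∀ {x y} l {m} → (x , false) ∈ l → (y , true) ∈ m → cost x y ≤ totalCost (l ++ m)
  pair-cost (_ ∷ l) {m} (here {x = x , false} refl) j =
    ≤-trans (≤-trans (keptCost-∈ x (∈-++⁺ʳ l j)) (m≤n+m _ (cost x favourite))) (m≤m+n _ _)
  pair-cost ((z , b) ∷ l) {m} (there i) j =
    ≤-trans (pair-cost l i j) (m≤n+m _ (if b then 0 else cost z favourite + keptCost z (l ++ m)))

  dummies-kept : ∀ ds j → map proj₁ ds ≡ map (const dummy) (replicate j tt) → (dummy , false) ∈ ds ⊎ countTrue ds ≡ j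
  dummies-kept []       zero    e = inj₂ refl
  dummies-kept ((x , false) ∷ ds) (suc j) e with refl ← ∷-injectiveˡ e = inj₁ (here refl)
  dummies-kept ((x , true)  ∷ ds) (suc j) e with dummies-kept ds j (∷-injectiveʳ e)
  ... | inj₁ i = inj₁ (there i)
  ... | inj₂ c = inj₂ (cong suc c)

  vertices-labelled : ∀ (vs : Labels) m (f : ℕ → ℕ) → map proj₁ vs ≡ map (λ x → vertex x) (applyUpTo f m) →
                      vs ≡ applyUpTo (λ i → vertex (f i) , at (map proj₂ vs) false i) m
  vertices-labelled []             zero    f e = refl
  vertices-labelled ((x , b) ∷ vs) (suc m) f e =
    cong₂ _∷_ (cong (_, b) (∷-injectiveˡ e)) (vertices-labelled vs m (f ∘ suc) (∷-injectiveʳ e))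

  tuples-labelled : ∀ us as → map proj₁ us ≡ map tuple as → ∃[ qs ] us ≡ tupleLabels qs × map proj₁ qs ≡ as
  tuples-labelled []             []       e = [] , refl , refl
  tuples-labelled ((x , b) ∷ us) (a ∷ as) e with refl ← ∷-injectiveˡ e =
    let (qs , p , q) = tuples-labelled us as (∷-injectiveʳ e) in (a , b) ∷ qs , cong (_ ∷_) p , cong (a ∷_) q

  kept-pos≤ : ∀ qs → total (λ (a , b) → if b then pos a else 0) qs ≤ total pos (map proj₁ qs)
  kept-pos≤ []                 = z≤n
  kept-pos≤ ((a , true)  ∷ qs) = +-monoʳ-≤ (pos a) (kept-pos≤ qs)
  kept-pos≤ ((a , false) ∷ qs) = ≤-trans (kept-pos≤ qs) (m≤n+m _ (pos a))

  module _ (f : List ℕ → Bool) where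

    Implies Agrees : List ℕ × Bool → Set
    Implies (a , b) = b ≡ true → f a ≡ true
    Agrees  (a , b) = f a ≡ b

    count-≤ : ∀ {qs} → All Implies qs → count proj₂ qs ≤ count f (map proj₁ qs)
    count-≤ [] = z≤n
    count-≤ (_∷_ {a , true}  i is) rewrite i refl = s≤s (count-≤ is)
    count-≤ (_∷_ {a , false} i is) = ≤-trans (count-≤ is) (m≤n+m _ (if f a then 1 else 0))

    -- The labels form a subset of the tuples satisfying `f`; when they are as many, they are the
    -- same.
    count-agree : ∀ {qs} → All Implies qs → count f (map proj₁ qs) ≤ count proj₂ qs → All Agrees qs
    count-agree [] le = []
    count-agree (_∷_ {a , true} {qs} i is) le = i refl ∷ count-agree is
      (s≤s⁻¹ (subst (λ b → (if b then 1 else 0) + count f (map proj₁ qs) ≤ suc (count proj₂ qs)) (i refl) le))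
    count-agree (_∷_ {a , false} i is) le with f a in eq
    ... | true  = contradiction (≤-trans le (count-≤ is)) (<⇒≱ ≤-refl)
    ... | false = eq ∷ count-agree is le

    agree-total : ∀ (w : List ℕ → ℕ) {qs} → All Agrees qs →
                  total (λ (a , b) → if b then w a else 0) qs ≡ total (λ a → if f a then w a else 0) (map proj₁ qs)
    agree-total w []                  = refl
    agree-total w (_∷_ {a , _} e es) = cong₂ _+_ (cong (λ b → if b then w a else 0) (sym e)) (agree-total w es)

  module _ (χ : ℕ → Bool) (qs : List (List ℕ × Bool)) (qs-erases : map proj₁ qs ≡ ts) where

    private
      vs us : Labels
      vs = vertexLabels χ (upTo n)
      us = tupleLabels qs
      NegT PosT lost τ : ℕ
      NegT = total (λ (a , b) → if b then neg a else 0) qs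
      PosT = total (λ (a , b) → if b then pos a else 0) qs
      lost = total (λ (a , b) → if b then 0 else base + pos a) qs
      τ    = count proj₂ qs

    cheap⇒closed : totalCost (vs ++ us) ≤ budget → All (Implies (holds χ)) qs
    cheap⇒closed cheap = All.tabulate λ { {a , true} i refl → holds⇐ χ (λ {x} → vertex-kept a i x) }
      where
      vertex-kept : ∀ a → (a , true) ∈ qs → ∀ x → x ∈ a → χ x ≡ true
      vertex-kept a i x x∈a with χ x in eq
      ... | true  = refl
      ... | false = contradiction (≤-trans (≤-trans (≤-reflexive (cong (λ b → if b then suc budget else 0) (sym (∈⇒member x∈a))))
          (pair-cost vs (subst (λ b → (vertex x , b) ∈ vs) eq (∈-map⁺ (λ x → vertex x , χ x) x∈))
                     (∈-map⁺ (λ (a , b) → tuple a , b) i))) cheap) (<⇒≱ ≤-refl)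
        where
        x∈ : x ∈ upTo n
        x∈ = All.lookup (All.lookup (tuples-⊆ (suc s) (upTo n)) (subst (a ∈_) qs-erases (∈-map⁺ proj₁ i))) x∈a

    cheap⇒accepted : WellFormed (suc s) n P → countTrue (vs ++ us) ≤ κ → totalCost ((toll , false) ∷ vs ++ us) ≤ budget → Accepted χ
    cheap⇒accepted wf few cheap = j≡k , proj₂ (positive⇔ χ P wf) (subst₂ _<_ (agree-within neg) (agree-within pos) Neg<Pos)
      where
      closed : All (Implies (holds χ)) qs
      closed = cheap⇒closed (≤-trans (totalCost-++ ((toll , false) ∷ []) (vs ++ us)) cheap)
      j : ℕ
      j = count χ (upTo n)
      -- After cancelling the dropped tuples, the fee and the negative part face the savings.
      balance : suc (N * base) + NegT ≤ τ * base + PosT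
      balance = +-cancelʳ-≤ lost _ _ (≤-trans (+-mono-≤
          (+-monoʳ-≤ fee (≤-trans (≤-reflexive (sym (tupleLabels-kept qs))) (≤-trans (m≤n+m _ (keptCost toll vs)) (≤-reflexive (sym (keptCost-++ toll vs us))))))
          (≤-trans (≤-reflexive (sym (tupleLabels-cost qs))) (totalCost-++ vs us)))
        (≤-trans cheap (≤-reflexive (budget-split qs qs-erases))))
      PosT≤ : PosT ≤ base
      PosT≤ = ≤-trans (kept-pos≤ qs) (≤-reflexive (cong (total pos) qs-erases))
      N≤τ : N ≤ τ
      N≤τ = ≮⇒≥ λ τ<N → <⇒≱ (≤-trans (m≤m+n _ NegT) balance)
        (≤-trans (+-monoʳ-≤ (τ * base) PosT≤) (≤-trans (≤-reflexive (+-comm (τ * base) base)) (*-monoˡ-≤ base τ<N)))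
      holding : count (holds χ) (map proj₁ qs) ≡ tupleCount (suc s) j
      holding = trans (cong (count (holds χ)) qs-erases) (count-tuples χ (suc s) (upTo n))
      τ≤ : τ ≤ tupleCount (suc s) j
      τ≤ = ≤-trans (count-≤ (holds χ) closed) (≤-reflexive holding)
      -- Kept tuples use kept variables only, and fewer than `k` variables have fewer than `N`
      -- tuples.
      k≤j : k ≤ j
      k≤j = ≮⇒≥ λ j<k → <⇒≱ (tupleCount-mono-< s j<k) (≤-trans N≤τ τ≤)
      j+τ≤ : j + τ ≤ k + N
      j+τ≤ = ≤-trans (≤-reflexive (sym (trans (countTrue-++ vs us) (cong₂ _+_ (vertexLabels-count χ (upTo n)) (tupleLabels-count qs))))) few
      -- At least `N` of the `k + N` places go to tuples, which leaves at most `k` for variables.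
      j≡k : j ≡ k
      j≡k = ≤-antisym (+-cancelʳ-≤ N j k (≤-trans (+-monoʳ-≤ j N≤τ) j+τ≤)) k≤j
      τ≡N : τ ≡ N
      τ≡N = ≤-antisym (≤-trans τ≤ (≤-reflexive (cong (tupleCount (suc s)) j≡k))) N≤τ
      agree : All (Agrees (holds χ)) qs
      agree = count-agree (holds χ) closed (≤-trans (≤-reflexive (trans holding (cong (tupleCount (suc s)) j≡k))) N≤τ)
      agree-within : ∀ w → total (λ (a , b) → if b then w a else 0) qs ≡ within χ w ts
      agree-within w = trans (agree-total (holds χ) w agree) (cong (within χ w) qs-erases)
      Neg<Pos : NegT < PosT
      Neg<Pos = +-cancelˡ-≤ (N * base) _ _ (≤-trans (≤-reflexive (+-suc (N * base) NegT)) (≤-trans balance (≤-reflexive (cong (λ t → t * base + PosT) τ≡N))))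

  outcome⇒accepted : WellFormed (suc s) n P → ∃ (Outcome body favourite cost budget κ) → ∃ Accepted
  outcome⇒accepted wf (ls , erases , few , cheap)
    with ds , (_ , b) ∷ ms , refl , ds-erases , ms-erases ← split-labels ls (map (const dummy) (replicate κ tt)) erases
    with refl ← ∷-injectiveˡ ms-erases
    with vs , us , refl , vs-erases , us-erases ← split-labels ms (map vertex (upTo n)) (∷-injectiveʳ ms-erases)
    with qs , refl , qs-erases ← tuples-labelled us ts us-erases = χ , cheap⇒accepted χ qs qs-erases wf
      (≤-trans (m≤n+m _ (countTrue ds)) (≤-trans (≤-reflexive (sym count≡)) few))
      (≤-trans (totalCost-++ ds _) (≤-trans (≤-reflexive (sym cost≡)) cheap))
    where
    χ : ℕ → Bool
    χ = at (map proj₂ vs) false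
    vs≡ : vs ≡ vertexLabels χ (upTo n)
    vs≡ = trans (vertices-labelled vs n (λ i → i) vs-erases) (sym (map-upTo {A = Candidate × Bool} (λ x → vertex x , χ x) n))
    -- If `toll` stayed, a leaving dummy would exceed the budget, while `κ` staying dummies would
    -- fill all `κ` places.
    b≡false : b ≡ false
    b≡false = toll-moved b few cheap
      where
      toll-moved : ∀ b → countTrue (ds ++ (toll , b) ∷ vs ++ tupleLabels qs) ≤ κ →
                   totalCost (ds ++ (toll , b) ∷ vs ++ tupleLabels qs) ≤ budget → b ≡ false
      toll-moved false few cheap = refl
      toll-moved true  few cheap with dummies-kept ds κ ds-erases
      ... | inj₁ i = contradiction (≤-trans (pair-cost ds i (here refl)) cheap) (<⇒≱ ≤-refl)
      ... | inj₂ c = contradiction (≤-trans (≤-reflexive (sym (countTrue-++ ds _))) few)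
                       (<⇒≱ (≤-trans (≤-reflexive (cong suc (sym c))) (≤-trans (≤-reflexive (+-comm 1 _)) (+-monoʳ-≤ (countTrue ds) (s≤s z≤n)))))
    ls≡ : ds ++ (toll , b) ∷ vs ++ tupleLabels qs ≡ ds ++ (toll , false) ∷ vertexLabels χ (upTo n) ++ tupleLabels qs
    ls≡ = cong₂ (λ b vs → ds ++ (toll , b) ∷ vs ++ tupleLabels qs) b≡false vs≡
    count≡ = trans (cong countTrue ls≡) (countTrue-++ ds _)
    cost≡ = cong totalCost ls≡

-- The reduction as a program

polynomialT decisionT gatesT candidateT : Ty
polynomialT = list (bool `× list nat)
decisionT   = list (polynomialT `× bool)
gatesT      = list (nat `× list nat)
candidateT  = unit `⊎ unit `⊎ nat `⊎ list nat `⊎ unit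

cartesianF : ∀ {Γ A B C f l m} → FP ((Γ `× A) `× B) C f → FP Γ (list A) l → FP Γ (list B) m →
             FP Γ (list C) (λ γ → cartesian (λ a b → f ((γ , a) , b)) (l γ) (m γ))
cartesianF F L M = concatMapF (mapF F (M ∘F fstF)) L

*ₚF : ∀ {Γ p q} → FP Γ polynomialT p → FP Γ polynomialT q → FP Γ polynomialT (λ γ → p γ *ₚ q γ)
*ₚF P Q = cartesianF (xorF (fstF ∘F v1) (fstF ∘F v0) ,F appendF (sndF ∘F v1) (sndF ∘F v0)) P Q

literalF : ∀ {Γ x} → FP Γ nat x → FP Γ polynomialT (λ γ → literal (x γ))
literalF X = (constF false ,F X ∷F []F) ∷F []F

complementIfF : ∀ {Γ b p} → FP Γ bool b → FP Γ polynomialT p → FP Γ polynomialT (λ γ → complementIf (b γ) (p γ))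
complementIfF B P = ifF B (constF (false , []) ∷F mapF (notF (fstF ∘F v0) ,F sndF ∘F v0) P) P

fold₂F : ∀ {Γ A e _∙_ l} → FP Γ A e → FP ((Γ `× A) `× A) A (λ ((_ , a) , b) → a ∙ b) → FP Γ (list A) l →
         FP Γ A (λ γ → fold₂ (e γ) _∙_ (l γ))
fold₂F {e = e} {_∙_} {l} E M L = ≗FP (λ γ → lemma γ (l γ))
  (caseListF L E (caseListF (sndF ∘F v0) (fstF ∘F v0)
    (M ∘F ((fstF ∘F fstF ,F fstF ∘F v1) ,F fstF ∘F v0))))
  where
  lemma : ∀ γ l → caseList l (e γ) (λ a l → caseList l a (λ b _ → a ∙ b)) ≡ fold₂ (e γ) _∙_ l
  lemma γ []          = refl
  lemma γ (a ∷ [])    = refl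
  lemma γ (a ∷ b ∷ _) = refl

parseF : FP (nat `× list nat) (bool `× bool `× list nat) parse
parseF = caseNatF fstF (constF true ,F constF false ,F lengthF sndF ∷F []F)
  (caseNatF v0 (constF false ,F constF false ,F sndF ∘F fstF) (constF true ,F constF true ,F sndF ∘F fstF ∘F fstF))

-- The depth `d` is fixed with the problem, so the recursion on it is unrolled into the program, and
-- a polynomial bound is composed a constant number of times.
exactF : ∀ d → FP (gatesT `× nat) polynomialT (λ (gs , x) → exact d gs x)
exactF zero    = literalF (monusF sndF (lengthF fstF))
exactF (suc d) = caseListF (dropF sndF fstF) (literalF (monusF sndF (lengthF fstF)))
  (complementIfF (fstF ∘F parsed) (fold₂F (constF one) (*ₚF v1 v0)
    (mapF (complementIfF (fstF ∘F sndF ∘F parsed ∘F fstF) (exactF d ∘F (sndF ∘F v0 ∘F fstF ,F v0))) (sndF ∘F sndF ∘F parsed))))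
  where
  parsed : ∀ {Γ} → FP (Γ `× (nat `× list nat) `× gatesT) (bool `× bool `× list nat) (λ (_ , g , _) → parse g)
  parsed = parseF ∘F fstF ∘F sndF

literalListF : ∀ {Γ x} → FP Γ nat x → FP Γ decisionT (λ γ → literalList (x γ))
literalListF X = (literalF X ,F constF true) ∷F constF ((one , false) ∷ [])

flipIfF : ∀ {Γ b l} → FP Γ bool b → FP Γ decisionT l → FP Γ decisionT (λ γ → flipIf (b γ) (l γ))
flipIfF B L = mapF (fstF ∘F v0 ,F xorF (B ∘F fstF) (sndF ∘F v0)) L

∧ᴰF : ∀ {Γ l m} → FP Γ decisionT l → FP Γ decisionT m → FP Γ decisionT (λ γ → l γ ∧ᴰ m γ)
∧ᴰF L M = cartesianF (*ₚF (fstF ∘F v1) (fstF ∘F v0) ,F andF (sndF ∘F v1) (sndF ∘F v0)) L M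

ltF : ∀ {Γ m n} → FP Γ nat m → FP Γ nat n → FP Γ bool (λ γ → m γ <ᵇ n γ)
ltF {m = m} {n} M N = ≗FP (λ γ → lemma (m γ) (n γ)) (caseNatF (monusF N M) (constF false) (constF true))
  where
  lemma : ∀ m n → caseNat (n ∸ m) false (λ _ → true) ≡ (m <ᵇ n)
  lemma zero    zero    = refl
  lemma zero    (suc n) = refl
  lemma (suc m) zero    = refl
  lemma (suc m) (suc n) = lemma m n

decisionsF : ∀ d → FP (gatesT `× nat) decisionT (λ (gs , x) → decisions d gs x)
decisionsF zero    = literalListF (monusF sndF (lengthF fstF))
decisionsF (suc d) = caseListF (dropF sndF fstF) (literalListF (monusF sndF (lengthF fstF)))
  (ifF (ltF (constF 2) (lengthF (sndF ∘F sndF ∘F parsed)))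
    ((concatMapF (complementIfF (notF (fstF ∘F sndF ∘F parsed ∘F fstF)) (exactF d ∘F (sndF ∘F v0 ∘F fstF ,F v0))) (sndF ∘F sndF ∘F parsed)
        ,F fstF ∘F parsed)
      ∷F (constF one ,F notF (fstF ∘F parsed)) ∷F []F)
    (flipIfF (fstF ∘F parsed) (fold₂F (constF ((one , true) ∷ [])) (∧ᴰF v1 v0)
      (mapF (flipIfF (fstF ∘F sndF ∘F parsed ∘F fstF) (decisionsF d ∘F (sndF ∘F v0 ∘F fstF ,F v0))) (sndF ∘F sndF ∘F parsed)))))
  where
  parsed : ∀ {Γ} → FP (Γ `× (nat `× list nat) `× gatesT) (bool `× bool `× list nat) (λ (_ , g , _) → parse g)
  parsed = parseF ∘F fstF ∘F sndF

flattenF : ∀ k → FP decisionT polynomialT (flatten k)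
flattenF zero    = []F
flattenF (suc k) = caseListF idF []F
  (appendF (*ₚF (mapF (notF (sndF ∘F fstF ∘F v0 ∘F fstF) ,F []F) (constF (false , []) ∷F flattenF k ∘F sndF ∘F v0)) (fstF ∘F fstF ∘F v0))
           (flattenF k ∘F sndF ∘F v0))

polynomialF : ∀ d → FP (gatesT `× nat) polynomialT (λ (gs , x) → polynomial d gs x)
polynomialF d = flattenF (entries d) ∘F decisionsF d

tuplesF : ∀ {Γ xs} s → FP Γ (list nat) xs → FP Γ (list (list nat)) (λ γ → tuples s (xs γ))
tuplesF zero    X = constF ([] ∷ [])
tuplesF (suc s) X = []F ∷F concatMapF (mapF (v1 ∷F v0) (tuplesF s X ∘F fstF)) X

tupleCountF : ∀ {Γ k} s → FP Γ nat k → FP Γ nat (λ γ → tupleCount s (k γ))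
tupleCountF zero    K = constF 1
tupleCountF (suc s) K = sucF (mulF K (tupleCountF s K))

coefficientF : ∀ {Γ p a} b → FP Γ polynomialT p → FP Γ (list nat) a → FP Γ nat (λ γ → coefficient b (p γ) (a γ))
coefficientF b P A = sumF (mapF (ifF (andF (notF (xorF (constF b) (fstF ∘F v0))) (eqListF (sndF ∘F v0) (A ∘F fstF))) (constF 1) (constF 0)) P)

matchF : ∀ {Γ A c a b f g e} → FP Γ candidateT c → FP Γ A a → FP Γ A b → FP (Γ `× nat) A f → FP (Γ `× list nat) A g → FP Γ A e →
         FP Γ A (λ γ → match (c γ) (a γ) (b γ) (λ x → f (γ , x)) (λ x → g (γ , x)) (e γ))
matchF {c = c} {a} {b} {f} {g} {e} C A B F G E = ≗FP (λ γ → lemma γ (c γ))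
  (caseSumF C (A ∘F fstF) (caseSumF v0 (B ∘F fstF ∘F fstF) (caseSumF v0 (F ∘F (fstF ∘F fstF ∘F fstF ,F v0))
    (caseSumF v0 (G ∘F (fstF ∘F fstF ∘F fstF ∘F fstF ,F v0)) (E ∘F fstF ∘F fstF ∘F fstF ∘F fstF)))))
  where
  lemma : ∀ γ (c : Candidate) → [ (λ _ → a γ) , [ (λ _ → b γ) , [ (λ x → f (γ , x)) , [ (λ x → g (γ , x)) , (λ _ → e γ) ] ] ] ] c
                              ≡ match c (a γ) (b γ) (λ x → f (γ , x)) (λ x → g (γ , x)) (e γ)
  lemma γ dummy      = refl
  lemma γ toll       = refl
  lemma γ (vertex x) = refl
  lemma γ (tuple x)  = refl
  lemma γ favourite  = refl

module _ (s : ℕ) where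

  open Reduction

  private
    Γ : Ty
    Γ = (nat `× nat) `× polynomialT

    nF : FP Γ nat (λ ((n , k) , P) → n)
    nF = fstF ∘F fstF

    kF : FP Γ nat (λ ((n , k) , P) → k)
    kF = sndF ∘F fstF

    tsF : FP Γ (list (list nat)) (λ ((n , k) , P) → ts n k s P)
    tsF = tuplesF (suc s) (upToF nF)

    κF : FP Γ nat (λ ((n , k) , P) → κ n k s P)
    κF = addF kF (tupleCountF (suc s) kF)

    baseF : FP Γ nat (λ ((n , k) , P) → base n k s P)
    baseF = sumF (mapF (coefficientF false (sndF ∘F fstF) v0) tsF)

    feeF : FP Γ nat (λ ((n , k) , P) → fee n k s P)
    feeF = sucF (mulF (tupleCountF (suc s) kF) baseF)

    budgetF : FP Γ nat (λ ((n , k) , P) → budget n k s P)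
    budgetF = sumF (mapF (addF (baseF ∘F fstF) (coefficientF false (sndF ∘F fstF) v0)) tsF)

    bodyF : FP Γ (list candidateT) (λ ((n , k) , P) → body n k s P)
    bodyF = appendF (mapF (constF dummy) (unitsF κF))
      (constF toll ∷F appendF (mapF (inj₂F (inj₂F (inj₁F v0))) (upToF nF)) (mapF (inj₂F (inj₂F (inj₂F (inj₁F v0)))) tsF))

    costF : FP ((Γ `× candidateT) `× candidateT) nat (λ ((((n , k) , P) , c) , d) → cost n k s P c d)
    costF = matchF v1
      (matchF v0 (constF 0) (sucF (budgetF ∘F fstF ∘F fstF)) (constF 0) (constF 0) (constF 0))
      (matchF v0 (constF 0) (constF 0) (constF 0) (coefficientF true (sndF ∘F fstF ∘F fstF ∘F fstF) v0) (feeF ∘F fstF ∘F fstF))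
      (matchF v1 (constF 0) (constF 0) (constF 0) (ifF (memberF v1 v0) (sucF (budgetF ∘F fstF ∘F fstF ∘F fstF ∘F fstF)) (constF 0)) (constF 0))
      (matchF v1 (constF 0) (constF 0) (constF 0) (constF 0) (addF (baseF ∘F fstF ∘F fstF ∘F fstF) (coefficientF false (sndF ∘F fstF ∘F fstF ∘F fstF) v0)))
      (constF 0)

  instanceT : Ty
  instanceT = nat `× list (list nat) `× nat `× list (list (list bin)) `× bin

  -- The initial vote is the identity, so its list of candidates is `upTo`; the favourite is the
  -- last candidate and has number `length b`.
  reduced : ⟦ Γ ⟧ → ⟦ instanceT `× nat ⟧
  reduced ((n , k) , P) =
    let b  = body n k s P
        cs = b ++ favourite ∷ []
    in (length cs , upTo (length cs) ∷ [] , length b , map (λ c → map (λ d → cost n k s P c d) cs) cs ∷ [] , budget n k s P) , suc (κ n k s P)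

  outputF : FP Γ (instanceT `× nat) reduced
  outputF = (lengthF candidatesF ,F upToF (lengthF candidatesF) ∷F []F ,F lengthF bodyF
      ,F mapF (mapF (toBinaryF costF) (candidatesF ∘F fstF)) candidatesF ∷F []F ,F toBinaryF budgetF) ,F sucF κF
    where
    candidatesF : FP Γ (list candidateT) (λ ((n , k) , P) → body n k s P ++ favourite ∷ [])
    candidatesF = appendF bodyF (constF (favourite ∷ []))

-- Codes and equivalence of the instances

open Problem

rawGate-code : ∀ {j} (g : Gate j) → enc (nat `× list nat) (rawGate g) ≡ gateCode g
rawGate-code (NOT i)  = cong (node leaf) (lemma (toℕ i))
  where
  lemma : ∀ n → enc (list nat) (replicate n 0) ≡ unary n
  lemma zero    = refl
  lemma (suc n) = cong (node leaf) (lemma n)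
rawGate-code (AND is) = cong (λ l → node (unary 1) (listTree l)) (sym (map-∘ is))
rawGate-code (OR is)  = cong (λ l → node (unary 2) (listTree l)) (sym (map-∘ is))

rawGates-code : ∀ {n j} (C : Circuit n j) → enc gatesT (rawGates C) ≡ listTree (gateCodes C)
rawGates-code inputs  = refl
rawGates-code (C ▹ g) = cong₂ node (rawGate-code g) (rawGates-code C)

circuitT : Ty
circuitT = nat `× gatesT `× nat

raw : ∀ {t d} → WCSInstance t d → ⟦ circuitT `× nat ⟧
raw I = (variables , rawGates circuit , toℕ output) , weight
  where open WCSInstance I

raw-code : ∀ {t d} (I : WCSInstance t d) → enc (circuitT `× nat) (raw I) ≡ input (WeightedCircuitSat t d) I
raw-code I = cong (λ c → node (node (unary variables) (node c (unary (toℕ output)))) (unary weight)) (rawGates-code circuit)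
  where open WCSInstance I

tabulate-toℕ : ∀ {A : Set} (g : ℕ → A) n → tabulate {n = n} (λ i → g (toℕ i)) ≡ applyUpTo g n
tabulate-toℕ g zero    = refl
tabulate-toℕ g (suc n) = cong (g 0 ∷_) (tabulate-toℕ (g ∘ suc) n)

module _ (d : ℕ) where

  private
    s : ℕ
    s = 2 ^ d

    W B : Problem
    W = WeightedCircuitSat 1 d
    B = restrict SwapBribery OneVote

  translate : ⟦ circuitT `× nat ⟧ → ⟦ instanceT s `× nat ⟧
  translate ((n , gs , x) , k) = reduced s ((n , k) , polynomial d gs x)

  translateF : FP (circuitT `× nat) (instanceT s `× nat) translate
  translateF = outputF s ∘F ((fstF ∘F fstF ,F sndF) ,F polynomialF d ∘F sndF ∘F fstF)

  module _ (I : Instance W) where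

    open WCSInstance I

    private
      P : Polynomial
      P = polynomial d (rawGates circuit) (toℕ output)

      module R = Reduction variables weight s P

      wf : WellFormed (suc s) variables P
      wf = weaken-wf (n≤1+n s) (polynomial-wf d circuit output depth≤)

    bribery : Instance B
    bribery = oneVote R.body favourite R.cost R.budget R.κ , refl

    private
      cands : List Candidate
      cands = R.body ++ favourite ∷ []

      length-cands : length cands ≡ suc (length R.body)
      length-cands = trans (length-++ R.body) (+-comm _ 1)

      row : Candidate → List Tree
      row c = tabulate (λ b → binary (R.cost c (at R.body favourite (toℕ {suc (length R.body)} b))))

      row-code : ∀ c → map (enc bin) (map (R.cost c) cands) ≡ row c
      row-code c = trans (sym (map-∘ cands)) (trans (cong (map (λ e → binary (R.cost c e))) (sym (tabulate-at R.body favourite)))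
        (map-tabulate (λ b → at R.body favourite (toℕ b)) (λ e → binary (R.cost c e))))

      rows-code : map (enc (list bin)) (map (λ c → map (R.cost c) cands) cands)
                  ≡ tabulate (λ a → listTree (row (at R.body favourite (toℕ {suc (length R.body)} a))))
      rows-code = trans (sym (map-∘ cands)) (trans (cong (map (λ c → enc (list bin) (map (R.cost c) cands))) (sym (tabulate-at R.body favourite)))
        (trans (map-tabulate (λ a → at R.body favourite (toℕ a)) (λ c → enc (list bin) (map (R.cost c) cands)))
               (tabulate-cong (λ a → cong listTree (row-code (at R.body favourite (toℕ a)))))))

      vote-code : map (enc nat) (upTo (length cands)) ≡ tabulate {n = suc (length R.body)} (λ r → unary (toℕ r))
      vote-code = trans (map-upTo unary (length cands)) (trans (cong (applyUpTo unary) length-cands) (sym (tabulate-toℕ unary _)))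

    translate-code : enc (instanceT s `× nat) (translate (raw I)) ≡ input B bribery
    translate-code = cong (λ c → node c (unary (suc R.κ)))
      (cong₂ node (cong unary length-cands)
      (cong₂ node (cong (λ l → node (listTree l) leaf) vote-code)
      (cong₂ node (cong unary (sym (toℕ-fromℕ (length R.body))))
      (cong₂ node (cong (λ l → node (listTree l) leaf) rows-code) refl))))

    translate-correct : Yes W I ⇔ Yes B bribery
    translate-correct = mk⇔ to from
      where
      to : Yes W I → Yes B bribery
      to (S , size , accepts) = let (ls , o) = R.accepted⇒outcome wf χ (trans (sym (∣∣-count S χ (λ i → i) agrees)) size , positive)
                                in outcome⇒bribery _ _ _ _ _ ls o
        where
        χ : ℕ → Bool
        χ = at (Vec.toList S) false
        agrees′ : ∀ {n} (S : Subset n) i → lookup S i ≡ at (Vec.toList S) false (toℕ i)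
        agrees′ (b Vec.∷ S) zero    = refl
        agrees′ (b Vec.∷ S) (suc i) = agrees′ S i
        agrees : ∀ i → lookup S i ≡ χ (toℕ i)
        agrees = agrees′ S
        positive : 0ℤ ℤ.< ⟪ P ⟫ χ
        positive = subst (λ b → HasSign χ b (⟪ P ⟫ χ)) accepts (polynomial-sign d circuit output depth≤ weft≤ S χ agrees)
      from : Yes B bribery → Yes W I
      from bribed =
        let (χ , size , positive) = R.outcome⇒accepted wf (bribery⇒outcome _ _ _ _ _ bribed)
            S = Vec.tabulate (χ ∘ toℕ)
            agrees = lookup∘tabulate (χ ∘ toℕ)
        in S , trans (∣∣-count S χ (λ i → i) agrees) size ,
           accepts χ (value circuit S output) (polynomial-sign d circuit output depth≤ weft≤ S χ agrees) positive
        where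
        accepts : ∀ χ b → HasSign χ b (⟪ P ⟫ χ) → 0ℤ ℤ.< ⟪ P ⟫ χ → b ≡ true
        accepts χ true  _ _ = refl
        accepts χ false p q = contradiction q (ℤₚ.<-asym p)

-- Composition with a given reduction

powerF : ∀ {Γ m} c → FP Γ nat m → FP Γ nat (λ γ → m γ ^ c)
powerF zero    M = constF 1
powerF (suc c) M = mulF M (powerF c M)

Computable-∘ : ∀ {f g} → FP nat nat g → Computable f → Computable (λ n → g (f n))
Computable-∘ {f} G (P , runs) = P ⨾ FP.prog G , λ n →
  let (_ , d)     = runs n
      (_ , e , _) = FP.runs G (f n)
  in _ , ⇓⨾ d e

-- The intermediate instance is no larger than the time spent on it. The translation is therefore
-- polynomial in that time, and a power of `f * n ^ c` again separates into a factor of the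
-- parameter and a power of `n`.
≤fpt-polynomial : ∀ {L W V A C φ h} → L ≤fpt W → FP A C φ → FP nat nat h →
  (∀ I → ∃[ a ] ∃[ J ] enc A a ≡ input W I × enc C (φ a) ≡ input V J × (Yes W I ⇔ Yes V J) × param V J ≡ h (param W I)) →
  L ≤fpt V
≤fpt-polynomial {L} {W} {V} {A} {C} {φ} {h} R F H translation = record
  { program      = R.program ⨾ FP.prog F
  ; f            = λ k → (2 + a) * R.f k ^ suc c
  ; g            = λ k → h (R.g k)
  ; c            = R.c * suc c
  ; f-computable = Computable-∘ (mulF (constF (2 + a)) (powerF (suc c) idF)) R.f-computable
  ; g-computable = Computable-∘ H R.g-computable
  ; reduces      = reduces
  }
  where
  module R = _≤fpt_ R
  q = FP.bound F
  a = proj₁ (eval-polynomial q)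
  c = proj₁ (proj₂ (eval-polynomial q))

  time-bound : ∀ f {t u v n} → 1 ≤ t → t ≤ f * n ^ R.c → u ≤ eval q v → v ≤ t →
               suc (t + u) ≤ ((2 + a) * f ^ suc c) * n ^ (R.c * suc c)
  time-bound f {t} {u} {v} {n} 1≤t t≤ u≤ v≤t = begin
    suc (t + u)                                  ≤⟨ s≤s (+-monoʳ-≤ t (≤-trans u≤ (eval-mono q v≤t))) ⟩
    suc (t + eval q t)                       ≤⟨ s≤s (+-monoʳ-≤ t (proj₂ (proj₂ (eval-polynomial q)) t 1≤t)) ⟩
    -- As `t` is at least 1, all three summands are below multiples of the common power `t ^ suc c`.
    1 + (t + a * t ^ c)                          ≤⟨ +-mono-≤ (^≥1 1≤t (suc c)) (+-mono-≤ t≤t^ (*-monoʳ-≤ a (^-exponent-mono 1≤t (n≤1+n c)))) ⟩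
    (2 + a) * t ^ suc c                          ≤⟨ *-monoʳ-≤ (2 + a) (^-monoˡ-≤ (suc c) t≤) ⟩
    (2 + a) * (f * n ^ R.c) ^ suc c              ≡⟨ cong ((2 + a) *_) (^-*-distrib f (n ^ R.c) (suc c)) ⟩
    (2 + a) * (f ^ suc c * (n ^ R.c) ^ suc c)    ≡⟨ cong (λ m → (2 + a) * (f ^ suc c * m)) (^-*-assoc n R.c (suc c)) ⟩
    (2 + a) * (f ^ suc c * n ^ (R.c * suc c))    ≡⟨ *-assoc (2 + a) (f ^ suc c) _ ⟨
    ((2 + a) * f ^ suc c) * n ^ (R.c * suc c)    ∎
    where
    open ≤-Reasoning
    t≤t^ : t ≤ t ^ suc c
    t≤t^ = ≤-trans (≤-reflexive (sym (*-identityʳ t))) (*-monoʳ-≤ t (^≥1 1≤t c))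

  reduces : ∀ I → ∃[ J ] ∃[ t ] (R.program ⨾ FP.prog F) ∙ input L I ⇓ input V J ⟨ t ⟩
                 × t ≤ ((2 + a) * R.f (param L I) ^ suc c) * size (code L I) ^ (R.c * suc c)
                 × (Yes L I ⇔ Yes V J)
                 × param V J ≡ h (R.g (param L I))
  reduces I =
    let (J , t , run , t≤ , L⇔W , paramJ) = R.reduces I
        (x , K , codeJ , codeK , W⇔V , paramK) = translation J
        (u , run′ , u≤) = FP.runs F x
        x≤t = ≤-trans (≤-reflexive (cong size codeJ)) (size≤time run)
    in K , suc (t + u) ,
       ⇓⨾ run (subst₂ (λ x y → FP.prog F ∙ x ⇓ y ⟨ u ⟩) codeJ codeK run′) ,
       time-bound (R.f (param L I)) (≤-trans (size≥1 (enc A x)) x≤t) t≤ u≤ x≤t ,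
       mk⇔ (Equivalence.to W⇔V ∘ Equivalence.to L⇔W) (Equivalence.from L⇔W ∘ Equivalence.from W⇔V) ,
       trans paramK (cong h paramJ)

theorem7 : W[ 1 ]-Hard (restrict SwapBribery OneVote)
theorem7 L (d , R) = ≤fpt-polynomial R (translateF d)
  -- The new parameter `suc (k + N)` depends on the weight `k` and the fixed depth only.
  (sucF (addF idF (tupleCountF (suc (2 ^ d)) idF)))
  (λ I → raw I , bribery d I , raw-code I , translate-code d I , translate-correct d I , refl)
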